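{- Let $n,\ell$ be two positive integers. Let $A$ be the set of hook permutations $(H,\sigma)$ of size $n$ and length $\ell$, regarded as a signed set all of whose elements are positive. Let $B$ be the set of pairs $(P,Q)$ of ribbon tableaux of size $n$ and length $\ell$ having the same shape, regarded as a signed set with sign $\varepsilon(P)\varepsilon(Q)$. Then there exists a signed bijection $(\mathrm{Id},i,\phi)$ between $A$ and $B$, i.e. there exist an involution $i:B\to B$ which reverses signs outside of its fixed point set $\mathrm{Fix}(i)$, and a sign preserving bijection $\phi:A\to \mathrm{Fix}(i)$. Moreover, $i$ and $\phi$ can be chosen so that contents are preserved, in the following sense: if $i(P,Q)=(P_1,Q_1)$, then $c(P)=c(P_1)$ and $c(Q)=c(Q_1)$; and if $\phi(H,\sigma)=(P,Q)$, then $c(H)=c(Q)$ and $c(H,\sigma)=c(P)$.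
   Context: Partitions are identified with their Ferrers diagrams (left-justified sets of cells, the $i$th row from the top having $\lambda_i$ cells); $|\lambda|$ is the number of cells. For $\lambda\subseteq\mu$, the skew shape $\mu/\lambda$ is identified with the set of cells $\mu\setminus\lambda$, and its size $|\mu/\lambda|$ is its number of cells. A ribbon is a connected skew shape (any two cells are joined by a sequence of its cells in which consecutive cells share a side) containing no $2\times 2$ square of cells. The height $h(r)$ of a nonempty ribbon $r$ is the number of rows it occupies minus one, and its sign is $\varepsilon(r)=(-1)^{h(r)}$. A ribbon tableau of shape $\lambda$ and length $\ell$ is a sequence of partitions $\emptyset=\lambda^0\subset\lambda^1\subset\cdots\subset\lambda^\ell=\lambda$ such that each $r_i=\lambda^{i+1}/\lambda^i$ ($0\le i<\ell$) is a nonempty ribbon. Its size is $|\lambda|$; its sign $\varepsilon(P)$ is the product of the signs of the ribbons $r_i$; its content $c(P)$ is the composition $(|r_0|,\ldots,|r_{\ell-1}|)$ of $|\lambda|$. A hook is a nonempty partition of the form $(k,1,\ldots,1)$; it is characterized by its size $s\geq 1$ and its height $h\in\{0,\ldots,s-1\}$ (number of rows minus one). A hook permutation of length $\ell$ is a pair $(H,\sigma)$ where $H=(H_1,\ldots,H_\ell)$ is a sequence of $\ell$ hooks and $\sigma$ is a permutation of $\{1,\ldots,\ell\}$; its size is $\sum_i|H_i|$. Put $c(H)=(|H_1|,\ldots,|H_\ell|)$ and $c(H,\sigma)=(|H_{\sigma(1)}|,\ldots,|H_{\sigma(\ell)}|)$. A signed set is a finite set together with a function to $\{1,-1\}$ (its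 sign). A signed bijection between signed sets $A$ and $B$ is a triple $(i_A,i_B,\phi)$ where $i_A$ (resp. $i_B$) is an involution on $A$ (resp. $B$) that is sign reversing outside its fixed point set, and $\phi$ is a sign preserving bijection from $\mathrm{Fix}(i_A)$ to $\mathrm{Fix}(i_B)$. -}

module Defs where

open import Data.Fin.Base using (Fin; zero; suc; toℕ; fromℕ; fromℕ<; inject₁; funToFin; finToFun; combine)
open import Data.Fin.Induction using (>-weakInduction)
import Data.Fin.Permutation as Perm
open import Data.Fin.Permutation using (Permutation′; _⟨$⟩ʳ_)
open import Data.Fin.Properties using (toℕ-fromℕ<; finToFun-funToFin; combine-injective)
open import Data.List.Base using (List; []; _∷_; _++_; map; length; upTo; filter; deduplicate; replicate)
open import Data.List.Properties using (length-++; length-map; length-upTo)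
open import Data.List.Relation.Unary.All using (All; []; _∷_; all?)
open import Data.List.Relation.Unary.Linked using (Linked; [])
open import Data.Nat.Base using (ℕ; zero; suc; _+_; _∸_; _^_; _≤_; _<_; _≥_; _>_; z≤n; s≤s; ∣_-_∣; _⊓_)
open import Data.Nat.ListAction using (sum)
open import Data.Nat.Properties using (_≟_; _<?_; m⊓n≤n; m≤n⇒m⊓n≡m; m≤m+n; m≤n⇒m≤o+n; +-mono-≤; ≤-trans; ≤-reflexive; ≮⇒≥; n≤0⇒n≡0)
open import Data.Product.Base using (Σ-syntax; ∃; ∃₂; _×_; _,_; proj₁; proj₂)
open import Data.Sign.Base as Sign using (Sign)
open import Data.Sum.Base using (_⊎_)
open import Data.Vec.Functional using (Vector; foldr)
open import Function.Base using (_∘_)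
open import Function.Bundles using (Injection; Bijection)
open import Level using (0ℓ)
open import Relation.Binary.Bundles using (Setoid)
open import Relation.Binary.Construct.Closure.ReflexiveTransitive using (Star)
import Relation.Binary.Construct.On as On
open import Relation.Binary.PropositionalEquality using (_≡_; refl; sym; trans; cong; cong₂; subst; subst₂; setoid; _≗_)
open import Relation.Nullary using (¬_; Dec; yes; no; ¬?; recompute)

-- The proofs are irrelevant, so that partitions with equal rows are equal.
record Partition : Set where
  constructor mkPartition
  field
    rows        : List ℕ
    .decreasing : Linked _≥_ rows
    .positive   : All (_> 0) rows

open Partition public using (rows)

∅ : Partition
∅ = mkPartition [] [] []

-- Row and column indices start at 0; rows beyond the last have length 0.
rowLength : List ℕ → ℕ → ℕ
rowLength []       _       = 0
rowLength (x ∷ xs) zero    = x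
rowLength (x ∷ xs) (suc i) = rowLength xs i

Cell : Set
Cell = ℕ × ℕ

infix 4 _∈_ _∈?_ _⊆_

_∈_ : Cell → Partition → Set
(i , j) ∈ μ = j < rowLength (rows μ) i

_∈?_ : ∀ c μ → Dec (c ∈ μ)
(i , j) ∈? μ = j <? rowLength (rows μ) i

_⊆_ : Partition → Partition → Set
ν ⊆ μ = ∀ c → c ∈ ν → c ∈ μ

top : ℕ → Cell
top j = (0 , j)

firstRow : ℕ → List Cell
firstRow x = map top (upTo x)

down : Cell → Cell
down (i , j) = (suc i , j)

cellsOfRows : List ℕ → List Cell
cellsOfRows []       = []
cellsOfRows (x ∷ xs) = firstRow x ++ map down (cellsOfRows xs)

cells : Partition → List Cell
cells μ = cellsOfRows (rows μ)

∣_∣ : Partition → ℕ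
∣ μ ∣ = length (cells μ)

infix 4 _∈_∖_

_∈_∖_ : Cell → Partition → Partition → Set
c ∈ μ ∖ ν = c ∈ μ × ¬ (c ∈ ν)

skewCells : Partition → Partition → List Cell
skewCells μ ν = filter (λ c → ¬? (c ∈? ν)) (cells μ)

∣_∖_∣ : Partition → Partition → ℕ
∣ μ ∖ ν ∣ = length (skewCells μ ν)

ShareSide : Cell → Cell → Set
ShareSide (i , j) (i′ , j′) =
  (i ≡ i′ × ∣ j - j′ ∣ ≡ 1) ⊎ (∣ i - i′ ∣ ≡ 1 × j ≡ j′)

Step : Partition → Partition → Cell → Cell → Set
Step μ ν c d = c ∈ μ ∖ ν × d ∈ μ ∖ ν × ShareSide c d

Connected : Partition → Partition → Set
Connected μ ν = ∀ c d → c ∈ μ ∖ ν → d ∈ μ ∖ ν → Star (Step μ ν) c d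

NoSquare : Partition → Partition → Set
NoSquare μ ν = ∀ i j →
  ¬ ((i , j) ∈ μ ∖ ν × (i , suc j) ∈ μ ∖ ν × (suc i , j) ∈ μ ∖ ν × (suc i , suc j) ∈ μ ∖ ν)

record IsNonemptyRibbon (μ ν : Partition) : Set where
  field
    inner⊆outer : ν ⊆ μ
    nonempty    : ∃ λ c → c ∈ μ ∖ ν
    connected   : Connected μ ν
    noSquare    : NoSquare μ ν

height : Partition → Partition → ℕ
height μ ν = length (deduplicate _≟_ (map proj₁ (skewCells μ ν))) ∸ 1

[-1]^_ : ℕ → Sign
[-1]^ zero  = Sign.+
[-1]^ suc h = Sign.- Sign.* ([-1]^ h)

ribbonSign : Partition → Partition → Sign
ribbonSign μ ν = [-1]^ height μ ν

record RibbonTableau (shape : Partition) (ℓ : ℕ) : Set where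
  field
    chain  : Vector Partition (suc ℓ)
    start  : chain zero ≡ ∅
    end    : chain (fromℕ ℓ) ≡ shape
    ribbon : ∀ (i : Fin ℓ) → IsNonemptyRibbon (chain (suc i)) (chain (inject₁ i))

open RibbonTableau public

chainSign : ∀ {ℓ} → Vector Partition (suc ℓ) → Sign
chainSign ch = foldr Sign._*_ Sign.+ (λ i → ribbonSign (ch (suc i)) (ch (inject₁ i)))

tableauSign : ∀ {μ ℓ} → RibbonTableau μ ℓ → Sign
tableauSign P = chainSign (chain P)

tableauContent : ∀ {μ ℓ} → RibbonTableau μ ℓ → Vector ℕ ℓ
tableauContent P i = ∣ chain P (suc i) ∖ chain P (inject₁ i) ∣

record TableauPair (n ℓ : ℕ) : Set where
  field
    shape     : Partition
    P Q       : RibbonTableau shape ℓ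
    shapeSize : ∣ shape ∣ ≡ n

open TableauPair public

-- A tableau is its sequence of partitions: the ribbon proofs, and the shape
-- (which is the last partition), are not compared.
TableauPair-setoid : ℕ → ℕ → Setoid 0ℓ 0ℓ
TableauPair-setoid n ℓ = record
  { Carrier       = TableauPair n ℓ
  ; _≈_           = λ b b′ → chain (P b) ≗ chain (P b′) × chain (Q b) ≗ chain (Q b′)
  ; isEquivalence = record
    { refl  = (λ _ → refl) , (λ _ → refl)
    ; sym   = λ (p , q) → (λ i → sym (p i)) , (λ i → sym (q i))
    ; trans = λ (p , q) (p′ , q′) → (λ i → trans (p i) (p′ i)) , (λ i → trans (q i) (q′ i))
    }
  }

record Hook : Set where
  field
    partition : Partition
    isHook    : ∃₂ λ k m → rows partition ≡ k ∷ replicate m 1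

open Hook public

sumᵛ : ∀ {ℓ} → Vector ℕ ℓ → ℕ
sumᵛ = foldr _+_ 0

hookSizes : ∀ {ℓ} → Vector Hook ℓ → Vector ℕ ℓ
hookSizes H i = ∣ partition (H i) ∣

record HookPermutation (n ℓ : ℕ) : Set where
  field
    H        : Vector Hook ℓ
    σ        : Permutation′ ℓ
    hookSize : sumᵛ (hookSizes H) ≡ n

open HookPermutation public

hookContent : ∀ {n ℓ} → HookPermutation n ℓ → Vector ℕ ℓ
hookContent a = hookSizes (H a)

permutedHookContent : ∀ {n ℓ} → HookPermutation n ℓ → Vector ℕ ℓ
permutedHookContent a i = hookSizes (H a) (σ a ⟨$⟩ʳ i)

HookPermutation-setoid : ℕ → ℕ → Setoid 0ℓ 0ℓ
HookPermutation-setoid n ℓ = record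
  { Carrier       = HookPermutation n ℓ
  ; _≈_           = λ a a′ → (partition ∘ H a) ≗ (partition ∘ H a′) × σ a Perm.≈ σ a′
  ; isEquivalence = record
    { refl  = (λ _ → refl) , (λ _ → refl)
    ; sym   = λ (p , q) → (λ i → sym (p i)) , (λ i → sym (q i))
    ; trans = λ (p , q) (p′ , q′) → (λ i → trans (p i) (p′ i)) , (λ i → trans (q i) (q′ i))
    }
  }

-- Finiteness as embeddability in some Fin N: no decision procedure for the
-- image of the embedding is required.
Finite : Setoid 0ℓ 0ℓ → Set
Finite S = ∃ λ N → Injection S (setoid (Fin N))

record SignedSet : Set₁ where
  field
    elements  : Setoid 0ℓ 0ℓ
    finite    : Finite elements
  open Setoid elements public using (Carrier; _≈_)
  field
    sign      : Carrier → Sign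
    sign-cong : ∀ {x y} → x ≈ y → sign x ≡ sign y

record SignReversingInvolution (A : SignedSet) : Set where
  open SignedSet A
  field
    to             : Carrier → Carrier
    to-cong        : ∀ {x y} → x ≈ y → to x ≈ to y
    involutive     : ∀ x → to (to x) ≈ x
    sign-reversing : ∀ x → ¬ (to x ≈ x) → sign (to x) ≡ Sign.opposite (sign x)

  Fix : Setoid 0ℓ 0ℓ
  Fix = On.setoid {B = Σ[ x ∈ Carrier ] to x ≈ x} elements proj₁

record SignedBijection (A B : SignedSet) : Set where
  open SignedSet
  open SignReversingInvolution
  field
    ιA : SignReversingInvolution A
    ιB : SignReversingInvolution B
    φ  : Bijection (Fix ιA) (Fix ιB)
    φ-sign : ∀ x → sign B (proj₁ (Bijection.to φ x)) ≡ sign A (proj₁ x)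

length-cellsOfRows : ∀ xs → length (cellsOfRows xs) ≡ sum xs
length-cellsOfRows []       = refl
length-cellsOfRows (x ∷ xs) = trans
  (length-++ (firstRow x))
  (cong₂ _+_
    (trans (length-map top (upTo x)) (length-upTo x))
    (trans (length-map down (cellsOfRows xs)) (length-cellsOfRows xs)))

rowLength≤sum : ∀ xs i → rowLength xs i ≤ sum xs
rowLength≤sum []       i       = z≤n
rowLength≤sum (x ∷ xs) zero    = m≤m+n x (sum xs)
rowLength≤sum (x ∷ xs) (suc i) = m≤n⇒m≤o+n x (rowLength≤sum xs i)

rowLength-beyond : ∀ xs i → length xs ≤ i → rowLength xs i ≡ 0
rowLength-beyond []       i       _       = refl
rowLength-beyond (x ∷ xs) (suc i) (s≤s p) = rowLength-beyond xs i p

length≤sum : ∀ {xs} → All (_> 0) xs → length xs ≤ sum xs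
length≤sum []       = z≤n
length≤sum (p ∷ ps) = +-mono-≤ p (length≤sum ps)

rowLength-injective : ∀ {xs ys} → All (_> 0) xs → All (_> 0) ys →
  rowLength xs ≗ rowLength ys → xs ≡ ys
rowLength-injective []       []       e = refl
rowLength-injective []       (q ∷ qs) e with () ← subst (_> 0) (sym (e 0)) q
rowLength-injective (p ∷ ps) []       e with () ← subst (_> 0) (e 0) p
rowLength-injective (p ∷ ps) (q ∷ qs) e =
  cong₂ _∷_ (e 0) (rowLength-injective ps qs (e ∘ suc))

positive : ∀ μ → All (_> 0) (rows μ)
positive (mkPartition xs _ p) = recompute (all? (0 <?_) xs) p

rows-injective : ∀ {μ ν} → rows μ ≡ rows ν → μ ≡ ν
rows-injective {mkPartition _ _ _} {mkPartition _ _ _} refl = refl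

FitsIn : ℕ → Partition → Set
FitsIn n μ = (∀ i → rowLength (rows μ) i ≤ n) × (∀ i → n ≤ i → rowLength (rows μ) i ≡ 0)

fitsIn-size : ∀ {n} μ → ∣ μ ∣ ≤ n → FitsIn n μ
fitsIn-size μ ∣μ∣≤n =
  (λ i → ≤-trans (rowLength≤sum (rows μ) i) s≤n) ,
  (λ i n≤i → rowLength-beyond (rows μ) i (≤-trans (length≤sum (positive μ)) (≤-trans s≤n n≤i)))
  where
  s≤n = ≤-trans (≤-reflexive (sym (length-cellsOfRows (rows μ)))) ∣μ∣≤n

⊆⇒rowLength≤ : ∀ {μ ν} → ν ⊆ μ → ∀ i → rowLength (rows ν) i ≤ rowLength (rows μ) i
⊆⇒rowLength≤ {μ} {ν} ν⊆μ i with rowLength (rows ν) i in eq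
... | zero  = z≤n
... | suc j = ν⊆μ (i , j) (≤-reflexive (sym eq))

fitsIn-⊆ : ∀ {n μ ν} → ν ⊆ μ → FitsIn n μ → FitsIn n ν
fitsIn-⊆ {n} {μ} {ν} ν⊆μ (short , few) =
  (λ i → ≤-trans (⊆⇒rowLength≤ {μ} {ν} ν⊆μ i) (short i)) ,
  (λ i n≤i → n≤0⇒n≡0 (≤-trans (⊆⇒rowLength≤ {μ} {ν} ν⊆μ i) (≤-reflexive (few i n≤i))))

funToFin-cong : ∀ {m n} {f g : Fin m → Fin n} → f ≗ g → funToFin f ≡ funToFin g
funToFin-cong {zero}  e = refl
funToFin-cong {suc m} e = cong₂ combine (e zero) (funToFin-cong (e ∘ suc))

funToFin-injective : ∀ {m n} {f g : Fin m → Fin n} → funToFin f ≡ funToFin g → f ≗ g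
funToFin-injective {f = f} {g} e i = trans
  (sym (finToFun-funToFin f i))
  (trans (cong (λ k → finToFun k i) e) (finToFun-funToFin g i))

truncate : ∀ n → ℕ → Fin (suc n)
truncate n m = fromℕ< (s≤s (m⊓n≤n m n))

truncate-injective : ∀ {n m m′} → m ≤ n → m′ ≤ n → truncate n m ≡ truncate n m′ → m ≡ m′
truncate-injective {n} {m} {m′} p p′ e = subst₂ _≡_
  (trans (toℕ-fromℕ< (s≤s (m⊓n≤n m n))) (m≤n⇒m⊓n≡m p))
  (trans (toℕ-fromℕ< (s≤s (m⊓n≤n m′ n))) (m≤n⇒m⊓n≡m p′))
  (cong toℕ e)

code : ∀ n → Partition → Fin (suc n ^ n)
code n μ = funToFin {n} (λ i → truncate n (rowLength (rows μ) (toℕ i)))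

code-injective : ∀ {n μ ν} → FitsIn n μ → FitsIn n ν → code n μ ≡ code n ν → μ ≡ ν
code-injective {n} {μ} {ν} (short , few) (short′ , few′) e =
  rows-injective (rowLength-injective (positive μ) (positive ν) same)
  where
  same : rowLength (rows μ) ≗ rowLength (rows ν)
  same i with i <? n
  ... | no  i≮n = trans (few i (≮⇒≥ i≮n)) (sym (few′ i (≮⇒≥ i≮n)))
  ... | yes i<n = subst (λ k → rowLength (rows μ) k ≡ rowLength (rows ν) k) (toℕ-fromℕ< i<n)
    (truncate-injective (short _) (short′ _) (funToFin-injective e (fromℕ< i<n)))

codes : ∀ n {k} → Vector Partition k → Fin ((suc n ^ n) ^ k)
codes n v = funToFin (code n ∘ v)

codes-cong : ∀ n {k} {v w : Vector Partition k} → v ≗ w → codes n v ≡ codes n w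
codes-cong n e = funToFin-cong (cong (code n) ∘ e)

codes-injective : ∀ {n k} {v w : Vector Partition k} →
  (∀ i → FitsIn n (v i)) → (∀ i → FitsIn n (w i)) → codes n v ≡ codes n w → v ≗ w
codes-injective fv fw e i = code-injective (fv i) (fw i) (funToFin-injective e i)

chain-fitsIn : ∀ {μ n ℓ} (T : RibbonTableau μ ℓ) → ∣ μ ∣ ≡ n → ∀ i → FitsIn n (chain T i)
chain-fitsIn {μ} {n} T e = >-weakInduction (λ i → FitsIn n (chain T i))
  (subst (FitsIn n) (sym (end T)) (fitsIn-size μ (≤-reflexive e)))
  (λ i → fitsIn-⊆ {n} {chain T (suc i)} {chain T (inject₁ i)}
    (IsNonemptyRibbon.inner⊆outer (ribbon T i)))

TableauPair-finite : ∀ n ℓ → Finite (TableauPair-setoid n ℓ)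
TableauPair-finite n ℓ = _ , record
  { to        = λ b → combine (codes n (chain (P b))) (codes n (chain (Q b)))
  ; cong      = λ (p , q) → cong₂ combine (codes-cong n p) (codes-cong n q)
  ; injective = λ {b} {b′} → inj b b′
  }
  where
  inj : ∀ (b b′ : TableauPair n ℓ) →
    combine (codes n (chain (P b))) (codes n (chain (Q b))) ≡
    combine (codes n (chain (P b′))) (codes n (chain (Q b′))) →
    chain (P b) ≗ chain (P b′) × chain (Q b) ≗ chain (Q b′)
  inj b b′ e with p , q ← combine-injective (codes n (chain (P b))) (codes n (chain (Q b)))
                            (codes n (chain (P b′))) (codes n (chain (Q b′))) e =
    codes-injective (chain-fitsIn (P b) (shapeSize b)) (chain-fitsIn (P b′) (shapeSize b′)) p ,
    codes-injective (chain-fitsIn (Q b) (shapeSize b)) (chain-fitsIn (Q b′) (shapeSize b′)) q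

≤sumᵛ : ∀ {ℓ} (v : Vector ℕ ℓ) i → v i ≤ sumᵛ v
≤sumᵛ v zero    = m≤m+n (v zero) _
≤sumᵛ v (suc i) = m≤n⇒m≤o+n (v zero) (≤sumᵛ (v ∘ suc) i)

hooks-fitIn : ∀ {n ℓ} (a : HookPermutation n ℓ) i → FitsIn n (partition (H a i))
hooks-fitIn a i = fitsIn-size (partition (H a i))
  (≤-trans (≤sumᵛ (hookContent a) i) (≤-reflexive (hookSize a)))

HookPermutation-finite : ∀ n ℓ → Finite (HookPermutation-setoid n ℓ)
HookPermutation-finite n ℓ = _ , record
  { to        = λ a → combine (codes n (partition ∘ H a)) (funToFin (σ a ⟨$⟩ʳ_))
  ; cong      = λ (p , q) → cong₂ combine (codes-cong n p) (funToFin-cong q)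
  ; injective = λ {a} {a′} → inj a a′
  }
  where
  inj : ∀ (a a′ : HookPermutation n ℓ) →
    combine (codes n (partition ∘ H a)) (funToFin (σ a ⟨$⟩ʳ_)) ≡
    combine (codes n (partition ∘ H a′)) (funToFin (σ a′ ⟨$⟩ʳ_)) →
    (partition ∘ H a) ≗ (partition ∘ H a′) × σ a Perm.≈ σ a′
  inj a a′ e with p , q ← combine-injective (codes n (partition ∘ H a)) (funToFin (σ a ⟨$⟩ʳ_))
                            (codes n (partition ∘ H a′)) (funToFin (σ a′ ⟨$⟩ʳ_)) e =
    codes-injective (hooks-fitIn a) (hooks-fitIn a′) p , funToFin-injective q

HookPermutations : ℕ → ℕ → SignedSet
HookPermutations n ℓ = record
  { elements  = HookPermutation-setoid n ℓ
  ; finite    = HookPermutation-finite n ℓ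
  ; sign      = λ _ → Sign.+
  ; sign-cong = λ _ → refl
  }

foldr-≗ : ∀ {ℓ} {v w : Vector Sign ℓ} → v ≗ w → foldr Sign._*_ Sign.+ v ≡ foldr Sign._*_ Sign.+ w
foldr-≗ {zero}  e = refl
foldr-≗ {suc ℓ} e = cong₂ Sign._*_ (e zero) (foldr-≗ (e ∘ suc))

chainSign-cong : ∀ {ℓ} {v w : Vector Partition (suc ℓ)} → v ≗ w → chainSign v ≡ chainSign w
chainSign-cong e = foldr-≗ (λ i → cong₂ ribbonSign (e (suc i)) (e (inject₁ i)))

TableauPairs : ℕ → ℕ → SignedSet
TableauPairs n ℓ = record
  { elements  = TableauPair-setoid n ℓ
  ; finite    = TableauPair-finite n ℓ
  ; sign      = λ b → tableauSign (P b) Sign.* tableauSign (Q b)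
  ; sign-cong = λ (p , q) → cong₂ Sign._*_ (chainSign-cong p) (chainSign-cong q)
  }

module _ {n ℓ : ℕ} (Φ : SignedBijection (HookPermutations n ℓ) (TableauPairs n ℓ)) where
  open SignedBijection Φ
  open SignReversingInvolution using (to; Fix)
  open Setoid (HookPermutation-setoid n ℓ) using (_≈_)

  ιA-IsIdentity : Set
  ιA-IsIdentity = ∀ a → to ιA a ≈ a

  ιB-PreservesContents : Set
  ιB-PreservesContents = ∀ b →
    tableauContent (P b) ≗ tableauContent (P (to ιB b)) ×
    tableauContent (Q b) ≗ tableauContent (Q (to ιB b))

  φ-PreservesContents : Set
  φ-PreservesContents = ∀ (x : Setoid.Carrier (Fix ιA)) →
    hookContent (proj₁ x) ≗ tableauContent (Q (proj₁ (Bijection.to φ x))) ×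
    permutedHookContent (proj₁ x) ≗ tableauContent (P (proj₁ (Bijection.to φ x)))

{-# OPTIONS --safe #-}
module Submission where

-- It is enough to count.  For fixed contents α of P and β of Q, let the positive and
-- the negative pairs of tableaux be numbered; if there are as many hook permutations
-- as the positive pairs exceed the negative ones, then pairs of opposite sign with the
-- same number are exchanged by i, and φ numbers the remaining positive pairs.
--
-- A partition with at most N rows is a strictly decreasing list of N numbers (beads).
-- For a function F of lists that is alternating under permutations of the entries, the
-- signed sum of F over all ways of adding a ribbon of size k is U k F, the sum of F
-- over all ways of adding k to one entry: repeated entries contribute 0, and sorting
-- produces the sign of the ribbon.  Similarly removing ribbons gives D m F.  Moves of
-- different entries commute, which leaves
--   U k (D m F) = D m (U k F) + [k = m] k F
-- at lists containing 0, …, k - 1.  A pair (P , Q) is a walk that adds ribbons along Q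
-- and then removes them along P.  At the beads of ∅ every D m F vanishes, so commuting
-- D (α ℓ) to the front shows that the signed number of walks is the sum, over all t
-- with β t = α ℓ, of β t times the number for α without its last entry and β without
-- entry t.  Hook permutations satisfy the same recursion: t is σ(ℓ), and there are β t
-- hooks of size β t.

-- The commutation relation is not an identity of operators. The coefficient `k` counts the entries
-- `x < k`: such an entry can be raised by `k` and lowered back, but cannot be lowered first.
-- Finitely many beads leave room for only finitely many new rows, so a list lacking some number
-- below `k` has too few of these entries, and the relation fails there. Every identity therefore
-- carries a level: it is claimed only at lists containing all numbers below that level. A raising
-- by `k` costs `k` levels, since the terms in which it would destroy more vanish by alternation.
-- Starting from the `n` beads of the empty partition, whose level is `n`, there is enough room for
-- all raisings, because their amounts sum to `n`. Letting the operators act on functions of lists,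
-- instead of formal sums of lists, needs no quotient by reordering: alternation is a property of
-- the function. Contents are preserved by construction, because the cancellation is carried out
-- separately for each pair of contents.

open import Defs

import Data.Integer.Properties as ℤ
import Data.Nat.Properties as ℕ
import Data.Sign.Properties as Sign

open import Algebra.Properties.AbelianGroup ℤ.+-0-abelianGroup using (∙-cancelʳ)
open import Algebra.Properties.CommutativeMonoid.Sum ℕ.+-0-commutativeMonoid
  using (sum-cong-≗; sum-init-last; sum-permute; sum-remove)
import Algebra.Properties.Monoid.Sum Sign.*-monoid as Product
open import Data.Empty using (⊥)
open import Data.Fin.Base using (Fin; fromℕ; fromℕ<; inject₁; punchIn; punchOut; suc; toℕ; zero)
open import Data.Fin.Induction using (<-weakInduction; >-weakInduction)
open import Data.Fin.Permutation as Perm using (Permutation′; _⟨$⟩ʳ_)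
open import Data.Fin.Properties as Fin
  using (punchIn-injective; punchIn-punchOut; toℕ-fromℕ<; toℕ-injective; toℕ<n)
open import Data.Fin.Relation.Unary.Top using (view; ‵fromℕ; ‵inj₁)
open import Data.Integer.Base as ℤ using (+_; -1ℤ; 0ℤ; 1ℤ; ℤ)
import Data.Integer.Solver as ℤ-Solver
open import Data.List.Base
  using (List; []; _++_; _∷_; _∷ʳ_; applyUpTo; cartesianProductWith; concat; concatMap;
    deduplicate; downFrom; filter; foldr; length; lookup; map; replicate; tabulate; upTo)
open import Data.List.Membership.Propositional using () renaming (_∈_ to _∈ₗ_)
open import Data.List.Membership.Propositional.Properties
  using (∈-++⁺ʳ; ∈-++⁺ˡ; ∈-++⁻; ∈-applyUpTo⁺; ∈-applyUpTo⁻; ∈-cartesianProductWith⁺;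
    ∈-cartesianProductWith⁻; ∈-concat⁺′; ∈-concat⁻′; ∈-deduplicate⁺; ∈-deduplicate⁻;
    ∈-downFrom⁺; ∈-downFrom⁻; ∈-filter⁺; ∈-filter⁻; ∈-lookup; ∈-map⁺; ∈-map⁻; ∈-tabulate⁺;
    ∈-tabulate⁻; ∈-upTo⁺; ∈-upTo⁻; ∈-∃++)
open import Data.List.Membership.Propositional.Properties.WithK using (unique∧set⇒bag)
open import Data.List.Properties
  using (++-assoc; filter-++; filter-accept; filter-all; filter-reject; length-++;
    length-applyUpTo; length-downFrom; length-map; length-replicate; length-upTo; tabulate-cong;
    upTo-∷ʳ; ∷-injective)
open import Data.List.Relation.Binary.BagAndSetEquality using (∼bag⇒↭)
open import Data.List.Relation.Binary.Permutation.Propositional.Properties using (↭-length)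
open import Data.List.Relation.Unary.All as All using (All; []; _∷_)
import Data.List.Relation.Unary.All.Properties as All
open import Data.List.Relation.Unary.AllPairs as AllPairs using (AllPairs; []; _∷_)
open import Data.List.Relation.Unary.AllPairs.Properties as AllPairs using (applyDownFrom⁺₁)
open import Data.List.Relation.Unary.Any using (here; index; there)
open import Data.List.Relation.Unary.Any.Properties using (lookup-index)
open import Data.List.Relation.Unary.Linked using (Linked; [-]; []; _∷_; linked?)
open import Data.List.Relation.Unary.Unique.DecPropositional.Properties ℕ._≟_ using (deduplicate-!)
open import Data.List.Relation.Unary.Unique.Propositional using (Unique)
open import Data.List.Relation.Unary.Unique.Propositional.Properties
  using (applyUpTo⁺₁; cartesianProductWith⁺; upTo⁺)
open import Data.Maybe.Base using (Maybe; _>>=_; just; maybe′; nothing)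
open import Data.Nat.Base
  using (NonZero; _*_; _+_; _<_; _>_; _≥_; _∸_; _≤_; suc; s≤s; s≤s⁻¹; zero; z≤n; ℕ; ∣_-_∣)
open import Data.Nat.ListAction using (sum)
open import Data.Nat.Properties using (_<?_; _≟_; _≤?_)
import Data.Nat.Solver as ℕ-Solver
open import Data.Product.Base using (Σ-syntax; ∃; ∃-syntax; _×_; _,_; proj₁; proj₂; map₂)
open import Data.Product.Properties using (,-injective)
open import Data.Sign.Base as Sign using (Sign; opposite)
open import Data.Sum.Base using (_⊎_; inj₁; inj₂)
open import Data.Vec.Base as Vec using (Vec)
open import Data.Vec.Functional as Vector using (Vector; insertAt)
open import Data.Vec.Functional.Properties using (insertAt-lookup; insertAt-punchIn)
import Data.Vec.Properties as Vec
open import Function.Base using (_on_; _∘_; flip; id)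
open import Function.Bundles using (mk⇔)
open import Level using (0ℓ)
open import Relation.Binary.Bundles using (Setoid)
open import Relation.Binary.Construct.Closure.ReflexiveTransitive
  using (Star; _◅_; _◅◅_; reverse; ε)
open import Relation.Binary.Definitions using (tri<; tri>; tri≈)
open import Relation.Binary.PropositionalEquality
open import Relation.Nullary using (Dec; contradiction; no; recompute; yes; ¬?; ¬_)
open import Relation.Unary using (Decidable)

-- Alternating functions

Functional : Set
Functional = List ℕ → ℤ

record Alternating (F : Functional) : Set where
  constructor alternating
  field swap : ∀ p x y q → F (p ++ x ∷ y ∷ q) ≡ ℤ.- F (p ++ y ∷ x ∷ q)

open Alternating

Move : Set
Move = ℕ → Maybe ℕ

at : Maybe ℕ → (ℕ → ℤ) → ℤ
at m f = maybe′ f 0ℤ m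

-- Since operators act on functions, the outer one is the first to move an entry of the list:
-- `∂ g (∂ h F) a` moves by `g`, then by `h`.
∂ : Move → Functional → Functional
∂ g F []       = 0ℤ
∂ g F (x ∷ xs) = at (g x) (λ y → F (y ∷ xs)) ℤ.+ ∂ g (F ∘ (x ∷_)) xs

alternating-∷ : ∀ {F} x → Alternating F → Alternating (F ∘ (x ∷_))
alternating-∷ x alt = alternating (λ p → swap alt (x ∷ p))

self-negative : ∀ z → z ≡ ℤ.- z → z ≡ 0ℤ
self-negative (+ zero) e = refl

moveToEnd : ∀ (p : List ℕ) x q → p ++ x ∷ q ≡ (p ∷ʳ x) ++ q
moveToEnd p x q = sym (++-assoc p (x ∷ []) q)

-- Adjacent swaps carry one copy of the repeated entry next to the other; swapping the two copies
-- then shows that the value is its own negative.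
vanishesʳ : ∀ {F} → Alternating F → ∀ p {x} {q} → x ∈ₗ q → F (p ++ x ∷ q) ≡ 0ℤ
vanishesʳ alt p {x} {y ∷ q} (here refl) = self-negative _ (swap alt p x x q)
vanishesʳ {F} alt p {x} {y ∷ q} (there x∈q) = begin
  F (p ++ x ∷ y ∷ q)           ≡⟨ swap alt p x y q ⟩
  ℤ.- F (p ++ y ∷ x ∷ q)       ≡⟨ cong (ℤ.-_ ∘ F) (moveToEnd p y (x ∷ q)) ⟩
  ℤ.- F ((p ∷ʳ y) ++ x ∷ q)    ≡⟨ cong ℤ.-_ (vanishesʳ alt (p ∷ʳ y) x∈q) ⟩
  0ℤ                           ∎
  where open ≡-Reasoning

vanishes : ∀ {F} → Alternating F → ∀ p {x} q → x ∈ₗ p ⊎ x ∈ₗ q → F (p ++ x ∷ q) ≡ 0ℤ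
vanishes alt p q (inj₂ x∈q) = vanishesʳ alt p x∈q
vanishes {F} alt p {x} q (inj₁ x∈p) with p₁ , p₂ , refl ← ∈-∃++ x∈p =
  trans (cong F (++-assoc p₁ (x ∷ p₂) (x ∷ q)))
        (vanishesʳ alt p₁ (∈-++⁺ʳ p₂ (here refl)))

at-cong : ∀ m {f h} → (∀ y → m ≡ just y → f y ≡ h y) → at m f ≡ at m h
at-cong (just y) e = e y refl
at-cong nothing  e = refl

-- Agreement is demanded only at the lists that one move reaches from `a`, and together with the
-- place of that move. This is what allows properties of `a`, such as containing small numbers, to
-- be used.
∂-cong : ∀ {g F G} a → (∀ p x q y → a ≡ p ++ x ∷ q → g x ≡ just y →
  F (p ++ y ∷ q) ≡ G (p ++ y ∷ q)) →
  ∂ g F a ≡ ∂ g G a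
∂-cong []       e = refl
∂-cong {g} (x ∷ xs) e = cong₂ ℤ._+_
  (at-cong (g x) (λ y → e [] x xs y refl))
  (∂-cong xs (λ p x′ q y eq → e (x ∷ p) x′ q y (cong (x ∷_) eq)))

∂-ext : ∀ {g F G} → (∀ a → F a ≡ G a) → ∀ a → ∂ g F a ≡ ∂ g G a
∂-ext e a = ∂-cong a (λ p _ q y _ _ → e (p ++ y ∷ q))

at-zero : ∀ m → at m (λ _ → 0ℤ) ≡ 0ℤ
at-zero (just _) = refl
at-zero nothing  = refl

∂-zero : ∀ g a → ∂ g (λ _ → 0ℤ) a ≡ 0ℤ
∂-zero g []       = refl
∂-zero g (x ∷ xs) = cong₂ ℤ._+_ (at-zero (g x)) (∂-zero g xs)

∂-null : ∀ {g F} a → (∀ p x q y → a ≡ p ++ x ∷ q → g x ≡ just y → F (p ++ y ∷ q) ≡ 0ℤ) →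
  ∂ g F a ≡ 0ℤ
∂-null {g} a e = trans (∂-cong a e) (∂-zero g a)

+-interchange : ∀ a b c d → (a ℤ.+ b) ℤ.+ (c ℤ.+ d) ≡ (a ℤ.+ c) ℤ.+ (b ℤ.+ d)
+-interchange = solve 4 (λ a b c d → (a :+ b) :+ (c :+ d) := (a :+ c) :+ (b :+ d)) refl
  where open ℤ-Solver.+-*-Solver

at-+ : ∀ m f h → at m (λ y → f y ℤ.+ h y) ≡ at m f ℤ.+ at m h
at-+ (just _) f h = refl
at-+ nothing  f h = refl

∂-+ : ∀ {g} F G a → ∂ g (λ b → F b ℤ.+ G b) a ≡ ∂ g F a ℤ.+ ∂ g G a
∂-+     F G []       = refl
∂-+ {g} F G (x ∷ xs) = trans
  (cong₂ ℤ._+_ (at-+ (g x) _ _) (∂-+ (F ∘ (x ∷_)) (G ∘ (x ∷_)) xs))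
  (+-interchange (at (g x) _) _ _ _)

at-* : ∀ m c f → at m (λ y → c ℤ.* f y) ≡ c ℤ.* at m f
at-* (just _) c f = refl
at-* nothing  c f = sym (ℤ.*-zeroʳ c)

∂-* : ∀ {g} c F a → ∂ g (λ b → c ℤ.* F b) a ≡ c ℤ.* ∂ g F a
∂-* c F []           = sym (ℤ.*-zeroʳ c)
∂-* {g} c F (x ∷ xs) = trans
  (cong₂ ℤ._+_ (at-* (g x) c _) (∂-* c (F ∘ (x ∷_)) xs))
  (sym (ℤ.*-distribˡ-+ c _ _))

-1*- : ∀ z → ℤ.- z ≡ -1ℤ ℤ.* z
-1*- z = sym (ℤ.-1*i≡-i z)

∂-neg : ∀ {g} F a → ∂ g (λ b → ℤ.- F b) a ≡ ℤ.- ∂ g F a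
∂-neg F a = trans (∂-ext (λ b → -1*- (F b)) a) (trans (∂-* -1ℤ F a) (sym (-1*- _)))

∂-at : ∀ {g} m (F : ℕ → Functional) a → ∂ g (λ b → at m (λ z → F z b)) a ≡ at m (λ z → ∂ g (F z) a)
∂-at     (just z) F a = refl
∂-at {g} nothing  F a = ∂-zero g a

-- Both sides have the same terms, moving `x`, moving `y` or moving another entry; they match by the
-- swap rule of `F`, with the first two kinds exchanged.
∂-swap : ∀ {g F} → Alternating F → ∀ p x y q → ∂ g F (p ++ x ∷ y ∷ q) ≡ ℤ.- ∂ g F (p ++ y ∷ x ∷ q)
∂-swap {g} {F} alt [] x y q = begin
  gx x (y ∷ q) ℤ.+ (at (g y) (λ z → F (x ∷ z ∷ q)) ℤ.+ ∂ g (λ b → F (x ∷ y ∷ b)) q)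
    ≡⟨ cong₂ ℤ._+_ (at-swap (g x) (λ z → swap alt [] z y q))
        (cong₂ ℤ._+_ (at-swap (g y) (λ z → swap alt [] x z q))
          (trans (∂-ext (λ b → swap alt [] x y b) q) (∂-neg _ q))) ⟩
  ℤ.- B ℤ.+ (ℤ.- A ℤ.+ ℤ.- C) ≡⟨ shuffle A B C ⟩
  ℤ.- (A ℤ.+ (B ℤ.+ C)) ∎
  where
  open ≡-Reasoning
  gx : ℕ → List ℕ → ℤ
  gx x ys = at (g x) (λ z → F (z ∷ ys))
  at-swap : ∀ m {f h : ℕ → ℤ} → (∀ z → f z ≡ ℤ.- h z) → at m f ≡ ℤ.- at m h
  at-swap (just z) e = e z
  at-swap nothing  e = refl
  A B C : ℤ
  A = gx y (x ∷ q)
  B = at (g x) (λ z → F (y ∷ z ∷ q))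
  C = ∂ g (λ b → F (y ∷ x ∷ b)) q
  shuffle : ∀ A B C → ℤ.- B ℤ.+ (ℤ.- A ℤ.+ ℤ.- C) ≡ ℤ.- (A ℤ.+ (B ℤ.+ C))
  shuffle = solve 3 (λ A B C → :- B :+ (:- A :+ :- C) := :- (A :+ (B :+ C))) refl
    where open ℤ-Solver.+-*-Solver
∂-swap {g} {F} alt (z ∷ p) x y q = trans
  (cong₂ ℤ._+_ (at-alt (g z)) (∂-swap (alternating-∷ z alt) p x y q))
  (sym (ℤ.neg-distrib-+ (at (g z) _) _))
  where
  at-alt : ∀ m → at m (λ z′ → F (z′ ∷ p ++ x ∷ y ∷ q)) ≡ ℤ.- at m (λ z′ → F (z′ ∷ p ++ y ∷ x ∷ q))
  at-alt (just z′) = swap alt (z′ ∷ p) x y q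
  at-alt nothing   = refl

∂-alternating : ∀ {g F} → Alternating F → Alternating (∂ g F)
∂-alternating alt = alternating (∂-swap alt)

infixr 9 _»_
_»_ : Move → Move → Move
(g » h) x = g x >>= h

-- Moves of different entries commute, so only the terms moving the same entry
-- twice survive in the commutator of ∂ g and ∂ h.
∂-commute : ∀ g h F a → ∂ g (∂ h F) a ℤ.+ ∂ (h » g) F a ≡ ∂ h (∂ g F) a ℤ.+ ∂ (g » h) F a
∂-commute g h F []       = refl
∂-commute g h F (x ∷ xs) = begin
  (at (g x) (λ y → ∂ h F (y ∷ xs)) ℤ.+ ∂ g (λ b → ∂ h F (x ∷ b)) xs) ℤ.+ (HG ℤ.+ ∂ (h » g) Fₓ xs)
    ≡⟨ cong (ℤ._+ (HG ℤ.+ ∂ (h » g) Fₓ xs)) (expand g h) ⟩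
  ((GH ℤ.+ mixed g h) ℤ.+ (mixed h g ℤ.+ ∂ g (∂ h Fₓ) xs)) ℤ.+ (HG ℤ.+ ∂ (h » g) Fₓ xs)
    ≡⟨ shuffle GH (mixed g h) (mixed h g) _ HG _ ⟩
  ((HG ℤ.+ mixed h g) ℤ.+ (mixed g h ℤ.+ GH)) ℤ.+ (∂ g (∂ h Fₓ) xs ℤ.+ ∂ (h » g) Fₓ xs)
    ≡⟨ cong (λ z → ((HG ℤ.+ mixed h g) ℤ.+ (mixed g h ℤ.+ GH)) ℤ.+ z) (∂-commute g h Fₓ xs) ⟩
  ((HG ℤ.+ mixed h g) ℤ.+ (mixed g h ℤ.+ GH)) ℤ.+ (∂ h (∂ g Fₓ) xs ℤ.+ ∂ (g » h) Fₓ xs)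
    ≡⟨ shuffle′ HG (mixed h g) (mixed g h) GH _ _ ⟩
  ((HG ℤ.+ mixed h g) ℤ.+ (mixed g h ℤ.+ ∂ h (∂ g Fₓ) xs)) ℤ.+ (GH ℤ.+ ∂ (g » h) Fₓ xs)
    ≡⟨ cong (ℤ._+ (GH ℤ.+ ∂ (g » h) Fₓ xs)) (expand h g) ⟨
  (at (h x) (λ y → ∂ g F (y ∷ xs)) ℤ.+ ∂ h (λ b → ∂ g F (x ∷ b)) xs) ℤ.+ (GH ℤ.+ ∂ (g » h) Fₓ xs) ∎
  where
  open ≡-Reasoning
  open ℤ-Solver.+-*-Solver
  Fₓ : Functional
  Fₓ = F ∘ (x ∷_)
  both : Move → Move → ℤ
  both g h = at ((g » h) x) (λ z → F (z ∷ xs))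
  GH HG : ℤ
  GH = both g h
  HG = both h g
  mixed : Move → Move → ℤ
  mixed g h = at (g x) (λ y → ∂ h (F ∘ (y ∷_)) xs)
  at-bind : ∀ m (f : ℕ → ℤ) h → at (m >>= h) f ≡ at m (λ y → at (h y) f)
  at-bind (just _) f h = refl
  at-bind nothing  f h = refl
  expand : ∀ g h → at (g x) (λ y → ∂ h F (y ∷ xs)) ℤ.+ ∂ g (λ b → ∂ h F (x ∷ b)) xs ≡
    (both g h ℤ.+ mixed g h) ℤ.+ (mixed h g ℤ.+ ∂ g (∂ h Fₓ) xs)
  expand g h = cong₂ ℤ._+_
    (trans (at-+ (g x) _ _) (cong (ℤ._+ mixed g h) (sym (at-bind (g x) _ h))))
    (trans (∂-+ _ _ xs) (cong (ℤ._+ ∂ g (∂ h Fₓ) xs) (∂-at (h x) (λ z b → F (z ∷ b)) xs)))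
  shuffle : ∀ a b c d e f → ((a ℤ.+ b) ℤ.+ (c ℤ.+ d)) ℤ.+ (e ℤ.+ f)
    ≡ ((e ℤ.+ c) ℤ.+ (b ℤ.+ a)) ℤ.+ (d ℤ.+ f)
  shuffle = solve 6 (λ a b c d e f →
    ((a :+ b) :+ (c :+ d)) :+ (e :+ f) := ((e :+ c) :+ (b :+ a)) :+ (d :+ f)) refl
  shuffle′ : ∀ a b c d e f → ((a ℤ.+ b) ℤ.+ (c ℤ.+ d)) ℤ.+ (e ℤ.+ f)
    ≡ ((a ℤ.+ b) ℤ.+ (c ℤ.+ e)) ℤ.+ (d ℤ.+ f)
  shuffle′ = solve 6 (λ a b c d e f →
    ((a :+ b) :+ (c :+ d)) :+ (e :+ f) := ((a :+ b) :+ (c :+ e)) :+ (d :+ f)) refl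

-- Values at lists containing an initial segment of the natural numbers

Full : ℕ → List ℕ → Set
Full z a = ∀ {c} → c < z → c ∈ₗ a

full-≤ : ∀ {y z a} → y ≤ z → Full z a → Full y a
full-≤ y≤z full c<y = full (ℕ.<-≤-trans c<y y≤z)

∈-replace : ∀ p {x c : ℕ} q → c ≢ x → c ∈ₗ p ++ x ∷ q → c ∈ₗ p ⊎ c ∈ₗ q
∈-replace p q c≢x c∈ with ∈-++⁻ p c∈
... | inj₁ c∈p         = inj₁ c∈p
... | inj₂ (here c≡x)  = contradiction c≡x c≢x
... | inj₂ (there c∈q) = inj₂ c∈q

⊎⇒∈ : ∀ p {y c : ℕ} q → c ∈ₗ p ⊎ c ∈ₗ q → c ∈ₗ p ++ y ∷ q
⊎⇒∈ p q (inj₁ c∈p) = ∈-++⁺ˡ c∈p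
⊎⇒∈ p q (inj₂ c∈q) = ∈-++⁺ʳ p (there c∈q)

vanishes-full : ∀ {F z x y} → Alternating F → ∀ p q → Full z (p ++ x ∷ q) → y < z → y ≢ x →
  F (p ++ y ∷ q) ≡ 0ℤ
vanishes-full alt p q full y<z y≢x = vanishes alt p q (∈-replace p q y≢x (full y<z))

_≈[_]_ : Functional → ℕ → Functional → Set
F ≈[ z ] G = ∀ a → Full z a → F a ≡ G a

raiseBy lowerBy : ℕ → Move
raiseBy   k x = just (x + k)
lowerBy m x with m ≤? x
... | yes _ = just (x ∸ m)
... | no  _ = nothing

down-just : ∀ {m x y} → lowerBy m x ≡ just y → m ≤ x × y ≡ x ∸ m
down-just {m} {x} e with m ≤? x
down-just refl | yes m≤x = m≤x , refl

down-≤ : ∀ {m x} → m ≤ x → lowerBy m x ≡ just (x ∸ m)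
down-≤ {m} {x} m≤x with m ≤? x
... | yes _  = refl
... | no m≰x = contradiction m≤x m≰x

down-< : ∀ {m x} → x < m → lowerBy m x ≡ nothing
down-< {m} {x} x<m with m ≤? x
... | yes m≤x = contradiction m≤x (ℕ.<⇒≱ x<m)
... | no  _   = refl

-- An entry below `z` is raised to a different number below `k + z`, which is already present, so
-- its term vanishes for both functions. Raising an entry that is at least `z` leaves all numbers
-- below `z` in place.
∂up-level : ∀ {F G k z} → 0 < k → Alternating F → Alternating G →
  F ≈[ z ] G → ∂ (raiseBy k) F ≈[ k + z ] ∂ (raiseBy k) G
∂up-level {F} {G} {k} {z} 0<k altF altG e a full = ∂-cong a step
  where
  step : ∀ p x q y → a ≡ p ++ x ∷ q → just (x + k) ≡ just y → F (p ++ y ∷ q) ≡ G (p ++ y ∷ q)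
  step p x q _ refl refl with x <? z
  ... | yes x<z = trans (null altF) (sym (null altG))
    where
    x+k<k+z = subst (x + k <_) (ℕ.+-comm z k) (ℕ.+-monoˡ-< k x<z)
    x+k≢x : x + k ≢ x
    x+k≢x eq = ℕ.<-irrefl (sym eq) (ℕ.m<m+n x 0<k)
    null : ∀ {F} → Alternating F → F (p ++ (x + k) ∷ q) ≡ 0ℤ
    null alt = vanishes-full alt p q full x+k<k+z x+k≢x
  ... | no x≮z = e _ (λ c<z → ⊎⇒∈ p q (∈-replace p q
        (λ { refl → x≮z c<z }) (full (ℕ.<-≤-trans c<z (ℕ.m≤n+m z k)))))

-- Every number below `z` is taken, so a lowered entry always meets another copy of its new value.
∂down-bottom : ∀ {F m z} → 0 < m → Alternating F → ∀ a → Full z a → (∀ {x} → x ∈ₗ a → x < z) →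
  ∂ (lowerBy m) F a ≡ 0ℤ
∂down-bottom {F} {m} {z} 0<m alt a full bound = ∂-null a step
  where
  step : ∀ p x q y → a ≡ p ++ x ∷ q → lowerBy m x ≡ just y → F (p ++ y ∷ q) ≡ 0ℤ
  step p x q y refl e with m≤x , refl ← down-just e =
    vanishes-full alt p q full (ℕ.<-trans x∸m<x (bound (∈-++⁺ʳ p (here refl)))) (ℕ.<⇒≢ x∸m<x)
    where x∸m<x = ℕ.∸-monoʳ-< 0<m m≤x

only : ℕ → Move
only c x with x ≟ c
... | yes _ = just x
... | no  _ = nothing

-- The first occurrence of `c` contributes `F a`; a term for a later occurrence contains `c` twice
-- and vanishes.
∂only : ∀ {F c} → Alternating F → ∀ {a} → c ∈ₗ a → ∂ (only c) F a ≡ F a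
∂only {F} {c} alt {x ∷ xs} c∈a with x ≟ c
∂only {F} {c} alt {x ∷ xs} c∈a | yes refl = trans
  (cong (λ z → F (x ∷ xs) ℤ.+ z) (∂-null xs step)) (ℤ.+-identityʳ _)
  where
  step : ∀ p x′ q y → xs ≡ p ++ x′ ∷ q → only c x′ ≡ just y → F (x ∷ p ++ y ∷ q) ≡ 0ℤ
  step p x′ q y eq e with x′ ≟ c
  step p x′ q .x′ refl refl | yes refl = vanishes alt (x ∷ p) q (inj₁ (here refl))
∂only {F} {c} alt {x ∷ xs} (here refl)  | no x≢x = contradiction refl x≢x
∂only {F} {c} alt {x ∷ xs} (there c∈xs) | no _ =
  trans (ℤ.+-identityˡ _) (∂only (alternating-∷ x alt) c∈xs)

∂-additive : ∀ {g h e} → (∀ x f → at (g x) f ≡ at (h x) f ℤ.+ at (e x) f) →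
  ∀ F a → ∂ g F a ≡ ∂ h F a ℤ.+ ∂ e F a
∂-additive {g} {h} {e} add F []       = refl
∂-additive {g} {h} {e} add F (x ∷ xs) = trans
  (cong₂ ℤ._+_ (add x _) (∂-additive add (F ∘ (x ∷_)) xs))
  (+-interchange (at (h x) _) _ _ _)

below : ℕ → Move
below z x with x <? z
... | yes _ = just x
... | no  _ = nothing

-- If `F a` is nonzero, `a` has no repetitions, and then exactly `z` of its entries are below `z`.
-- The induction peels off the largest of these values, so that repetitions never have to be
-- discussed separately.
∂below : ∀ {F} z → Alternating F → ∀ a → Full z a → ∂ (below z) F a ≡ + z ℤ.* F a
∂below {F} zero    alt a full = ∂-null a (λ p x q y _ ())
∂below {F} (suc z) alt a full = begin
  ∂ (below (suc z)) F a               ≡⟨ ∂-additive split F a ⟩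
  ∂ (below z) F a ℤ.+ ∂ (only z) F a
    ≡⟨ cong₂ ℤ._+_ (∂below z alt a (full-≤ (ℕ.n≤1+n z) full))
    (∂only alt (full ℕ.≤-refl)) ⟩
  + z ℤ.* F a ℤ.+ F a                 ≡⟨ ℤ.+-comm (+ z ℤ.* F a) (F a) ⟩
  F a ℤ.+ + z ℤ.* F a                 ≡⟨ ℤ.suc-* (+ z) (F a) ⟨
  + suc z ℤ.* F a                     ∎
  where
  open ≡-Reasoning
  split : ∀ x f → at (below (suc z) x) f ≡ at (below z x) f ℤ.+ at (only z x) f
  split x f with x <? suc z | x <? z | x ≟ z
  ... | yes _ | yes _   | no _     = sym (ℤ.+-identityʳ _)
  ... | yes _ | no _    | yes _    = sym (ℤ.+-identityˡ _)
  ... | no _  | no _    | no _     = refl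
  ... | _     | yes x<z | yes refl = contradiction x<z (ℕ.<-irrefl refl)
  ... | yes (s≤s x≤z) | no x≮z  | no x≢z   = contradiction (ℕ.≤∧≢⇒< x≤z x≢z) x≮z
  ... | no x≮ | yes x<z | no _     = contradiction (ℕ.m<n⇒m<1+n x<z) x≮
  ... | no x≮ | no _    | yes refl = contradiction ℕ.≤-refl x≮

weight : ℕ → ℕ → ℕ
weight k m with k ≟ m
... | yes _ = k
... | no  _ = 0

-- The entries that can be raised by k and then lowered by m, but not the other
-- way round.
excess : ℕ → ℕ → Move
excess k m x with x <? m
... | yes _ = lowerBy m (x + k)
... | no  _ = nothing

-- By `∂-commute` only the two compositions on a single entry matter, and they differ exactly where
-- `x < m`. There the result `x + k - m` is below `k`: if `k ≢ m` it differs from `x` and is already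
-- present, so the term vanishes; if `k ≡ m` it is `x` itself, and `∂below` counts these entries.
commutator : ∀ {F k m} → 0 < k → Alternating F →
  ∂ (raiseBy k) (∂ (lowerBy m) F) ≈[ k ] (λ a →
    ∂ (lowerBy m) (∂ (raiseBy k) F) a ℤ.+ + weight k m ℤ.* F a)
commutator {F} {k} {m} 0<k alt a full = ∙-cancelʳ DU _ _ (begin
  ∂ (raiseBy k) (∂ (lowerBy m) F) a ℤ.+ DU           ≡⟨ ∂-commute (raiseBy k) (lowerBy m) F a ⟩
  D ℤ.+ ∂ (raiseBy k » lowerBy m) F a
    ≡⟨ cong (λ z → D ℤ.+ z)
    (∂-additive split F a) ⟩
  D ℤ.+ (DU ℤ.+ ∂ (excess k m) F a)          ≡⟨ cong (λ z → D ℤ.+ (DU ℤ.+ z)) excess-sum ⟩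
  D ℤ.+ (DU ℤ.+ + weight k m ℤ.* F a)               ≡⟨ shuffle D DU _ ⟩
  (D ℤ.+ + weight k m ℤ.* F a) ℤ.+ DU               ∎)
  where
  open ≡-Reasoning
  D DU : ℤ
  D = ∂ (lowerBy m) (∂ (raiseBy k) F) a
  DU = ∂ (lowerBy m » raiseBy k) F a
  shuffle : ∀ a b c → a ℤ.+ (b ℤ.+ c) ≡ (a ℤ.+ c) ℤ.+ b
  shuffle = solve 3 (λ a b c → a :+ (b :+ c) := (a :+ c) :+ b) refl
    where open ℤ-Solver.+-*-Solver
  split : ∀ x f → at ((raiseBy k » lowerBy m) x) f
    ≡ at ((lowerBy m » raiseBy k) x) f ℤ.+ at (excess k m x) f
  split x f with x <? m
  ... | yes x<m = trans (sym (ℤ.+-identityˡ _))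
    (cong (λ w → at (w >>= raiseBy k) f ℤ.+ at (lowerBy m (x + k)) f) (sym (down-< x<m)))
  ... | no x≮m = begin
    at (lowerBy m (x + k)) f             ≡⟨ cong (λ w → at w f) (down-≤ (ℕ.m≤n⇒m≤n+o k m≤x)) ⟩
    f (x + k ∸ m)                     ≡⟨ cong f (ℕ.+-∸-comm k m≤x) ⟩
    f (x ∸ m + k)                     ≡⟨ cong (λ w → at (w >>= raiseBy k) f) (down-≤ m≤x) ⟨
    at (lowerBy m x >>= raiseBy k) f          ≡⟨ ℤ.+-identityʳ _ ⟨
    at (lowerBy m x >>= raiseBy k) f ℤ.+ 0ℤ   ∎
    where m≤x = ℕ.≮⇒≥ x≮m
  excess-self : ∀ x f → at (excess k k x) f ≡ 0ℤ ℤ.+ at (below k x) f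
  excess-self x f with x <? k
  ... | yes _ = begin
    at (lowerBy k (x + k)) f  ≡⟨ cong (λ w → at w f) (down-≤ (ℕ.m≤n+m k x)) ⟩
    f (x + k ∸ k)          ≡⟨ cong f (ℕ.m+n∸n≡m x k) ⟩
    f x                    ≡⟨ ℤ.+-identityˡ _ ⟨
    0ℤ ℤ.+ f x             ∎
  ... | no _ = refl
  excess-sum : ∂ (excess k m) F a ≡ + weight k m ℤ.* F a
  excess-sum with k ≟ m
  ... | yes refl = begin
    ∂ (excess k k) F a                         ≡⟨ ∂-additive {h = λ _ → nothing} excess-self F a ⟩
    ∂ (λ _ → nothing) F a ℤ.+ ∂ (below k) F a
      ≡⟨ cong₂ ℤ._+_
      (∂-null a (λ _ _ _ _ _ ())) (∂below k alt a full) ⟩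
    0ℤ ℤ.+ + k ℤ.* F a                         ≡⟨ ℤ.+-identityˡ _ ⟩
    + k ℤ.* F a                                ∎
  ... | no k≢m = ∂-null a step
    where
    step : ∀ p x q y → a ≡ p ++ x ∷ q → excess k m x ≡ just y → F (p ++ y ∷ q) ≡ 0ℤ
    step p x q y refl e with x <? m
    step p x q y refl e | yes x<m with m≤x+k , refl ← down-just e = vanishes-full alt p q full
      (ℕ.+-cancelʳ-< m _ _ (subst₂ _<_ (sym (ℕ.m∸n+n≡m m≤x+k)) (ℕ.+-comm m k) (ℕ.+-monoˡ-< k x<m)))
      (λ eq → k≢m (ℕ.+-cancelˡ-≡ x k m (trans (sym (ℕ.m∸n+n≡m m≤x+k)) (cong (_+ m) eq))))

-- Moving one lowering past all raisings

raise : ∀ {ℓ} → Vector ℕ ℓ → Functional → Functional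
raise {zero}  β F = F
raise {suc ℓ} β F = ∂ (raiseBy (β zero)) (raise (β ∘ suc) F)

raise-alternating : ∀ {ℓ} (β : Vector ℕ ℓ) {F} → Alternating F → Alternating (raise β F)
raise-alternating {zero}  β alt = alt
raise-alternating {suc ℓ} β alt = ∂-alternating (raise-alternating (β ∘ suc) alt)

-- The correction left behind when the lowering by `m` has passed every raising: each term has lost
-- one raising to a commutator.
contract : ∀ {ℓ} → ℕ → Vector ℕ ℓ → Functional → Functional
contract {zero}  m β F a = 0ℤ
contract {suc ℓ} m β F a = + weight (β zero) m ℤ.* raise (β ∘ suc) F a ℤ.+ ∂ (raiseBy (β zero))
  (contract m (β ∘ suc) F) a

*-alternating : ∀ c {F} → Alternating F → Alternating (λ a → c ℤ.* F a)
*-alternating c alt = alternating (λ p x y q →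
  trans (cong (c ℤ.*_) (swap alt p x y q)) (sym (ℤ.neg-distribʳ-* c _)))

+-alternating : ∀ {F G} → Alternating F → Alternating G → Alternating (λ a → F a ℤ.+ G a)
+-alternating {F} {G} altF altG = alternating (λ p x y q →
  trans (cong₂ ℤ._+_ (swap altF p x y q) (swap altG p x y q)) (sym (ℤ.neg-distrib-+ (F _) (G _))))

contract-alternating : ∀ {ℓ} m (β : Vector ℕ ℓ) {F} → Alternating F → Alternating (contract m β F)
contract-alternating {zero}  m β alt = alternating (λ _ _ _ _ → refl)
contract-alternating {suc ℓ} m β alt = +-alternating
  (*-alternating (+ weight (β zero) m) (raise-alternating (β ∘ suc) alt))
  (∂-alternating (contract-alternating m (β ∘ suc) alt))

-- The level is the total amount of the raisings. The outermost raising is performed first and uses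
-- up `β zero`, which leaves the level needed by the induction hypothesis; the commutator itself
-- needs only `β zero`.
raise-lower : ∀ {ℓ} m (β : Vector ℕ ℓ) → (∀ i → 0 < β i) → ∀ {F} → Alternating F →
  raise β (∂ (lowerBy m) F) ≈[ sumᵛ β ] (λ a → ∂ (lowerBy m) (raise β F) a ℤ.+ contract m β F a)
raise-lower {zero}  m β 0<β alt a full = sym (ℤ.+-identityʳ _)
raise-lower {suc ℓ} m β 0<β {F} alt a full = begin
  ∂ U (raise β′ (∂ D F)) a
    ≡⟨ ∂up-level (0<β zero)
        (raise-alternating β′ (∂-alternating alt))
        (+-alternating (∂-alternating altR) altC)
        (raise-lower m β′ (0<β ∘ suc) alt) a full ⟩
  ∂ U (λ b → ∂ D R b ℤ.+ contract m β′ F b) a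
    ≡⟨ ∂-+ _ _ a ⟩
  ∂ U (∂ D R) a ℤ.+ ∂ U (contract m β′ F) a
    ≡⟨ cong (ℤ._+ ∂ U (contract m β′ F) a)
      (commutator (0<β zero) altR a (full-≤ (ℕ.m≤m+n _ _) full)) ⟩
  (∂ D (∂ U R) a ℤ.+ + weight (β zero) m ℤ.* R a) ℤ.+ ∂ U (contract m β′ F) a
    ≡⟨ ℤ.+-assoc (∂ D (∂ U R) a) _ _ ⟩
  ∂ D (∂ U R) a ℤ.+ contract m β F a ∎
  where
  open ≡-Reasoning
  β′ = β ∘ suc
  U = raiseBy (β zero)
  D = lowerBy m
  R = raise β′ F
  altR = raise-alternating β′ alt
  altC = contract-alternating m β′ alt

sumℤ : ∀ {ℓ} → Vector ℤ ℓ → ℤ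
sumℤ = Vector.foldr ℤ._+_ 0ℤ

∂-sum : ∀ {ℓ g} (F : Fin ℓ → Functional) a →
  ∂ g (λ b → sumℤ (λ t → F t b)) a ≡ sumℤ (λ t → ∂ g (F t) a)
∂-sum {zero}  {g} F a = ∂-zero g a
∂-sum {suc ℓ} F a = trans (∂-+ _ _ a) (cong (λ z → ∂ _ (F zero) a ℤ.+ z) (∂-sum (F ∘ suc) a))

sumℤ-cong : ∀ {ℓ} {v w : Vector ℤ ℓ} → v ≗ w → sumℤ v ≡ sumℤ w
sumℤ-cong {zero}  e = refl
sumℤ-cong {suc ℓ} e = cong₂ ℤ._+_ (e zero) (sumℤ-cong (e ∘ suc))

contract-sum : ∀ {ℓ} m (β : Vector ℕ (suc ℓ)) F a →
  contract m β F a ≡ sumℤ (λ t → + weight (β t) m ℤ.* raise (β ∘ punchIn t) F a)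
contract-sum {zero}  m β F a = cong (λ z → + weight (β zero) m ℤ.* F a ℤ.+ z)
  (∂-zero (raiseBy (β zero)) a)
contract-sum {suc ℓ} m β F a = cong (λ z → + weight (β zero) m ℤ.* raise (β ∘ suc) F a ℤ.+ z) (begin
  ∂ U (contract m (β ∘ suc) F) a
    ≡⟨ ∂-ext (contract-sum m (β ∘ suc) F) a ⟩
  ∂ U (λ b → sumℤ (λ t → term t b)) a
    ≡⟨ ∂-sum {g = U} term a ⟩
  sumℤ (λ t → ∂ U (term t) a)
    ≡⟨ sumℤ-cong (λ t → ∂-* {g = U} (+ weight (β (suc t)) m) (raise (β ∘ suc ∘ punchIn t) F) a) ⟩
  sumℤ (λ t → + weight (β (suc t)) m ℤ.* ∂ U (raise (β ∘ suc ∘ punchIn t) F) a) ∎)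
  where
  open ≡-Reasoning
  U = raiseBy (β zero)
  term : Fin (suc ℓ) → Functional
  term t b = + weight (β (suc t)) m ℤ.* raise (β ∘ suc ∘ punchIn t) F b

-- The sign of sorting, and evaluation at the empty partition

sgn : ℕ → ℕ → ℤ
sgn zero    zero    = 0ℤ
sgn zero    (suc y) = -1ℤ
sgn (suc x) zero    = 1ℤ
sgn (suc x) (suc y) = sgn x y

sgn-antisym : ∀ x y → sgn x y ≡ ℤ.- sgn y x
sgn-antisym zero    zero    = refl
sgn-antisym zero    (suc y) = refl
sgn-antisym (suc x) zero    = refl
sgn-antisym (suc x) (suc y) = sgn-antisym x y

sgn-> : ∀ {x y} → y < x → sgn x y ≡ 1ℤ
sgn-> {suc x} {zero}  (s≤s p) = refl
sgn-> {suc x} {suc y} (s≤s p) = sgn-> p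

-- As `sgn x y` is the sign of `x - y`, the function `sortSign` built from these products is the
-- sign of the Vandermonde product of all differences of an entry and a later one.
sgns : ℕ → List ℕ → ℤ
sgns x []       = 1ℤ
sgns x (y ∷ ys) = sgn x y ℤ.* sgns x ys

-- Zero on lists with repetitions, so that it is alternating.
sortSign : Functional
sortSign []       = 1ℤ
sortSign (x ∷ xs) = sgns x xs ℤ.* sortSign xs

sgns-swap : ∀ z p x y q → sgns z (p ++ x ∷ y ∷ q) ≡ sgns z (p ++ y ∷ x ∷ q)
sgns-swap z []      x y q = exchange (sgn z x) (sgn z y) (sgns z q)
  where
  open ℤ-Solver.+-*-Solver
  exchange : ∀ a b c → a ℤ.* (b ℤ.* c) ≡ b ℤ.* (a ℤ.* c)
  exchange = solve 3 (λ a b c → a :* (b :* c) := b :* (a :* c)) refl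
sgns-swap z (w ∷ p) x y q = cong (sgn z w ℤ.*_) (sgns-swap z p x y q)

sortSign-swap : ∀ p x y q → sortSign (p ++ x ∷ y ∷ q) ≡ ℤ.- sortSign (p ++ y ∷ x ∷ q)
sortSign-swap [] x y q = trans
  (cong (λ s → (s ℤ.* sgns x q) ℤ.* (sgns y q ℤ.* sortSign q)) (sgn-antisym x y))
  (exchange (sgn y x) (sgns x q) (sgns y q) (sortSign q))
  where
  open ℤ-Solver.+-*-Solver
  exchange : ∀ a b c d → (ℤ.- a ℤ.* b) ℤ.* (c ℤ.* d) ≡ ℤ.- ((a ℤ.* c) ℤ.* (b ℤ.* d))
  exchange = solve 4 (λ a b c d → (:- a :* b) :* (c :* d) := :- ((a :* c) :* (b :* d))) refl
sortSign-swap (z ∷ p) x y q = trans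
  (cong₂ ℤ._*_ (sgns-swap z p x y q) (sortSign-swap p x y q))
  (sym (ℤ.neg-distribʳ-* (sgns z (p ++ y ∷ x ∷ q)) _))

sortSign-alternating : Alternating sortSign
sortSign-alternating = alternating sortSign-swap

Decreasing : List ℕ → Set
Decreasing = AllPairs _>_

sgns-decreasing : ∀ {x xs} → All (x >_) xs → sgns x xs ≡ 1ℤ
sgns-decreasing []         = refl
sgns-decreasing (x>y ∷ x>) = cong₂ ℤ._*_ (sgn-> x>y) (sgns-decreasing x>)

sortSign-decreasing : ∀ {a} → Decreasing a → sortSign a ≡ 1ℤ
sortSign-decreasing []        = refl
sortSign-decreasing (x> ∷ xs) = cong₂ ℤ._*_ (sgns-decreasing x>) (sortSign-decreasing xs)

-- The last entry of `α` is outermost and so is performed first, because a tableau is taken apart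
-- from its last ribbon on.
lower : ∀ {ℓ} → Vector ℕ ℓ → Functional → Functional
lower {zero}  α F = F
lower {suc ℓ} α F = ∂ (lowerBy (α (fromℕ ℓ))) (lower (α ∘ inject₁) F)

lower-alternating : ∀ {ℓ} (α : Vector ℕ ℓ) {F} → Alternating F → Alternating (lower α F)
lower-alternating {zero}  α alt = alt
lower-alternating {suc ℓ} α alt = ∂-alternating (lower-alternating (α ∘ inject₁) alt)

-- The permanent of the matrix with entries `weight (β t) (α i)`, expanded along the last `α i`. Its
-- terms are the permutations matching equal sizes, each weighted by the choices of hooks.
count : ∀ {ℓ} → Vector ℕ ℓ → Vector ℕ ℓ → ℕ
count {zero}  α β = 1
count {suc ℓ} α β = sumᵛ (λ t → weight (β t) (α (fromℕ ℓ)) * count (α ∘ inject₁) (β ∘ punchIn t))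

+-sum : ∀ {ℓ} (v : Vector ℕ ℓ) → + sumᵛ v ≡ sumℤ (+_ ∘ v)
+-sum {zero}  v = refl
+-sum {suc ℓ} v = cong (λ z → + v zero ℤ.+ z) (+-sum (v ∘ suc))

-- `N` only bounds the sum of `β`, since the number of beads stays fixed while the induction deletes
-- entries of `β`.
raise-lower-count : ∀ {ℓ} (α β : Vector ℕ ℓ) → (∀ i → 0 < α i) → (∀ i → 0 < β i) →
  ∀ {N} → sumᵛ β ≤ N → raise β (lower α sortSign) (downFrom N) ≡ + count α β
raise-lower-count {zero}  α β 0<α 0<β {N} _ =
  sortSign-decreasing (applyDownFrom⁺₁ (λ x → x) N (λ j<i _ → j<i))
raise-lower-count {suc ℓ} α β 0<α 0<β {N} Σβ≤N = begin
  raise β (∂ (lowerBy m) F) a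
    ≡⟨ raise-lower m β 0<β alt a (full-≤ Σβ≤N full) ⟩
  ∂ (lowerBy m) (raise β F) a ℤ.+ contract m β F a
    -- The entries of `downFrom N` are all the numbers below `N`: no ribbon can be removed from the
    -- empty partition.
    ≡⟨ cong₂ ℤ._+_ (∂down-bottom (0<α _) (raise-alternating β alt) a full ∈-downFrom⁻)
                   (contract-sum m β F a) ⟩
  0ℤ ℤ.+ sumℤ (λ t → + weight (β t) m ℤ.* raise (β ∘ punchIn t) F a)
    ≡⟨ ℤ.+-identityˡ _ ⟩
  sumℤ (λ t → + weight (β t) m ℤ.* raise (β ∘ punchIn t) F a)
    ≡⟨ sumℤ-cong (λ t → trans
        (cong (λ z → + weight (β t) m ℤ.* z)
          (raise-lower-count (α ∘ inject₁) (β ∘ punchIn t) (λ _ → 0<α _) (λ _ → 0<β _)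
            (ℕ.≤-trans (ℕ.≤-trans (ℕ.m≤n+m _ (β t)) (ℕ.≤-reflexive (sym (sum-remove {i = t} β))))
              Σβ≤N)))
        (sym (ℤ.pos-* (weight (β t) m) _))) ⟩
  sumℤ (λ t → + (weight (β t) m * count (α ∘ inject₁) (β ∘ punchIn t)))
    ≡⟨ +-sum (λ t → weight (β t) m * count (α ∘ inject₁) (β ∘ punchIn t)) ⟨
  + count α β ∎
  where
  open ≡-Reasoning
  m = α (fromℕ ℓ)
  F = lower (α ∘ inject₁) sortSign
  a = downFrom N
  alt = lower-alternating (α ∘ inject₁) sortSign-alternating
  full : Full N a
  full = ∈-downFrom⁺

-- Signed walks

Signed : Set → Set
Signed A = List (Sign × A)

infixr 7 _·_
_·_ : Sign → ℤ → ℤ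
Sign.+ · z = z
Sign.- · z = ℤ.- z

·-* : ∀ s t z → (s Sign.* t) · z ≡ s · t · z
·-* Sign.+ t      z = refl
·-* Sign.- Sign.+ z = refl
·-* Sign.- Sign.- z = sym (ℤ.neg-involutive z)

·-zero : ∀ s → s · 0ℤ ≡ 0ℤ
·-zero Sign.+ = refl
·-zero Sign.- = refl

·-+ : ∀ s y z → s · (y ℤ.+ z) ≡ s · y ℤ.+ s · z
·-+ Sign.+ y z = refl
·-+ Sign.- y z = ℤ.neg-distrib-+ y z

module _ {A : Set} where

  total : (A → ℤ) → Signed A → ℤ
  total F []            = 0ℤ
  total F ((s , a) ∷ L) = s · F a ℤ.+ total F L

  total-++ : ∀ F L M → total F (L ++ M) ≡ total F L ℤ.+ total F M
  total-++ F []            M = sym (ℤ.+-identityˡ _)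
  total-++ F ((s , a) ∷ L) M =
    trans (cong (λ z → s · F a ℤ.+ z) (total-++ F L M)) (sym (ℤ.+-assoc (s · F a) _ _))

  total-cong : ∀ {F G} L → (∀ {s a} → (s , a) ∈ₗ L → F a ≡ G a) → total F L ≡ total G L
  total-cong []            e = refl
  total-cong ((s , a) ∷ L) e = cong₂ ℤ._+_ (cong (s ·_) (e (here refl))) (total-cong L (e ∘ there))

  -- Signs are ignored in the comparison, so an object is also excluded from occurring once with
  -- each sign.
  Distinct : Signed A → Set
  Distinct = AllPairs (_≢_ on proj₂)

module _ {A B : Set} where

  scale : Sign → Signed B → Signed B
  scale s = map (λ (t , b) → s Sign.* t , b)

  bind : Signed A → (A → Signed B) → Signed B
  bind L K = concatMap (λ (s , a) → scale s (K a)) L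

  total-scale : ∀ F s L → total F (scale s L) ≡ s · total F L
  total-scale F s []            = sym (·-zero s)
  total-scale F s ((t , b) ∷ L) =
    trans (cong₂ ℤ._+_ (·-* s t (F b)) (total-scale F s L)) (sym (·-+ s (t · F b) _))

  total-bind : ∀ F L K → total F (bind L K) ≡ total (total F ∘ K) L
  total-bind F []            K = refl
  total-bind F ((s , a) ∷ L) K = trans
    (total-++ F (scale s (K a)) (bind L K))
    (cong₂ ℤ._+_ (total-scale F s (K a)) (total-bind F L K))

  total-map₂ : ∀ (h : A → B) F L → total F (map (map₂ h) L) ≡ total (F ∘ h) L
  total-map₂ h F []      = refl
  total-map₂ h F ((s , a) ∷ L) = cong (λ z → s · F (h a) ℤ.+ z) (total-map₂ h F L)

  ∈-bind⁻ : ∀ L (K : A → Signed B) {u b} → (u , b) ∈ₗ bind L K →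
    ∃[ s ] ∃[ a ] ∃[ t ] (s , a) ∈ₗ L × (t , b) ∈ₗ K a × u ≡ s Sign.* t
  ∈-bind⁻ ((s , a) ∷ L) K p with ∈-++⁻ (scale s (K a)) p
  ... | inj₁ q with (t , _) , t∈ , refl ← ∈-map⁻ _ q = s , a , t , here refl , t∈ , refl
  ... | inj₂ q with s′ , a′ , t , s∈ , t∈ , e ← ∈-bind⁻ L K q = s′ , a′ , t , there s∈ , t∈ , e

  ∈-bind⁺ : ∀ {L} {K : A → Signed B} {s a t b} → (s , a) ∈ₗ L → (t , b) ∈ₗ K a →
    (s Sign.* t , b) ∈ₗ bind L K
  ∈-bind⁺ (here refl) t∈ = ∈-++⁺ˡ (∈-map⁺ _ t∈)
  ∈-bind⁺ {(s , a) ∷ L} {K} (there s∈) t∈ = ∈-++⁺ʳ (scale s (K a)) (∈-bind⁺ s∈ t∈)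

  distinct-bind : ∀ {L} {K : A → Signed B} → Distinct L →
    (∀ {s a} → (s , a) ∈ₗ L → Distinct (K a)) →
    (∀ {s s′ a a′ t t′ b} → (s , a) ∈ₗ L → (s′ , a′) ∈ₗ L → (t , b) ∈ₗ K a → (t′ , b) ∈ₗ K a′ →
      a ≡ a′) →
    Distinct (bind L K)
  distinct-bind {[]} [] dK inj = []
  distinct-bind {(s , a) ∷ L} {K} (a≢ ∷ dL) dK inj = AllPairs.++⁺
    (AllPairs.map⁺ (dK (here refl)))
    (distinct-bind dL (dK ∘ there) (λ p q → inj (there p) (there q)))
    (All.tabulate λ p → All.tabulate λ {(_ , b)} q eq → absurd p q eq)
    where
    absurd : ∀ {u b u′ b′} → (u , b) ∈ₗ scale s (K a) → (u′ , b′) ∈ₗ bind L K → ¬ (b ≡ b′)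
    absurd p q refl with (t , _) , t∈ , refl ← ∈-map⁻ _ p | s′ , a′ , t′ , s∈ , t∈′ , _ ← ∈-bind⁻ L
      K q =
      All.lookup a≢ s∈ (inj (here refl) (there s∈) t∈ t∈′)

infix 4 _∪_≡[_]_

-- x ∪ r ≡[ s ] b: the entry x, absent from r, is inserted before the first
-- smaller entry, and s is the sign of the cycle that moves it there.
data _∪_≡[_]_ (x : ℕ) : List ℕ → Sign → List ℕ → Set where
  last  : x ∪ [] ≡[ Sign.+ ] x ∷ []
  front : ∀ {y ys} → y < x → x ∪ y ∷ ys ≡[ Sign.+ ] x ∷ y ∷ ys
  skip  : ∀ {y ys s zs} → x < y → x ∪ ys ≡[ s ] zs → x ∪ y ∷ ys ≡[ opposite s ] y ∷ zs

insert : ℕ → List ℕ → Signed (List ℕ)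
insert x []       = (Sign.+ , x ∷ []) ∷ []
insert x (y ∷ ys) with ℕ.<-cmp x y
... | tri< _ _ _ = map (λ (s , zs) → opposite s , y ∷ zs) (insert x ys)
-- A repeated entry produces no term, in accordance with the vanishing of alternating functions.
... | tri≈ _ _ _ = []
... | tri> _ _ _ = (Sign.+ , x ∷ y ∷ ys) ∷ []

∈-insert⁻ : ∀ {x ys s zs} → (s , zs) ∈ₗ insert x ys → x ∪ ys ≡[ s ] zs
∈-insert⁻ {x} {[]}     (here refl) = last
∈-insert⁻ {x} {y ∷ ys} p with ℕ.<-cmp x y
... | tri< x<y _ _ with _ , q , refl ← ∈-map⁻ _ p = skip x<y (∈-insert⁻ q)
∈-insert⁻ {x} {y ∷ ys} (here refl) | tri> _ _ y<x = front y<x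

∈-insert⁺ : ∀ {x ys s zs} → x ∪ ys ≡[ s ] zs → (s , zs) ∈ₗ insert x ys
∈-insert⁺ last = here refl
∈-insert⁺ {x} (front {y} y<x) with ℕ.<-cmp x y
... | tri< _ _ y≮x = contradiction y<x y≮x
... | tri≈ _ _ y≮x = contradiction y<x y≮x
... | tri> _ _ _   = here refl
∈-insert⁺ {x} (skip {y} x<y p) with ℕ.<-cmp x y
... | tri< _ _ _   = ∈-map⁺ _ (∈-insert⁺ p)
... | tri≈ x≮y _ _ = contradiction x<y x≮y
... | tri> x≮y _ _ = contradiction x<y x≮y

distinct-insert : ∀ x ys → Distinct (insert x ys)
distinct-insert x []       = [] ∷ []
distinct-insert x (y ∷ ys) with ℕ.<-cmp x y
... | tri< _ _ _ = AllPairs.map⁺ (AllPairs.map (λ { ≢ refl → ≢ refl }) (distinct-insert x ys))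
... | tri≈ _ _ _ = []
... | tri> _ _ _ = [] ∷ []

total-insert : ∀ {F} → Alternating F → ∀ x ys → total F (insert x ys) ≡ F (x ∷ ys)
total-insert alt x []       = ℤ.+-identityʳ _
total-insert {F} alt x (y ∷ ys) with ℕ.<-cmp x y
... | tri≈ _ refl _ = sym (vanishes alt [] (x ∷ ys) (inj₂ (here refl)))
... | tri> _ _ _    = ℤ.+-identityʳ _
... | tri< _ _ _    = begin
  total F (map (λ (s , zs) → opposite s , y ∷ zs) (insert x ys)) ≡⟨ negated (insert x ys) ⟩
  ℤ.- total (F ∘ (y ∷_)) (insert x ys)  ≡⟨ cong ℤ.-_ (total-insert (alternating-∷ y alt) x ys) ⟩
  ℤ.- F (y ∷ x ∷ ys)                     ≡⟨ Alternating.swap alt [] x y ys ⟨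
  F (x ∷ y ∷ ys)                         ∎
  where
  open ≡-Reasoning
  negated : ∀ L → total F (map (λ (s , zs) → opposite s , y ∷ zs) L) ≡ ℤ.- total (F ∘ (y ∷_)) L
  negated []             = refl
  negated ((s , zs) ∷ L) = trans
    (cong₂ ℤ._+_ (·-* Sign.- s (F (y ∷ zs))) (negated L))
    (sym (ℤ.neg-distrib-+ (s · F (y ∷ zs)) _))

insertᵐ : Maybe ℕ → List ℕ → Signed (List ℕ)
insertᵐ m xs = maybe′ (λ y → insert y xs) [] m

-- After a move inside the tail the head is inserted afresh, because the moved entry may have
-- overtaken it or landed on it.
moves : Move → List ℕ → Signed (List ℕ)
moves g []       = []
moves g (x ∷ xs) = insertᵐ (g x) xs ++ bind (moves g xs) (insert x)

total-moves : ∀ {F} → Alternating F → ∀ g xs → total F (moves g xs) ≡ ∂ g F xs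
total-moves alt g []       = refl
total-moves {F} alt g (x ∷ xs) = trans
  (total-++ F (insertᵐ (g x) xs) (bind (moves g xs) (insert x)))
  (cong₂ ℤ._+_
    (total-insertᵐ (g x))
    (trans (total-bind F (moves g xs) (insert x))
      (trans (total-cong (moves g xs) (λ {_} {ys} _ → total-insert alt x ys))
        (total-moves (alternating-∷ x alt) g xs))))
  where
  total-insertᵐ : ∀ m → total F (insertᵐ m xs) ≡ at m (λ y → F (y ∷ xs))
  total-insertᵐ (just y) = total-insert alt y xs
  total-insertᵐ nothing  = refl

insert-All⁺ : ∀ {P : ℕ → Set} {x r s b} → x ∪ r ≡[ s ] b → P x → All P r → All P b
insert-All⁺ last       px pr        = px ∷ pr
insert-All⁺ (front _)  px pr        = px ∷ pr
insert-All⁺ (skip _ i) px (py ∷ pr) = py ∷ insert-All⁺ i px pr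

insert-All⁻ : ∀ {P : ℕ → Set} {x r s b} → x ∪ r ≡[ s ] b → All P b → P x × All P r
insert-All⁻ last       (px ∷ pr) = px , pr
insert-All⁻ (front _)  (px ∷ pr) = px , pr
insert-All⁻ (skip _ i) (py ∷ pb) with px , pr ← insert-All⁻ i pb = px , py ∷ pr

insert-decreasing : ∀ {x r s b} → x ∪ r ≡[ s ] b → Decreasing r → Decreasing b
insert-decreasing last           []       = [] ∷ []
insert-decreasing (front y<x)    (y> ∷ d) = (y<x ∷ All.map (λ z<y → ℕ.<-trans z<y y<x) y>) ∷ y> ∷ d
insert-decreasing (skip x<y i)   (y> ∷ d) = insert-All⁺ i x<y y> ∷ insert-decreasing i d

insert-length : ∀ {x r s b} → x ∪ r ≡[ s ] b → length b ≡ suc (length r)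
insert-length last       = refl
insert-length (front _)  = refl
insert-length (skip _ i) = cong suc (insert-length i)

insert-sum : ∀ {x r s b} → x ∪ r ≡[ s ] b → sum b ≡ x + sum r
insert-sum last       = refl
insert-sum (front _)  = refl
insert-sum {x} (skip {y} {ys} _ i) = trans (cong (λ z → y + z) (insert-sum i))
  (exchange y x (sum ys))
  where
  exchange : ∀ a b c → a + (b + c) ≡ b + (a + c)
  exchange a b c = trans (sym (ℕ.+-assoc a b c))
    (trans (cong (λ z → z + c) (ℕ.+-comm a b)) (ℕ.+-assoc b a c))

insert-injective : ∀ {x r r′ s s′ b} → x ∪ r ≡[ s ] b → x ∪ r′ ≡[ s′ ] b → r ≡ r′
insert-injective last          last          = refl
insert-injective (front _)     (front _)     = refl
insert-injective (skip _ i)    (skip _ i′)   = cong (_ ∷_) (insert-injective i i′)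
insert-injective last          (skip x<x _)  = contradiction x<x (ℕ.<-irrefl refl)
insert-injective (front _)     (skip x<x _)  = contradiction x<x (ℕ.<-irrefl refl)
insert-injective (skip x<x _)  last          = contradiction x<x (ℕ.<-irrefl refl)
insert-injective (skip x<x _)  (front _)     = contradiction x<x (ℕ.<-irrefl refl)

-- `r` consists of the entries that stay, and the sign combines the cycle taking `x` out with the
-- cycle putting `y` in. The description is symmetric in source and target, so removing a ribbon is
-- the same datum as adding it, read backwards.
record Shift (g : Move) (b : List ℕ) (s : Sign) (b′ : List ℕ) : Set where
  constructor shift
  field
    {x y}      : ℕ
    {r}        : List ℕ
    {s₁ s₂}    : Sign
    decreasing : Decreasing r
    moved      : g x ≡ just y
    source     : x ∪ r ≡[ s₁ ] b
    target     : y ∪ r ≡[ s₂ ] b′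
    signs      : s ≡ s₁ Sign.* s₂

shift-decreasing : ∀ {g b s b′} → Shift g b s b′ → Decreasing b′
shift-decreasing (shift d _ _ i _) = insert-decreasing i d

shift-length : ∀ {g b s b′} → Shift g b s b′ → length b ≡ length b′
shift-length (shift _ _ i i′ _) = trans (insert-length i) (sym (insert-length i′))

insert-front : ∀ {x r} → All (x >_) r → x ∪ r ≡[ Sign.+ ] x ∷ r
insert-front []      = last
insert-front (p ∷ _) = front p

insert-front⁻ : ∀ {x r s b} → All (x >_) r → x ∪ r ≡[ s ] b → s ≡ Sign.+ × b ≡ x ∷ r
insert-front⁻ _        last         = refl , refl
insert-front⁻ _        (front _)    = refl , refl
insert-front⁻ (p ∷ _)  (skip q _)   = contradiction p (ℕ.<-asym q)

insert-second⁻ : ∀ {x y r s b} → All (x >_) r → x < y → x ∪ y ∷ r ≡[ s ] b →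
  s ≡ Sign.- × b ≡ y ∷ x ∷ r
insert-second⁻ x>r x<y (front y<x)  = contradiction y<x (ℕ.<-asym x<y)
insert-second⁻ x>r _   (skip _ i) with refl , refl ← insert-front⁻ x>r i = refl , refl

no-duplicate : ∀ {x r s b} → ¬ (x ∪ x ∷ r ≡[ s ] b)
no-duplicate (front x<x)  = ℕ.<-irrefl refl x<x
no-duplicate (skip x<x _) = ℕ.<-irrefl refl x<x

opposite-*ˡ : ∀ s t → opposite (s Sign.* t) ≡ opposite s Sign.* t
opposite-*ˡ Sign.+ t = refl
opposite-*ˡ Sign.- t = Sign.opposite-involutive t

opposite-*ʳ : ∀ s t → opposite (s Sign.* t) ≡ s Sign.* opposite t
opposite-*ʳ s t = trans (cong opposite (Sign.*-comm s t))
  (trans (opposite-*ˡ t s) (Sign.*-comm (opposite t) s))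

opposite-*-opposite : ∀ s t → opposite s Sign.* opposite t ≡ s Sign.* t
opposite-*-opposite s t = trans (sym (opposite-*ˡ s (opposite t)))
  (trans (cong opposite (sym (opposite-*ʳ s t))) (Sign.opposite-involutive _))

∈-moves⁻ : ∀ {g b s b′} → Decreasing b → (s , b′) ∈ₗ moves g b → Shift g b s b′
∈-moves⁻ {g} {x ∷ xs} (x> ∷ d) p with ∈-++⁻ (insertᵐ (g x) xs) p
... | inj₁ q with just y ← g x in eq = shift d eq (insert-front x>) (∈-insert⁻ q) refl
... | inj₂ q with s , ys , t , s∈ , t∈ , refl ← ∈-bind⁻ (moves g xs) (insert x) q
  with shift {x = x′} {y = y′} {r = r} {s₁ = s₁} {s₂ = s₂} dr moved i i′ refl ← ∈-moves⁻ d s∈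
  with x′<x , r<x ← insert-All⁻ i x> with ℕ.<-cmp y′ x
... | tri< y′<x _ _ with refl , refl ← insert-front⁻ (insert-All⁺ i′ y′<x r<x) (∈-insert⁻ t∈) =
  shift (r<x ∷ dr) moved (skip x′<x i) (skip y′<x i′)
    (trans (Sign.*-identityʳ _) (sym (opposite-*-opposite s₁ s₂)))
-- The moved entry has landed on the head, so reinserting the head gives nothing.
... | tri≈ _ refl _ with refl , refl ← insert-front⁻ r<x i′ =
  contradiction (∈-insert⁻ {x} {x ∷ r} t∈) no-duplicate
-- The moved entry overtakes the head. The extra sign comes from reinserting the head behind it; in
-- the shift it comes from the source skipping the head while the target does not.
... | tri> _ _ x<y′
  with refl , refl ← insert-front⁻ (All.map (λ z<x → ℕ.<-trans z<x x<y′) r<x) i′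
  with refl , refl ← insert-second⁻ r<x x<y′ (∈-insert⁻ t∈) =
  shift (r<x ∷ dr) moved (skip x′<x i) (front x<y′)
    (trans (cong (Sign._* Sign.-) (Sign.*-identityʳ s₁))
      (trans (Sign.*-comm s₁ Sign.-) (sym (Sign.*-identityʳ _))))

∈-moves⁺ : ∀ {g b s b′} → Decreasing b → Shift g b s b′ → (s , b′) ∈ₗ moves g b
∈-moves⁺ {g} _ (shift {x = x} dr moved last last refl) rewrite moved = here refl
∈-moves⁺ {g} {x ∷ xs} _ (shift dr moved (front _) i′ refl) rewrite moved =
  ∈-++⁺ˡ (∈-insert⁺ i′)
∈-moves⁺ {g} {x ∷ xs} (x> ∷ d) (shift {s₂ = s₂} (r<x ∷ dr) moved (skip {s = s₁} x′<x i)
  (skip {s = s₂′} y′<x i′) refl) =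
  ∈-++⁺ʳ (insertᵐ (g x) xs) (subst (λ s → (s , _) ∈ₗ bind (moves g xs) (insert x))
    (trans (Sign.*-identityʳ _) (sym (opposite-*-opposite s₁ s₂′)))
    (∈-bind⁺ (∈-moves⁺ d (shift dr moved i i′ refl))
      (∈-insert⁺ (insert-front (insert-All⁺ i′ y′<x r<x)))))
∈-moves⁺ {g} {x ∷ xs} (x> ∷ d) (shift {r = _ ∷ r} (r<x ∷ dr) moved (skip {s = s₁} x′<x i)
  (front x<y′) refl) =
  ∈-++⁺ʳ (insertᵐ (g x) xs) (subst (λ s → (s , _) ∈ₗ bind (moves g xs) (insert x))
    (trans (cong (Sign._* Sign.-) (Sign.*-identityʳ s₁))
      (trans (Sign.*-comm s₁ Sign.-) (sym (Sign.*-identityʳ _))))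
    (∈-bind⁺ (∈-moves⁺ d (shift dr moved i
      (insert-front (All.map (λ z<x → ℕ.<-trans z<x x<y′) r<x)) refl))
      (∈-insert⁺ (skip x<y′ (insert-front r<x)))))

-- Whether the old head still occurs in the result tells if the head or a later entry has moved. For
-- this a move must never return the entry it is given.
distinct-moves : ∀ {g} → (∀ {x} → g x ≢ just x) → ∀ {b} → Decreasing b → Distinct (moves g b)
distinct-moves moving []       = []
distinct-moves {g} moving {x ∷ xs} (x> ∷ d) = AllPairs.++⁺
  (distinct-insertᵐ (g x))
  (distinct-bind (distinct-moves moving d) (λ {_} {ys} _ → distinct-insert x ys)
    (λ _ _ p q → insert-injective (∈-insert⁻ p) (∈-insert⁻ q)))
  (All.tabulate λ p → All.tabulate λ {(_ , _)} q eq → absurd p q eq)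
  where
  distinct-insertᵐ : ∀ m → Distinct (insertᵐ m xs)
  distinct-insertᵐ (just y) = distinct-insert y xs
  distinct-insertᵐ nothing  = []
  absurd : ∀ {u b u′ b′} → (u , b) ∈ₗ insertᵐ (g x) xs → (u′ , b′) ∈ₗ bind (moves g xs) (insert x) →
    b ≢ b′
  absurd p q refl with just y ← g x in eq | _ , ys , _ , _ , t∈ , _ ← ∈-bind⁻ (moves g xs) (insert x) q =
    proj₁ (insert-All⁻ {P = _≢ x} (∈-insert⁻ {x} {ys} t∈)
      (insert-All⁺ (∈-insert⁻ p) y≢x (All.map ℕ.<⇒≢ x>))) refl
    where
    y≢x : y ≢ x
    y≢x refl = moving eq

-- Walks along a sequence of moves

walks : List Move → List ℕ → Signed (List (List ℕ))
walks []       b = (Sign.+ , []) ∷ []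
walks (g ∷ gs) b = bind (moves g b) (λ b′ → map (map₂ (b′ ∷_)) (walks gs b′))

-- The constant function is not alternating, but walks only visit decreasing lists, and there it
-- agrees with the alternating function `sortSign`.
total-walks : ∀ gs {b} → Decreasing b → total (λ _ → 1ℤ) (walks gs b) ≡ foldr ∂ sortSign gs b
total-walks []       d = sym (sortSign-decreasing d)
total-walks (g ∷ gs) {b} d = begin
  total (λ _ → 1ℤ) (bind (moves g b) (λ b′ → map (map₂ (b′ ∷_)) (walks gs b′)))
    ≡⟨ total-bind _ (moves g b) _ ⟩
  total (λ b′ → total (λ _ → 1ℤ) (map (map₂ (b′ ∷_)) (walks gs b′))) (moves g b)
    ≡⟨ total-cong (moves g b) (λ {_} {b′} b′∈ → trans
        (total-map₂ (b′ ∷_) (λ _ → 1ℤ) (walks gs b′))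
        (total-walks gs (shift-decreasing (∈-moves⁻ d b′∈)))) ⟩
  total (foldr ∂ sortSign gs) (moves g b)
    ≡⟨ total-moves (foldr-alternating gs) g b ⟩
  ∂ g (foldr ∂ sortSign gs) b ∎
  where
  open ≡-Reasoning
  foldr-alternating : ∀ gs → Alternating (foldr ∂ sortSign gs)
  foldr-alternating []       = sortSign-alternating
  foldr-alternating (g ∷ gs) = ∂-alternating (foldr-alternating gs)

distinct-walks : ∀ {gs} → All (λ g → ∀ {x} → g x ≢ just x) gs → ∀ {b} → Decreasing b →
  Distinct (walks gs b)
distinct-walks []             d = [] ∷ []
distinct-walks {g ∷ gs} (moving ∷ all) {b} d = distinct-bind (distinct-moves moving d)
  (λ {_} {b′} b′∈ → AllPairs.map⁺ (AllPairs.map (λ { ≢ refl → ≢ refl })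
    (distinct-walks all (shift-decreasing (∈-moves⁻ d b′∈)))))
  (λ _ _ → same)
  where
  same : ∀ {t t′ a a′ w} → (t , w) ∈ₗ map (map₂ (a ∷_)) (walks gs a) →
    (t′ , w) ∈ₗ map (map₂ (a′ ∷_)) (walks gs a′) → a ≡ a′
  same p q with _ , _ , refl ← ∈-map⁻ _ p | _ , _ , refl ← ∈-map⁻ _ q = refl

-- Ribbons and beads

Rows : Set
Rows = ℕ → ℕ

Antitone : Rows → Set
Antitone f = ∀ i → f (suc i) ≤ f i

-- The shape with rows [f i, g i) is a ribbon with top row t and height h.
record Strip (t h : ℕ) (f g : Rows) : Set where
  field
    above  : ∀ i → i < t → f i ≡ g i
    starts : f t < g t
    inside : ∀ i → i < h → g (suc (t + i)) ≡ suc (f (t + i))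
    beyond : ∀ i → t + h < i → f i ≡ g i

open Strip

strip-tail : ∀ {t h f g} → Strip (suc t) h f g → Strip t h (f ∘ suc) (g ∘ suc)
strip-tail s = record
  { above  = λ i i<t → above s (suc i) (s≤s i<t)
  ; starts = starts s
  ; inside = inside s
  ; beyond = λ i p → beyond s (suc i) (s≤s p)
  }

strip-next : ∀ {h f g} → Antitone f → Strip 0 (suc h) f g → Strip 0 h (f ∘ suc) (g ∘ suc)
strip-next anti s = record
  { above  = λ _ ()
  ; starts = ℕ.≤-trans (s≤s (anti 0)) (ℕ.≤-reflexive (sym (inside s 0 (s≤s z≤n))))
  ; inside = λ i i<h → inside s (suc i) (s≤s i<h)
  ; beyond = λ i p → beyond s (suc i) (s≤s p)
  }

-- The strictly decreasing numbers f i + (N - 1 - i): adding a ribbon with k cells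
-- to f adds k to one of them and sorts the result, and the height of the ribbon is
-- the number of entries jumped over.
beads : ℕ → Rows → List ℕ
beads zero    f = []
beads (suc N) f = f 0 + N ∷ beads N (f ∘ suc)

beads-cong : ∀ N {f g} → (∀ i → f i ≡ g i) → beads N f ≡ beads N g
beads-cong zero    e = refl
beads-cong (suc N) e = cong₂ _∷_ (cong (λ x → x + N) (e 0)) (beads-cong N (e ∘ suc))

beads-< : ∀ N {f} → Antitone f → All (f 0 + N >_) (beads N f)
beads-< zero    anti = []
beads-< (suc N) {f} anti = ℕ.+-monoʳ-< (f 0) ℕ.≤-refl ∷
  All.map (λ p → ℕ.<-≤-trans p (ℕ.+-mono-≤ (anti 0) (ℕ.n≤1+n N))) (beads-< N (anti ∘ suc))

beads-<′ : ∀ N {f} → Antitone f → All (f 0 + N >_) (beads N (f ∘ suc))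
beads-<′ N anti = All.map (λ p → ℕ.<-≤-trans p (ℕ.+-monoˡ-≤ N (anti 0))) (beads-< N (anti ∘ suc))

beads-decreasing : ∀ N {f} → Antitone f → Decreasing (beads N f)
beads-decreasing zero    anti = []
beads-decreasing (suc N) anti = beads-<′ N anti ∷ beads-decreasing N (anti ∘ suc)

Vanishes : ℕ → Rows → Set
Vanishes N f = ∀ i → N ≤ i → f i ≡ 0

vanishes-suc : ∀ {N f} → Vanishes (suc N) f → Vanishes N (f ∘ suc)
vanishes-suc v i N≤i = v (suc i) (s≤s N≤i)

beads-injective : ∀ N {f g} → Vanishes N f → Vanishes N g → beads N f ≡ beads N g → ∀ i → f i ≡ g i
beads-injective zero    vf vg e i = trans (vf i z≤n) (sym (vg i z≤n))
beads-injective (suc N) vf vg e zero    = ℕ.+-cancelʳ-≡ N _ _ (proj₁ (∷-injective e))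
beads-injective (suc N) vf vg e (suc i) =
  beads-injective N (vanishes-suc vf) (vanishes-suc vg) (proj₂ (∷-injective e)) i

-- By `inside`, the bead of `g` in row `i + 1` equals the bead of `f` in row `i`. Hence the beads of
-- `f` are those of `g` without row 0, together with the bead `x` of `f` in the bottom row `h`,
-- which lies behind `h` common beads.
strip⇒insert : ∀ N {h f g} → Antitone f → Vanishes N g → Strip 0 h f g →
  ∃[ x ] x < g 0 + (N ∸ 1) × x ∪ beads (N ∸ 1) (g ∘ suc) ≡[ [-1]^ h ] beads N f
strip⇒insert zero    anti v s with () ← subst (_ <_) (v 0 z≤n) (starts s)
strip⇒insert (suc N) {zero} {f} {g} anti v s =
  f 0 + N , ℕ.+-monoˡ-< N (starts s) ,
  subst (λ r → f 0 + N ∪ r ≡[ Sign.+ ] f 0 + N ∷ beads N (f ∘ suc))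
    (beads-cong N (λ i → beyond s (suc i) (s≤s z≤n)))
    (insert-front (beads-<′ N anti))
strip⇒insert (suc zero) {suc h} anti v s with () ← trans (sym (v 1 ℕ.≤-refl)) (inside s 0 (s≤s z≤n))
strip⇒insert (suc (suc N)) {suc h} {f} {g} anti v s
  with x , x< , i ← strip⇒insert (suc N) (anti ∘ suc) (vanishes-suc v) (strip-next anti s) =
  x , ℕ.<-trans x<f (ℕ.+-monoˡ-< (suc N) (starts s)) ,
  subst (λ z → x ∪ z ∷ beads N (λ i → g (suc (suc i))) ≡[ opposite ([-1]^ h) ] f 0 + suc N ∷ beads
    (suc N) (f ∘ suc))
    head (skip x<f i)
  where
  x<f : x < f 0 + suc N
  x<f = proj₁ (insert-All⁻ i (beads-<′ (suc N) anti))
  head : f 0 + suc N ≡ g 1 + N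
  head = trans (ℕ.+-suc (f 0) N) (cong (λ z → z + N) (sym (inside s 0 (s≤s z≤n))))

shift-∷ : ∀ {g b s b′ z} → All (z >_) b → All (z >_) b′ → Shift g b s b′ →
  Shift g (z ∷ b) s (z ∷ b′)
shift-∷ z> z>′ (shift {s₁ = s₁} {s₂} d moved i i′ e) = shift
  (proj₂ (insert-All⁻ i z>) ∷ d) moved
  (skip (proj₁ (insert-All⁻ i z>)) i) (skip (proj₁ (insert-All⁻ i′ z>′)) i′)
  (trans e (sym (opposite-*-opposite s₁ s₂)))

-- A row above the ribbon has the same bead in both lists; removal and insertion both pass it, so
-- its two signs cancel. Here `k` is just the distance travelled by the bead; its equality with the
-- number of cells comes later from sums of beads.
strip⇒shift : ∀ N {t h f g} → Antitone f → Antitone g → Vanishes N g → Strip t h f g →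
  ∃[ k ] 0 < k × Shift (raiseBy k) (beads N f) ([-1]^ h) (beads N g)
strip⇒shift zero {t} antif antig v s with () ← subst (_ <_) (v t z≤n) (starts s)
strip⇒shift (suc N) {zero} {h} {f} {g} antif antig v s with x , x<y , i ← strip⇒insert
  (suc N) antif v s =
  g 0 + N ∸ x , ℕ.m<n⇒0<n∸m x<y , shift
    (beads-decreasing N (antig ∘ suc)) (cong just (ℕ.m+[n∸m]≡n (ℕ.<⇒≤ x<y)))
    i (insert-front (beads-<′ N antig)) (sym (Sign.*-identityʳ _))
strip⇒shift (suc N) {suc t} {h} {f} {g} antif antig v s
  with k , 0<k , sh ← strip⇒shift N (antif ∘ suc) (antig ∘ suc) (vanishes-suc v) (strip-tail s) =
  k , 0<k , subst (λ z → Shift (raiseBy k) (z ∷ beads N (f ∘ suc)) ([-1]^ h)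
    (g 0 + N ∷ beads N (g ∘ suc))) (cong (λ z → z + N) (sym f0≡g0))
    (shift-∷ (subst (λ z → All (z + N >_) (beads N (f ∘ suc))) f0≡g0 (beads-<′ N antif))
      (beads-<′ N antig) sh)
  where
  f0≡g0 = above s 0 (s≤s z≤n)

-- Each bead that `x` skips gives one equation `inside`; where `x` stops, all further beads agree
-- and hence so do the rows.
insert⇒strip : ∀ N {f g x s} → Antitone g → Vanishes (suc N) f → Vanishes (suc N) g →
  x < g 0 + N → x ∪ beads N (g ∘ suc) ≡[ s ] beads (suc N) f → ∃[ h ] Strip 0 h f g × s ≡ [-1]^ h
insert⇒strip N {f} {g} {x} {s} anti vf vg x<y i = go N x<y vf vg anti refl refl i
  where
  oneRow : ∀ {N f g} → Vanishes (suc N) f → Vanishes (suc N) g → f 0 + N < g 0 + N →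
    beads N (f ∘ suc) ≡ beads N (g ∘ suc) → Strip 0 0 f g
  oneRow {N} {f} {g} vf vg lt e = record
    { above  = λ _ ()
    ; starts = ℕ.+-cancelʳ-< N _ _ lt
    ; inside = λ _ ()
    ; beyond = λ { (suc i) _ → beads-injective N (vanishes-suc vf) (vanishes-suc vg) e i }
    }
  go : ∀ N {f g x s b r} → x < g 0 + N → Vanishes (suc N) f → Vanishes (suc N) g → Antitone g →
    r ≡ beads N (g ∘ suc) → b ≡ beads (suc N) f → x ∪ r ≡[ s ] b →
      ∃[ h ] Strip 0 h f g × s ≡ [-1]^ h
  go N x<y vf vg anti er eb last with refl , e ← ∷-injective eb =
    0 , oneRow vf vg x<y (trans (sym e) er) , refl
  go N x<y vf vg anti er eb (front _) with refl , e ← ∷-injective eb =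
    0 , oneRow vf vg x<y (trans (sym e) er) , refl
  go (suc N) {f} {g} x<y vf vg anti er eb (skip x<z i)
    with refl , er′ ← ∷-injective er | e , eb′ ← ∷-injective eb
    with h , s , refl ← go N x<z (vanishes-suc vf) (vanishes-suc vg) (anti ∘ suc) er′ eb′ i =
    suc h , record
      { above  = λ _ ()
      ; starts = ℕ.≤-trans (ℕ.≤-reflexive (sym g1)) (anti 0)
      ; inside = λ { zero _ → g1 ; (suc i) (s≤s p) → inside s i p }
      ; beyond = λ { (suc i) (s≤s p) → beyond s i p }
      } , refl
    where
    g1 : g 1 ≡ suc (f 0)
    g1 = ℕ.+-cancelʳ-≡ N _ _ (trans e (ℕ.+-suc (f 0) N))

shift⇒strip : ∀ N {f g k s} → 0 < k → Antitone g → Vanishes N f → Vanishes N g →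
  Shift (raiseBy k) (beads N f) s (beads N g) → ∃[ t ] ∃[ h ] Strip t h f g × s ≡ [-1]^ h
shift⇒strip N {k = k} 0<k anti vf vg (shift {x = x} d refl i i′ refl) =
  go N anti vf vg refl refl i i′
  where
  x<x+k = ℕ.m<m+n x 0<k
  go : ∀ N {f g r b b′ s₁ s₂} → Antitone g → Vanishes N f → Vanishes N g → b ≡ beads N f →
    b′ ≡ beads N g →
    x ∪ r ≡[ s₁ ] b → x + k ∪ r ≡[ s₂ ] b′ → ∃[ t ] ∃[ h ] Strip t h f g × s₁ Sign.* s₂ ≡ [-1]^ h
  go (suc N) {f} {g} {s₁ = s₁} anti vf vg eb eb′ last last with e , e′ ← ∷-injective eb′
    with h , s , e″ ← insert⇒strip N anti vf vg (ℕ.<-≤-trans x<x+k (ℕ.≤-reflexive e))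
          (subst₂ (λ r b → x ∪ r ≡[ s₁ ] b) e′ eb last) =
    0 , h , s , trans (Sign.*-identityʳ _) e″
  go (suc N) {f} {g} {s₁ = s₁} anti vf vg eb eb′ i (front p) with e , e′ ← ∷-injective eb′
    with h , s , e″ ← insert⇒strip N anti vf vg (ℕ.<-≤-trans x<x+k (ℕ.≤-reflexive e))
          (subst₂ (λ r b → x ∪ r ≡[ s₁ ] b) e′ eb i) =
    0 , h , s , trans (Sign.*-identityʳ _) e″
  go (suc N) {f} {g} anti vf vg eb eb′ (skip {s = s₁} _ i) (skip {s = s₂} _ i′)
    with e , e₁ ← ∷-injective eb | e′ , e₁′ ← ∷-injective eb′
    with t , h , s , e″ ← go N (anti ∘ suc) (vanishes-suc vf) (vanishes-suc vg) e₁ e₁′ i i′ =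
    suc t , h , record
      { above  = λ { zero _ → ℕ.+-cancelʳ-≡ N _ _ (trans (sym e) e′) ; (suc i) (s≤s p) →
        above s i p }
      ; starts = starts s
      ; inside = inside s
      ; beyond = λ { (suc i) (s≤s p) → beyond s i p }
      } , trans (opposite-*-opposite s₁ s₂) e″
  go (suc N) anti vf vg eb eb′ (front p) (skip q _) = contradiction (ℕ.<-trans p x<x+k) (ℕ.<-asym q)
  go zero anti vf vg eb () _ last
  go zero anti vf vg eb () _ (front _)
  go zero anti vf vg eb () _ (skip _ _)

open Strip

strip-outside : ∀ {t h f g i} → Strip t h f g → i < t ⊎ t + h < i → f i ≡ g i
strip-outside s (inj₁ i<t) = above s _ i<t
strip-outside s (inj₂ b<i) = beyond s _ b<i

data Position (t h i : ℕ) : Set where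
  out : i < t ⊎ t + h < i → Position t h i
  row : ∀ d → d ≤ h → i ≡ t + d → Position t h i

position : ∀ t h i → Position t h i
position t h i with i ℕ.<? t | (t + h) ℕ.<? i
... | yes p | _     = out (inj₁ p)
... | no _  | yes q = out (inj₂ q)
... | no p  | no q  = row (i ∸ t)
  (ℕ.≤-trans (ℕ.∸-monoˡ-≤ t (ℕ.≮⇒≥ q)) (ℕ.≤-reflexive (ℕ.m+n∸m≡n t h)))
  (sym (ℕ.m+[n∸m]≡n (ℕ.≮⇒≥ p)))

strip-row : ∀ {t h f g} → Antitone f → Strip t h f g → ∀ {d} → d ≤ h → f (t + d) < g (t + d)
strip-row {t} anti s {zero} _ rewrite ℕ.+-identityʳ t = starts s
strip-row {t} anti s {suc d} d<h rewrite ℕ.+-suc t d =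
  ℕ.≤-trans (s≤s (anti (t + d))) (ℕ.≤-reflexive (sym (inside s d d<h)))

strip-≤ : ∀ {t h f g} → Antitone f → Strip t h f g → ∀ i → f i ≤ g i
strip-≤ {t} {h} anti s i with position t h i
... | out o          = ℕ.≤-reflexive (strip-outside s o)
... | row d d≤h refl = ℕ.<⇒≤ (strip-row anti s d≤h)

first : ∀ {f g : Rows} → (∀ i → f i ≤ g i) → ∀ n → f n < g n →
  ∃[ t ] t ≤ n × f t < g t × (∀ i → i < t → f i ≡ g i)
first {f} {g} le n p with f 0 ℕ.<? g 0
... | yes q = 0 , z≤n , q , λ _ ()
first {f} {g} le zero p    | no q = contradiction p q
first {f} {g} le (suc n) p | no q with t , t≤n , r , e ← first {f ∘ suc} {g ∘ suc} (le ∘ suc) n p =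
  suc t , s≤s t≤n , r , λ { zero _ → ℕ.≤-antisym (le 0) (ℕ.≮⇒≥ q) ; (suc i) (s≤s i<t) → e i i<t }

final : ∀ {f g : Rows} → (∀ i → f i ≤ g i) → ∀ N → (∀ i → N ≤ i → f i ≡ g i) → ∀ {t} → f t < g t →
  ∃[ b ] t ≤ b × f b < g b × (∀ i → b < i → f i ≡ g i)
final le zero    eq {t} p = contradiction (eq t z≤n) (ℕ.<⇒≢ p)
final {f} {g} le (suc N) eq {t} p with f N ℕ.<? g N
... | yes q = N , ℕ.≮⇒≥ (λ N<t → ℕ.<⇒≢ p (eq t N<t)) , q , eq
... | no q  = final le N (λ i N≤i → eq′ i N≤i (N ℕ.≟ i)) p
  where
  eq′ : ∀ i → N ≤ i → Dec (N ≡ i) → f i ≡ g i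
  eq′ i N≤i (yes refl) = ℕ.≤-antisym (le N) (ℕ.≮⇒≥ q)
  eq′ i N≤i (no N≢i)   = eq i (ℕ.≤∧≢⇒< N≤i N≢i)

-- Ribbons as connected skew shapes without squares

len : Partition → Rows
len μ = rowLength (rows μ)

∣suc-self∣ : ∀ j → ∣ suc j - j ∣ ≡ 1
∣suc-self∣ zero    = refl
∣suc-self∣ (suc j) = ∣suc-self∣ j

suc-of : ∀ {i i′} → ∣ i - i′ ∣ ≡ 1 → i < i′ → i′ ≡ suc i
suc-of {zero}  {suc i′} e  (s≤s _) = e
suc-of {suc i} {suc i′} e (s≤s p)  = cong suc (suc-of e p)

module _ {μ ν : Partition} where

  -- A path that gets below row `i` takes a vertical step from row `i` to row `i + 1`; its column
  -- lies outside `ν` in the upper row and inside `μ` in the lower one.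
  crossing : ∀ {c d} → Star (Step μ ν) c d → ∀ {i} → proj₁ c ≤ i → i < proj₁ d →
    len ν i < len μ (suc i)
  crossing ε p q = contradiction q (ℕ.≤⇒≯ p)
  crossing (_◅_ {c} {c′} st path) {i} p q with proj₁ c′ ℕ.≤? i
  ... | yes p′ = crossing path p′ q
  crossing {c} (_◅_ {_} {_ , j} ((_ , c∉ν) , (c′∈μ , _) , inj₁ (refl , _)) path) p q | no ≰ =
    contradiction p ≰
  crossing {c} (_◅_ {_} {i′ , j} ((_ , c∉ν) , (c′∈μ , _) , inj₂ (e , refl)) path) {i} p q | no ≰ =
    go (suc-of e (ℕ.≤-<-trans p (ℕ.≰⇒> ≰))) c′∈μ
    where
    go : i′ ≡ suc (proj₁ c) → j < len μ i′ → len ν i < len μ (suc i)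
    go refl c′∈μ with refl ← ℕ.≤-antisym p (s≤s⁻¹ (ℕ.≰⇒> ≰)) = ℕ.≤-<-trans (ℕ.≮⇒≥ c∉ν) c′∈μ

  -- Between the first and last rows where the shapes differ, connectedness makes consecutive rows
  -- share a column, and the absence of squares allows no second one. These are the two inequalities
  -- behind `inside`.
  ribbon⇒strip : Antitone (len μ) → Antitone (len ν) → ∀ {N} → Vanishes N (len μ) →
    Vanishes N (len ν) →
    IsNonemptyRibbon μ ν → ∃[ t ] ∃[ h ] Strip t h (len ν) (len μ)
  ribbon⇒strip antiμ antiν {N} vμ vν R
    with (i₀ , j) , j<μ , j≮ν ← IsNonemptyRibbon.nonempty R
    with t , _ , t∈ , abv ← first (⊆⇒rowLength≤ {μ} {ν} (IsNonemptyRibbon.inner⊆outer R)) i₀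
      (ℕ.≤-<-trans (ℕ.≮⇒≥ j≮ν) j<μ)
    with b , t≤b , b∈ , bel ← final (⊆⇒rowLength≤ {μ} {ν} (IsNonemptyRibbon.inner⊆outer R)) N
      (λ i N≤i → trans (vν i N≤i) (sym (vμ i N≤i))) t∈ =
    t , b ∸ t , record
      { above  = abv
      ; starts = t∈
      ; inside = λ i i<h → ℕ.≤-antisym (narrow (t + i))
          (crossing path (ℕ.m≤m+n t i) (subst (t + i <_) (ℕ.m+[n∸m]≡n t≤b) (ℕ.+-monoʳ-< t i<h)))
      ; beyond = λ i p → bel i (subst (_< i) (ℕ.m+[n∸m]≡n t≤b) p)
      }
    where
    open IsNonemptyRibbon R
    path = connected (t , len ν t) (b , len ν b) (t∈ , ℕ.<-irrefl refl) (b∈ , ℕ.<-irrefl refl)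
    narrow : ∀ i → len μ (suc i) ≤ suc (len ν i)
    narrow i = ℕ.≮⇒≥ λ lt → noSquare i (len ν i)
      ( (ℕ.<-≤-trans (ℕ.<-trans (ℕ.n<1+n _) lt) (antiμ i) , ℕ.<-irrefl refl)
      , (ℕ.<-≤-trans lt (antiμ i) , ℕ.≤⇒≯ (ℕ.n≤1+n _))
      , (ℕ.<-trans (ℕ.n<1+n _) lt , ℕ.≤⇒≯ (antiν i))
      , (lt , ℕ.≤⇒≯ (ℕ.m≤n⇒m≤1+n (antiν i))))

  step-sym : ∀ {c d} → Step μ ν c d → Step μ ν d c
  step-sym {_ , j} {_ , j′} (c∈ , d∈ , inj₁ (refl , e)) =
    d∈ , c∈ , inj₁ (refl , trans (ℕ.∣-∣-comm j′ j) e)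
  step-sym {i , _} {i′ , _} (c∈ , d∈ , inj₂ (e , refl)) =
    d∈ , c∈ , inj₂ (trans (ℕ.∣-∣-comm i′ i) e , refl)

  leftward : ∀ {i} k → (i , len ν i + k) ∈ μ ∖ ν → Star (Step μ ν) (i , len ν i + k) (i , len ν i)
  leftward {i} zero    c∈ = subst (λ j → Star (Step μ ν) (i , j) (i , len ν i))
    (sym (ℕ.+-identityʳ _)) ε
  leftward {i} (suc k) c∈ rewrite ℕ.+-suc (len ν i) k =
    (c∈ , next , inj₁ (refl , ∣suc-self∣ (len ν i + k))) ◅ leftward k next
    where
    next : (i , len ν i + k) ∈ μ ∖ ν
    next = ℕ.<-trans (ℕ.n<1+n _) (proj₁ c∈) , ℕ.≤⇒≯ (ℕ.m≤m+n _ k)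

  toLeft : ∀ {i j} → (i , j) ∈ μ ∖ ν → Star (Step μ ν) (i , j) (i , len ν i)
  toLeft {i} {j} c∈ = subst (λ j → Star (Step μ ν) (i , j) (i , len ν i)) eq
    (leftward (j ∸ len ν i) (subst (λ j → (i , j) ∈ μ ∖ ν) (sym eq) c∈))
    where eq = ℕ.m+[n∸m]≡n (ℕ.≮⇒≥ (proj₂ c∈))

  -- Every cell is joined to the leftmost cell of the top row: go left to the end of the row, right
  -- to its last cell, which lies under the leftmost cell of the row above, then up, and repeat.
  strip⇒ribbon : ∀ {t h} → Antitone (len ν) → Strip t h (len ν) (len μ) → IsNonemptyRibbon μ ν
  strip⇒ribbon {t} {h} anti s = record
    { inner⊆outer = λ (i , j) j<ν → ℕ.<-≤-trans j<ν (strip-≤ anti s i)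
    ; nonempty    = (t , len ν t) , starts s , ℕ.<-irrefl refl
    ; connected   = λ c d c∈ d∈ → toTop c∈ ◅◅ reverse step-sym (toTop d∈)
    ; noSquare    = λ i j (c , _ , d , e) →
      square (proj₂ c) (proj₁ e) (row? (ℕ.≤-<-trans (ℕ.≮⇒≥ (proj₂ c)) (proj₁ c)))
        (row? (ℕ.≤-<-trans (ℕ.≮⇒≥ (proj₂ d)) (proj₁ d)))
    }
    where
    row? : ∀ {i} → len ν i < len μ i → ∃[ d ] d ≤ h × i ≡ t + d
    row? {i} p with position t h i
    ... | out o       = contradiction (strip-outside s o) (ℕ.<⇒≢ p)
    ... | row d d≤h e = d , d≤h , e
    square : ∀ {i j} → ¬ (j < len ν i) → suc j < len μ (suc i) →
      ∃[ d ] d ≤ h × i ≡ t + d → ∃[ d ] d ≤ h × suc i ≡ t + d → ⊥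
    square {i} {j} j≮ j< (d , _ , refl) (d′ , d′≤h , e) =
      j≮ (s≤s⁻¹ (ℕ.<-≤-trans j< (ℕ.≤-reflexive (inside s d
      (ℕ.<-≤-trans (ℕ.≤-reflexive (ℕ.+-cancelˡ-≡ t _ _ (trans (ℕ.+-suc t d) e))) d′≤h)))))
    climb : ∀ d → d ≤ h → Star (Step μ ν) (t + d , len ν (t + d)) (t , len ν t)
    climb zero    _   rewrite ℕ.+-identityʳ t = ε
    climb (suc d) d<h rewrite ℕ.+-suc t d =
      reverse step-sym (toLeft lowerCell) ◅◅
        (lowerCell , upperCell , inj₂ (∣suc-self∣ (t + d) , refl)) ◅ climb d (ℕ.<⇒≤ d<h)
      where
      lowerCell : (suc (t + d) , len ν (t + d)) ∈ μ ∖ ν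
      lowerCell = ℕ.≤-reflexive (sym (inside s d d<h)) , ℕ.≤⇒≯ (anti (t + d))
      upperCell : (t + d , len ν (t + d)) ∈ μ ∖ ν
      upperCell = strip-row anti s (ℕ.<⇒≤ d<h) , ℕ.<-irrefl refl
    toTop : ∀ {c} → c ∈ μ ∖ ν → Star (Step μ ν) c (t , len ν t)
    toTop {i , j} c∈ with d , d≤h , refl ← row? (ℕ.≤-<-trans (ℕ.≮⇒≥ (proj₂ c∈)) (proj₁ c∈)) =
      toLeft c∈ ◅◅ climb d d≤h

-- Heights and sizes of ribbons in terms of cells

∈-cellsOfRows⁻ : ∀ xs {i j} → (i , j) ∈ₗ cellsOfRows xs → j < rowLength xs i
∈-cellsOfRows⁻ (x ∷ xs) p with ∈-++⁻ (firstRow x) p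
... | inj₁ q with _ , j∈ , refl ← ∈-map⁻ _ q = ∈-upTo⁻ j∈
... | inj₂ q with _ , c∈ , refl ← ∈-map⁻ _ q = ∈-cellsOfRows⁻ xs c∈

∈-cellsOfRows⁺ : ∀ xs {i j} → j < rowLength xs i → (i , j) ∈ₗ cellsOfRows xs
∈-cellsOfRows⁺ (x ∷ xs) {zero}  p = ∈-++⁺ˡ (∈-map⁺ top (∈-upTo⁺ p))
∈-cellsOfRows⁺ (x ∷ xs) {suc i} p = ∈-++⁺ʳ (firstRow x) (∈-map⁺ down (∈-cellsOfRows⁺ xs p))

-- The occupied rows without repetitions and the list `t`, ..., `t + h` have the same members and no
-- duplicates, so they are permutations of each other.
height-strip : ∀ {t h} μ ν → Antitone (len ν) → Strip t h (len ν) (len μ) → height μ ν ≡ h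
height-strip {t} {h} μ ν anti s = cong (_∸ 1) (trans
  (↭-length (∼bag⇒↭ (unique∧set⇒bag
    (deduplicate-! _) (applyUpTo⁺₁ (λ d → t + d) (suc h) (λ i<j _ → ℕ.<⇒≢ (ℕ.+-monoʳ-< t i<j)))
    (mk⇔ to from))))
  (length-applyUpTo (λ d → t + d) (suc h)))
  where
  is : List ℕ
  is = map proj₁ (skewCells μ ν)
  to : ∀ {i} → i ∈ₗ deduplicate ℕ._≟_ is → i ∈ₗ applyUpTo (λ d → t + d) (suc h)
  to {i} i∈ with (_ , j) , c∈ , refl ← ∈-map⁻ proj₁ (∈-deduplicate⁻ ℕ._≟_ is i∈)
    with c∈μ , c∉ν ← ∈-filter⁻ (λ c → ¬? (c ∈? ν)) {xs = cells μ} c∈ with position t h i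
  ... | out o          = contradiction (subst (j <_) (sym (strip-outside s o))
    (∈-cellsOfRows⁻ (rows μ) c∈μ)) c∉ν
  ... | row d d≤h refl = ∈-applyUpTo⁺ (λ d → t + d) (s≤s d≤h)
  from : ∀ {i} → i ∈ₗ applyUpTo (λ d → t + d) (suc h) → i ∈ₗ deduplicate ℕ._≟_ is
  from i∈ with d , s≤s d≤h , refl ← ∈-applyUpTo⁻ (λ d → t + d) i∈ = ∈-deduplicate⁺ ℕ._≟_
    (∈-map⁺ proj₁ (∈-filter⁺ (λ c → ¬? (c ∈? ν)) (∈-cellsOfRows⁺ (rows μ) (strip-row anti s d≤h))
      (ℕ.<-irrefl refl)))

filter-map : ∀ {A B : Set} {P : B → Set} (P? : Decidable P) (f : A → B) xs →
  filter P? (map f xs) ≡ map f (filter (P? ∘ f) xs)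
filter-map P? f []       = refl
filter-map P? f (x ∷ xs) with P? (f x)
... | yes _ = cong (f x ∷_) (filter-map P? f xs)
... | no  _ = filter-map P? f xs

length-filter-upTo : ∀ a n → length (filter (λ j → ¬? (j ℕ.<? a)) (upTo n)) ≡ n ∸ a
length-filter-upTo a zero    = sym (ℕ.0∸n≡0 a)
length-filter-upTo a (suc n) = begin
  length (filter P? (upTo (suc n)))
    ≡⟨ cong (length ∘ filter P?)
    (upTo-∷ʳ n) ⟨
  length (filter P? (upTo n ++ n ∷ []))
    ≡⟨ cong length
    (filter-++ P? (upTo n) (n ∷ [])) ⟩
  length (filter P? (upTo n) ++ filter P? (n ∷ []))        ≡⟨ length-++ (filter P? (upTo n)) ⟩
  length (filter P? (upTo n)) + length (filter P? (n ∷ []))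
    ≡⟨ cong (λ z → z + length (filter P? (n ∷ []))) (length-filter-upTo a n) ⟩
  n ∸ a + length (filter P? (n ∷ []))                      ≡⟨ lastColumn ⟩
  suc n ∸ a                                                ∎
  where
  open ≡-Reasoning
  P? = λ j → ¬? (j ℕ.<? a)
  lastColumn : n ∸ a + length (filter P? (n ∷ [])) ≡ suc n ∸ a
  lastColumn with n ℕ.<? a
  ... | yes n<a = begin
    n ∸ a + length (filter P? (n ∷ []))
      ≡⟨ cong (λ z → n ∸ a + length z)
      (filter-reject P? {xs = []} (λ n≮a → n≮a n<a)) ⟩
    n ∸ a + 0                            ≡⟨ ℕ.+-identityʳ _ ⟩
    n ∸ a                                ≡⟨ ℕ.m≤n⇒m∸n≡0 (ℕ.<⇒≤ n<a) ⟩
    0                                    ≡⟨ ℕ.m≤n⇒m∸n≡0 n<a ⟨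
    suc n ∸ a                            ∎
  ... | no n≮a = begin
    n ∸ a + length (filter P? (n ∷ []))
      ≡⟨ cong (λ z → n ∸ a + length z)
      (filter-accept P? {xs = []} n≮a) ⟩
    n ∸ a + 1                            ≡⟨ ℕ.+-comm (n ∸ a) 1 ⟩
    1 + (n ∸ a)                          ≡⟨ ℕ.+-∸-assoc 1 (ℕ.≮⇒≥ n≮a) ⟨
    suc n ∸ a                            ∎

outside : Rows → List ℕ → List Cell
outside f xs = filter (λ c → ¬? (proj₂ c ℕ.<? f (proj₁ c))) (cellsOfRows xs)

length-outside : ∀ f x xs → length (outside f (x ∷ xs)) ≡ (x ∸ f 0) + length (outside (f ∘ suc) xs)
length-outside f x xs = begin
  length (filter P? (firstRow x ++ map down (cellsOfRows xs)))
    ≡⟨ cong length (filter-++ P? (firstRow x) _) ⟩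
  length (filter P? (firstRow x) ++ filter P? (map down (cellsOfRows xs)))
    ≡⟨ length-++ (filter P? (firstRow x)) ⟩
  length (filter P? (firstRow x)) + length (filter P? (map down (cellsOfRows xs)))
    ≡⟨ cong₂ _+_
        (trans (cong length (filter-map P? top (upTo x)))
          (trans (length-map top (filter (P? ∘ top) (upTo x))) (length-filter-upTo (f 0) x)))
        (trans (cong length (filter-map P? down (cellsOfRows xs)))
          (length-map down (outside (f ∘ suc) xs))) ⟩
  (x ∸ f 0) + length (outside (f ∘ suc) xs) ∎
  where
  open ≡-Reasoning
  P? = λ (c : Cell) → ¬? (proj₂ c ℕ.<? f (proj₁ c))

-- The summands `N - 1 - i` are common to both bead lists, so only the row lengths contribute to the
-- difference of the sums.
sum-beads : ∀ N f xs → length xs ≤ N → (∀ i → f i ≤ rowLength xs i) →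
  sum (beads N (rowLength xs)) ≡ sum (beads N f) + length (outside f xs)
sum-beads N f [] _ f≤ = trans
  (cong sum (beads-cong N (λ i → sym (ℕ.n≤0⇒n≡0 (f≤ i)))))
  (sym (ℕ.+-identityʳ _))
sum-beads (suc N) f (x ∷ xs) (s≤s p) f≤ = begin
  x + N + sum (beads N (rowLength xs))
    ≡⟨ cong₂ (λ a b → a + N + b) (sym (ℕ.m+[n∸m]≡n (f≤ 0)))
      (sum-beads N (f ∘ suc) xs p (f≤ ∘ suc)) ⟩
  f 0 + (x ∸ f 0) + N + (S + L)
    ≡⟨ solve 5 (λ a b c d e → a :+ b :+ c :+ (d :+ e) := a :+ c :+ d :+ (b :+ e)) refl (f 0)
      (x ∸ f 0) N S L ⟩
  f 0 + N + S + ((x ∸ f 0) + L)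
    ≡⟨ cong (λ z → f 0 + N + S + z) (length-outside f x xs) ⟨
  f 0 + N + S + length (outside f (x ∷ xs)) ∎
  where
  open ≡-Reasoning
  open ℕ-Solver.+-*-Solver
  S = sum (beads N (f ∘ suc))
  L = length (outside (f ∘ suc) xs)

rowLength-antitone : ∀ {xs} → Linked _≥_ xs → Antitone (rowLength xs)
rowLength-antitone []       i       = z≤n
rowLength-antitone [-]      i       = z≤n
rowLength-antitone (x≥y ∷ l) zero    = x≥y
rowLength-antitone (x≥y ∷ l) (suc i) = rowLength-antitone l i

antitone : ∀ μ → Antitone (len μ)
antitone (mkPartition xs l _) = rowLength-antitone (recompute (linked? (flip ℕ._≤?_) xs) l)

sum-shift : ∀ {k b s b′} → Shift (raiseBy k) b s b′ → sum b′ ≡ sum b + k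
sum-shift {k} {b} {s} {b′} (shift {x = x} {r = r} _ refl i i′ _) = begin
  sum b′             ≡⟨ insert-sum i′ ⟩
  x + k + sum r      ≡⟨ solve 3 (λ x k r → x :+ k :+ r := x :+ r :+ k) refl x k (sum r) ⟩
  x + sum r + k      ≡⟨ cong (λ z → z + k) (insert-sum i) ⟨
  sum b + k          ∎
  where
  open ≡-Reasoning
  open ℕ-Solver.+-*-Solver

-- Partitions as lists of `N` beads

module _ (N : ℕ) where

  encode : Partition → List ℕ
  encode μ = beads N (len μ)

  Fits : Partition → Set
  Fits μ = length (rows μ) ≤ N

  fits-vanishes : ∀ {μ} → Fits μ → Vanishes N (len μ)
  fits-vanishes {μ} fits i N≤i = rowLength-beyond (rows μ) i (ℕ.≤-trans fits N≤i)

  encode-decreasing : ∀ μ → Decreasing (encode μ)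
  encode-decreasing μ = beads-decreasing N (antitone μ)

  encode-injective : ∀ {μ ν} → Fits μ → Fits ν → encode μ ≡ encode ν → μ ≡ ν
  encode-injective {μ} {ν} fμ fν e = rows-injective (rowLength-injective (positive μ) (positive ν)
    (beads-injective N (fits-vanishes {μ} fμ) (fits-vanishes {ν} fν) e))

  sum-encode : ∀ {μ ν} → Fits μ → ν ⊆ μ → sum (encode μ) ≡ sum (encode ν) + ∣ μ ∖ ν ∣
  sum-encode {μ} {ν} fμ ν⊆μ = sum-beads N (len ν) (rows μ) fμ (⊆⇒rowLength≤ {μ} {ν} ν⊆μ)

  -- Both numbers measure the growth of the sum of the beads: a move adds `k` to it, and the cells
  -- of the skew shape add their number.
  shift-size : ∀ {μ ν k s} → Fits μ → ν ⊆ μ → Shift (raiseBy k) (encode ν) s (encode μ) →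
    ∣ μ ∖ ν ∣ ≡ k
  shift-size {μ} {ν} fμ ν⊆μ sh = ℕ.+-cancelˡ-≡ (sum (encode ν)) _ _
    (trans (sym (sum-encode {μ} {ν} fμ ν⊆μ)) (sum-shift sh))

  ribbon⇒shift : ∀ {μ ν} → Fits μ → Fits ν → IsNonemptyRibbon μ ν →
    0 < ∣ μ ∖ ν ∣ × Shift (raiseBy ∣ μ ∖ ν ∣) (encode ν) (ribbonSign μ ν) (encode μ)
  ribbon⇒shift {μ} {ν} fμ fν R
    with t , h , s ← ribbon⇒strip {μ} {ν} (antitone μ) (antitone ν) (fits-vanishes {μ} fμ)
      (fits-vanishes {ν} fν) R
    with k , 0<k , sh ← strip⇒shift N (antitone ν) (antitone μ) (fits-vanishes {μ} fμ) s
    rewrite shift-size {μ} {ν} fμ (IsNonemptyRibbon.inner⊆outer R) sh | height-strip μ ν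
      (antitone ν) s = 0<k , sh

  shift⇒ribbon : ∀ {μ ν k s} → Fits μ → Fits ν → 0 < k → Shift (raiseBy k) (encode ν) s (encode μ) →
    IsNonemptyRibbon μ ν × ribbonSign μ ν ≡ s × ∣ μ ∖ ν ∣ ≡ k
  shift⇒ribbon {μ} {ν} fμ fν 0<k sh
    with t , h , s , refl ← shift⇒strip N 0<k (antitone μ) (fits-vanishes {ν} fν)
      (fits-vanishes {μ} fμ) sh =
    R , cong [-1]^_ (height-strip μ ν (antitone ν) s) , shift-size {μ} {ν} fμ
      (IsNonemptyRibbon.inner⊆outer R) sh
    where R = strip⇒ribbon {μ} {ν} (antitone ν) s

beads-head : ∀ L {g x} → Vanishes L g → All (x >_) (beads L g) → g 0 + L ≤ x
beads-head zero    {g} v []      = subst (λ z → z + 0 ≤ _) (sym (v 0 z≤n)) z≤n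
beads-head (suc L) {g} v (p ∷ _) = ℕ.≤-trans (ℕ.≤-reflexive (ℕ.+-suc (g 0) L)) p

record Decoding (b : List ℕ) : Set where
  field
    {rs}    : List ℕ
    linked  : Linked _≥_ rs
    pos     : All (_> 0) rs
    short   : length rs ≤ length b
    beads-≡ : beads (length b) (rowLength rs) ≡ b

-- The row of a bead has as its length the bead minus the number of beads after it; strict decrease
-- makes these lengths weakly decreasing.
decoding : ∀ {b} → Decreasing b → Decoding b
decoding {[]}     [] = record { linked = [] ; pos = [] ; short = z≤n ; beads-≡ = refl }
decoding {x ∷ xs} (x> ∷ d) = extend (x ∸ L)
  (ℕ.m∸n+n≡m (ℕ.≤-trans (ℕ.m≤n+m L _) head≤)) linked pos short beads-≡ head≤
  where
  open Decoding (decoding d)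
  L = length xs
  head≤ : rowLength rs 0 + L ≤ x
  head≤ = beads-head L (λ i L≤i → rowLength-beyond rs i (ℕ.≤-trans short L≤i))
    (subst (All (x >_)) (sym beads-≡) x>)
  extend : ∀ {rs} a → a + L ≡ x → Linked _≥_ rs → All (_> 0) rs → length rs ≤ L →
    beads L (rowLength rs) ≡ xs →
    rowLength rs 0 + L ≤ x → Decoding (x ∷ xs)
  -- An empty row must not be recorded, since the rows of a partition are positive; `rowLength`
  -- returns 0 there by default. An empty row above a nonempty one is excluded by the bound on the
  -- head.
  extend {[]} zero    e l p sh be _ = record
    { linked = [] ; pos = [] ; short = z≤n ; beads-≡ = cong₂ _∷_ e be }
  extend {y ∷ rs} zero e l (0<y ∷ p) sh be h =
    contradiction (ℕ.+-cancelʳ-≤ L y 0 (ℕ.≤-trans h (ℕ.≤-reflexive (sym e)))) (ℕ.<⇒≱ 0<y)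
  extend {[]} (suc a) e l p sh be h = record
    { linked = [-] ; pos = s≤s z≤n ∷ p ; short = s≤s sh ; beads-≡ = cong₂ _∷_ e be }
  extend {y ∷ rs} (suc a) e l p sh be h = record
    { linked = ℕ.+-cancelʳ-≤ L y (suc a) (ℕ.≤-trans h (ℕ.≤-reflexive (sym e))) ∷ l ; pos =
      s≤s z≤n ∷ p
    ; short = s≤s sh ; beads-≡ = cong₂ _∷_ e be }

decode : ∀ {N b} → Decreasing b → length b ≡ N → Σ[ μ ∈ Partition ] Fits N μ × encode N μ ≡ b
decode d refl = mkPartition rs linked pos , short , beads-≡
  where open Decoding (decoding d)

-- Cancellation by numbering

-- The elements with key κ are numbered from 0 to size κ - 1; only Good keys occur.
record Enumeration (S : Setoid 0ℓ 0ℓ) {K : Set} (Good : K → Set) : Set where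
  open Setoid S using (Carrier; _≈_)
  field
    key           : Carrier → K
    key-cong      : ∀ {x y} → x ≈ y → key x ≡ key y
    key-good      : ∀ x → Good (key x)
    size          : K → ℕ
    number        : Carrier → ℕ
    number-cong   : ∀ {x y} → x ≈ y → number x ≡ number y
    number<       : ∀ x → number x < size (key x)
    injective     : ∀ {x y} → key x ≡ key y → number x ≡ number y → x ≈ y
    element       : ∀ {κ i} → Good κ → i < size κ → Carrier
    key-element   : ∀ {κ i} (g : Good κ) (p : i < size κ) → key (element g p) ≡ κ
    number-element : ∀ {κ i} (g : Good κ) (p : i < size κ) → number (element g p) ≡ i

lookup-injective : ∀ {C : Set} {xs : List C} → Unique xs → ∀ i j → lookup xs i ≡ lookup xs j → i ≡ j
lookup-injective (x∉ ∷ u) zero    zero    e = refl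
lookup-injective {xs = x ∷ xs} (x∉ ∷ u) zero (suc j) e =
  contradiction e (All.lookup x∉ (∈-lookup j))
lookup-injective {xs = x ∷ xs} (x∉ ∷ u) (suc i) zero e =
  contradiction (sym e) (All.lookup x∉ (∈-lookup i))
lookup-injective (x∉ ∷ u) (suc i) (suc j) e = cong suc (lookup-injective u i j e)

index-unique : ∀ {C : Set} {xs ys : List C} {c d} → xs ≡ ys → Unique ys →
  (p : c ∈ₗ xs) (q : d ∈ₗ ys) → c ≡ d →
  toℕ (index p) ≡ toℕ (index q)
index-unique refl u p q e = cong toℕ (lookup-injective u (index p) (index q)
  (trans (sym (lookup-index p)) (trans e (lookup-index q))))

index-injective : ∀ {C : Set} {xs ys : List C} {c d} → xs ≡ ys → (p : c ∈ₗ xs) (q : d ∈ₗ ys) →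
  toℕ (index p) ≡ toℕ (index q) → c ≡ d
index-injective {xs = xs} refl p q e = trans (lookup-index p)
  (trans (cong (lookup xs) (toℕ-injective e)) (sym (lookup-index q)))

index-lookup : ∀ {C : Set} (xs : List C) i → index (∈-lookup {xs = xs} i) ≡ i
index-lookup (x ∷ xs) zero    = refl
index-lookup (x ∷ xs) (suc i) = cong suc (index-lookup xs i)

module _ {S : Setoid 0ℓ 0ℓ} {K C : Set} {Good : K → Set} where
  open Setoid S using (Carrier; _≈_)

  -- Elements are compared only by the equality of the setoid, so labels with propositional equality
  -- are listed in their place. The number of an element is the position of its label in a list
  -- without duplicates.
  record Coding : Set where
    field
      key       : Carrier → K
      key-cong  : ∀ {x y} → x ≈ y → key x ≡ key y
      key-good  : ∀ x → Good (key x)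
      listing     : K → List C
      unique    : ∀ {κ} → Good κ → Unique (listing κ)
      label      : Carrier → C
      label-cong : ∀ {x y} → x ≈ y → label x ≡ label y
      injective : ∀ {x y} → key x ≡ key y → label x ≡ label y → x ≈ y
      label∈     : ∀ x → label x ∈ₗ listing (key x)
      decoded   : ∀ {κ c} → Good κ → c ∈ₗ listing κ → ∃[ x ] key x ≡ κ × label x ≡ c

  enumeration : Coding → Enumeration S Good
  enumeration coding = record
    { key            = key
    ; key-cong       = key-cong
    ; key-good       = key-good
    ; size           = length ∘ listing
    ; number         = λ x → toℕ (index (label∈ x))
    ; number-cong    = λ {x} {y} x≈y → index-unique (cong listing (key-cong x≈y))
      (unique (key-good y)) (label∈ x) (label∈ y) (label-cong x≈y)
    ; number<        = λ x → toℕ<n (index (label∈ x))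
    ; injective      = λ {x} {y} e e′ → injective e
      (index-injective (cong listing e) (label∈ x) (label∈ y) e′)
    ; element        = λ g p → proj₁ (elem g p)
    ; key-element    = λ g p → proj₁ (proj₂ (elem g p))
    ; number-element = λ {κ} g p → let x , kx , cx = elem g p in trans
        (index-unique (cong listing kx) (unique g) (label∈ x) (∈-lookup (fromℕ< p)) cx)
        (trans (cong toℕ (index-lookup (listing κ) (fromℕ< p))) (toℕ-fromℕ< p))
    }
    where
    open Coding coding
    elem : ∀ {κ i} (g : Good κ) (p : i < length (listing κ)) →
      ∃[ x ] key x ≡ κ × label x ≡ lookup (listing κ) (fromℕ< p)
    elem g p = decoded g (∈-lookup (fromℕ< p))

module Cancellation {A B : SignedSet} {K : Set} {Good : K → Set}
  (EA : Enumeration (SignedSet.elements A) Good)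
  (EB : Enumeration (SignedSet.elements B) {Sign × K} (Good ∘ proj₂))
  (signA : ∀ a → SignedSet.sign A a ≡ Sign.+)
  (signB : ∀ b → proj₁ (Enumeration.key EB b) ≡ SignedSet.sign B b)
  (balanced : ∀ {κ} → Good κ → Enumeration.size EB (Sign.+ , κ) ≡ Enumeration.size EB
    (Sign.- , κ) + Enumeration.size EA κ)
  where
  private
    module A = SignedSet A
    module B = SignedSet B
    module SA = Setoid A.elements
    module SB = Setoid B.elements
    module EA = Enumeration EA
    module EB = Enumeration EB

  parity : B.Carrier → Sign
  parity = proj₁ ∘ EB.key

  base : B.Carrier → K
  base = proj₂ ∘ EB.key

  #⁻ : K → ℕ
  #⁻ k = EB.size (Sign.- , k)

  -- Elements of opposite sign with the same number are partners; the surplus of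
  -- positive elements is fixed.
  data Partner (b b′ : B.Carrier) : Set where
    paired  : parity b′ ≡ opposite (parity b) → base b′ ≡ base b → EB.number b′ ≡ EB.number b →
      EB.number b < #⁻ (base b) → Partner b b′
    surplus : parity b ≡ Sign.+ → #⁻ (base b) ≤ EB.number b → b′ B.≈ b → Partner b b′

  partner-sym : ∀ {b b′} → Partner b b′ → Partner b′ b
  partner-sym {b} {b′} (paired s k n lt) = paired
    (trans (sym (Sign.opposite-involutive _)) (cong opposite (sym s))) (sym k) (sym n)
    (subst₂ (λ k n → n < #⁻ k) (sym k) (sym n) lt)
  partner-sym (surplus s le e) = surplus
    (trans (cong proj₁ (EB.key-cong e)) s)
    (subst₂ (λ k n → #⁻ k ≤ n) (cong proj₂ (sym (EB.key-cong e))) (sym (EB.number-cong e)) le)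
    (SB.sym e)

  -- Partnership is symmetric and single-valued up to `B._≈_`. From this follow that `ι` is an
  -- involution, that it respects equality and that it fixes the values of `φ`.
  partner-unique : ∀ {b b′ b″} → Partner b b′ → Partner b b″ → b′ B.≈ b″
  partner-unique (paired s k n _) (paired s′ k′ n′ _) =
    EB.injective (cong₂ _,_ (trans s (sym s′)) (trans k (sym k′))) (trans n (sym n′))
  partner-unique (paired _ _ _ lt) (surplus _ le _) = contradiction lt (ℕ.≤⇒≯ le)
  partner-unique (surplus _ le _) (paired _ _ _ lt) = contradiction lt (ℕ.≤⇒≯ le)
  partner-unique (surplus _ _ e) (surplus _ _ e′)   = SB.trans e (SB.sym e′)

  partner-resp : ∀ {b c b′} → b B.≈ c → Partner c b′ → Partner b b′
  partner-resp e (paired s k n lt) = paired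
    (trans s (cong (opposite ∘ proj₁) (sym (EB.key-cong e))))
      (trans k (cong proj₂ (sym (EB.key-cong e))))
    (trans n (sym (EB.number-cong e)))
    (subst₂ (λ k n → n < #⁻ k) (cong proj₂ (sym (EB.key-cong e))) (sym (EB.number-cong e)) lt)
  partner-resp e (surplus s le e′) = surplus
    (trans (cong proj₁ (EB.key-cong e)) s)
    (subst₂ (λ k n → #⁻ k ≤ n) (cong proj₂ (sym (EB.key-cong e))) (sym (EB.number-cong e)) le)
    (SB.trans e′ (SB.sym e))

  #⁻≤ : ∀ {k} → Good k → #⁻ k ≤ EB.size (Sign.+ , k)
  #⁻≤ g = ℕ.≤-trans (ℕ.m≤m+n _ _) (ℕ.≤-reflexive (sym (balanced g)))

  partner : ∀ b → ∃ (Partner b)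
  partner b = go (parity b) refl
    where
    element-partner : ∀ {s} (p : EB.number b < EB.size (s , base b)) → s ≡ opposite (parity b) →
      EB.number b < #⁻ (base b) →
      ∃ (Partner b)
    element-partner {s} p s≡ lt = EB.element {s , base b} (EB.key-good b) p , paired
      (trans (cong proj₁ (EB.key-element (EB.key-good b) p)) s≡)
      (cong proj₂ (EB.key-element (EB.key-good b) p))
      (EB.number-element (EB.key-good b) p)
      lt
    go : ∀ s → parity b ≡ s → ∃ (Partner b)
    -- A negative element is numbered below `#⁻`, and `balanced` provides at least that many
    -- positive elements, so it always finds a partner.
    go Sign.- e = element-partner (ℕ.<-≤-trans lt (#⁻≤ (EB.key-good b))) (cong opposite (sym e)) lt
      where
      lt : EB.number b < #⁻ (base b)
      lt = subst (λ s → EB.number b < EB.size (s , base b)) e (EB.number< b)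
    go Sign.+ e with EB.number b ℕ.<? #⁻ (base b)
    ... | yes lt = element-partner lt (cong opposite (sym e)) lt
    ... | no ≮   = b , surplus e (ℕ.≮⇒≥ ≮) SB.refl

  ι : B.Carrier → B.Carrier
  ι = proj₁ ∘ partner

  base-ι : ∀ b → base (ι b) ≡ base b
  base-ι b with proj₂ (partner b)
  ... | paired _ k _ _  = k
  ... | surplus _ _ e   = cong proj₂ (EB.key-cong e)

  ιA : SignReversingInvolution A
  ιA = record
    { to             = id
    ; to-cong        = id
    ; involutive     = λ _ → SA.refl
    ; sign-reversing = λ x x≉x → contradiction SA.refl x≉x
    }

  ιB : SignReversingInvolution B
  ιB = record
    { to             = ι
    ; to-cong        = λ {b} {c} e → partner-unique (proj₂ (partner b))
      (partner-resp e (proj₂ (partner c)))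
    ; involutive     = λ b → partner-unique (proj₂ (partner (ι b)))
      (partner-sym (proj₂ (partner b)))
    ; sign-reversing = reversing
    }
    where
    reversing : ∀ b → ¬ (ι b B.≈ b) → B.sign (ι b) ≡ opposite (B.sign b)
    reversing b moved with proj₂ (partner b)
    ... | paired s _ _ _ = trans (sym (signB _)) (trans s (cong opposite (signB b)))
    ... | surplus _ _ e  = contradiction e moved

  surplus< : ∀ {k} → Good k → ∀ {i} → i < EA.size k → #⁻ k + i < EB.size (Sign.+ , k)
  surplus< g p = ℕ.<-≤-trans (ℕ.+-monoʳ-< _ p) (ℕ.≤-reflexive (sym (balanced g)))

  -- The first `#⁻` positive elements are used up by the negative ones, so the numbers from `A` are
  -- shifted by `#⁻`.
  φ : A.Carrier → B.Carrier
  φ a = EB.element {Sign.+ , EA.key a} (EA.key-good a) (surplus< (EA.key-good a) (EA.number< a))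

  key-φ : ∀ a → EB.key (φ a) ≡ (Sign.+ , EA.key a)
  key-φ a = EB.key-element {Sign.+ , EA.key a} (EA.key-good a)
    (surplus< (EA.key-good a) (EA.number< a))

  number-φ : ∀ a → EB.number (φ a) ≡ #⁻ (EA.key a) + EA.number a
  number-φ a = EB.number-element {Sign.+ , EA.key a} (EA.key-good a)
    (surplus< (EA.key-good a) (EA.number< a))

  φ-fixed : ∀ a → ι (φ a) B.≈ φ a
  φ-fixed a = partner-unique (proj₂ (partner (φ a))) (surplus
    (cong proj₁ (key-φ a))
    (subst₂ (λ k n → #⁻ k ≤ n) (sym (cong proj₂ (key-φ a))) (sym (number-φ a)) (ℕ.m≤m+n _ _))
    SB.refl)

  φ-cong : ∀ {a a′} → a A.≈ a′ → φ a B.≈ φ a′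
  φ-cong {a} {a′} e = EB.injective
    (trans (key-φ a) (trans (cong (Sign.+ ,_) (EA.key-cong e)) (sym (key-φ a′))))
    (trans (number-φ a) (trans (cong₂ _+_ (cong #⁻ (EA.key-cong e)) (EA.number-cong e))
      (sym (number-φ a′))))

  φ-injective : ∀ {a a′} → φ a B.≈ φ a′ → a A.≈ a′
  φ-injective {a} {a′} e = EA.injective same-key
    (ℕ.+-cancelˡ-≡ (#⁻ (EA.key a)) _ _ (begin
      #⁻ (EA.key a) + EA.number a    ≡⟨ number-φ a ⟨
      EB.number (φ a)                ≡⟨ EB.number-cong e ⟩
      EB.number (φ a′)               ≡⟨ number-φ a′ ⟩
      #⁻ (EA.key a′) + EA.number a′  ≡⟨ cong (λ k → #⁻ k + EA.number a′) same-key ⟨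
      #⁻ (EA.key a) + EA.number a′   ∎))
    where
    open ≡-Reasoning
    same-key : EA.key a ≡ EA.key a′
    same-key = cong proj₂ (trans (sym (key-φ a)) (trans (EB.key-cong e) (key-φ a′)))

  -- A paired element cannot be fixed, because its partner has the opposite sign. A surplus element
  -- comes from the number that remains after subtracting `#⁻`.
  φ-surjective : ∀ b → ι b B.≈ b → ∃[ a ] φ a B.≈ b
  φ-surjective b fixed with proj₂ (partner b)
  ... | paired s _ _ _ = contradiction
    (trans (cong proj₁ (sym (EB.key-cong fixed))) s) (Sign.s≢opposite[s] (parity b))
  ... | surplus s le _ = a , EB.injective
    (trans (key-φ a) (cong₂ _,_ (sym s) key-a))
    (trans (number-φ a) (trans (cong₂ _+_ (cong #⁻ key-a) (EA.number-element g lt))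
      (ℕ.m+[n∸m]≡n le)))
    where
    g = EB.key-good b
    lt : EB.number b ∸ #⁻ (base b) < EA.size (base b)
    lt = ℕ.+-cancelˡ-< (#⁻ (base b)) _ _ (ℕ.≤-<-trans (ℕ.≤-reflexive (ℕ.m+[n∸m]≡n le))
      (ℕ.<-≤-trans (subst (λ s → EB.number b < EB.size (s , base b)) s (EB.number< b))
        (ℕ.≤-reflexive (balanced g))))
    a = EA.element g lt
    key-a = EA.key-element g lt

  Φ : SignedBijection A B
  Φ = record
    { ιA     = ιA
    ; ιB     = ιB
    ; φ      = record
      { to        = λ (a , _) → φ a , φ-fixed a
      ; cong      = φ-cong
      ; bijective = φ-injective , λ (b , fixed) →
          let a , e = φ-surjective b fixed in (a , SA.refl) , λ e′ → SB.trans (φ-cong e′) e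
      }
    ; φ-sign = λ (a , _) → trans (sym (signB (φ a))) (trans (cong proj₁ (key-φ a)) (sym (signA a)))
    }

-- Hook permutations

punchIn-fromℕ : ∀ {n} (j : Fin n) → punchIn (fromℕ n) j ≡ inject₁ j
punchIn-fromℕ zero    = refl
punchIn-fromℕ (suc j) = cong suc (punchIn-fromℕ j)

punched : ∀ {n} (i j : Fin (suc n)) → i ≡ j ⊎ ∃[ k ] punchIn i k ≡ j
punched i j with i Fin.≟ j
... | yes i≡j = inj₁ i≡j
... | no  i≢j = inj₂ (punchOut i≢j , punchIn-punchOut i≢j)

-- The code of (H , σ) starts with t = σ(ℓ) and the height of the hook H t, followed
-- by the code of the hook permutation of length ℓ - 1 left after deleting both.
hookCodes : ∀ {ℓ} → Vector ℕ ℓ → Vector ℕ ℓ → List (List (ℕ × ℕ))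
codesFrom : ∀ {ℓ} → Vector ℕ (suc ℓ) → Vector ℕ (suc ℓ) → Fin (suc ℓ) → List (List (ℕ × ℕ))

hookCodes {zero}  α β = [] ∷ []
hookCodes {suc ℓ} α β = concat (tabulate (codesFrom α β))

codesFrom {ℓ} α β t = cartesianProductWith (λ h c → (toℕ t , h) ∷ c)
  (upTo (weight (β t) (α (fromℕ ℓ)))) (hookCodes (α ∘ inject₁) (β ∘ punchIn t))

length-cartesianProductWith : ∀ {A B C : Set} (f : A → B → C) xs ys →
  length (cartesianProductWith f xs ys) ≡ length xs * length ys
length-cartesianProductWith f []       ys = refl
length-cartesianProductWith f (x ∷ xs) ys = trans (length-++ (map (f x) ys))
  (cong₂ _+_ (length-map (f x) ys) (length-cartesianProductWith f xs ys))

length-concat-tabulate : ∀ {C : Set} {n} (f : Fin n → List C) →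
  length (concat (tabulate f)) ≡ sumᵛ (length ∘ f)
length-concat-tabulate {n = zero}  f = refl
length-concat-tabulate {n = suc n} f =
  trans (length-++ (f zero)) (cong (λ z → length (f zero) + z) (length-concat-tabulate (f ∘ suc)))

-- The codes are built along the recursion of `count`: a position `t`, one of `weight` many heights,
-- and a shorter code.
length-hookCodes : ∀ {ℓ} (α β : Vector ℕ ℓ) → length (hookCodes α β) ≡ count α β
length-hookCodes {zero}  α β = refl
length-hookCodes {suc ℓ} α β = trans
  (length-concat-tabulate (codesFrom α β))
  (sum-cong-≗ {x = length ∘ codesFrom α β} λ t → trans
    (length-cartesianProductWith (λ h c → (toℕ t , h) ∷ c) (upTo (weight (β t) (α (fromℕ ℓ))))
      (rest t))
    (cong₂ _*_ (length-upTo (weight (β t) (α (fromℕ ℓ))))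
      (length-hookCodes (α ∘ inject₁) (β ∘ punchIn t))))
  where
  rest : Fin (suc ℓ) → List (List (ℕ × ℕ))
  rest t = hookCodes (α ∘ inject₁) (β ∘ punchIn t)

weight-self : ∀ {k m} → k ≡ m → weight k m ≡ k
weight-self {k} {m} k≡m with k ℕ.≟ m
... | yes _   = refl
... | no  k≢m = contradiction k≡m k≢m

<weight : ∀ {h k m} → h < weight k m → h < k × k ≡ m
<weight {h} {k} {m} p with k ℕ.≟ m
... | yes k≡m = p , k≡m

∈-codesFrom⁻ : ∀ {ℓ} (α β : Vector ℕ (suc ℓ)) t {c} → c ∈ₗ codesFrom α β t →
  ∃[ h ] ∃[ c′ ] c ≡ (toℕ t , h) ∷ c′ × h < weight (β t) (α (fromℕ ℓ)) × c′ ∈ₗ hookCodes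
    (α ∘ inject₁) (β ∘ punchIn t)
∈-codesFrom⁻ {ℓ} α β t c∈
  with h , c′ , h∈ , c′∈ , e ← ∈-cartesianProductWith⁻ (λ h c → (toℕ t , h) ∷ c)
    (upTo (weight (β t) (α (fromℕ ℓ))))
         (hookCodes (α ∘ inject₁) (β ∘ punchIn t)) c∈ = h , c′ , e , ∈-upTo⁻ h∈ , c′∈

∈-hookCodes⁻ : ∀ {ℓ} {α β : Vector ℕ (suc ℓ)} {c} → c ∈ₗ hookCodes α β →
  ∃[ t ] ∃[ h ] ∃[ c′ ] c ≡ (toℕ t , h) ∷ c′ × h < β t × β t
    ≡ α (fromℕ ℓ) × c′ ∈ₗ hookCodes (α ∘ inject₁) (β ∘ punchIn t)
∈-hookCodes⁻ {ℓ} {α} {β} c∈ with _ , c∈L , L∈ ← ∈-concat⁻′ (tabulate (codesFrom α β)) c∈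
  with t , refl ← ∈-tabulate⁻ {f = codesFrom α β} L∈
  with h , c′ , e , h<w , c′∈ ← ∈-codesFrom⁻ α β t c∈L
  with h<β , β≡α ← <weight h<w = t , h , c′ , e , h<β , β≡α , c′∈

∈-hookCodes⁺ : ∀ {ℓ} {α β : Vector ℕ (suc ℓ)} t {h c′} → h < β t → β t ≡ α (fromℕ ℓ) →
  c′ ∈ₗ hookCodes (α ∘ inject₁) (β ∘ punchIn t) → (toℕ t , h) ∷ c′ ∈ₗ hookCodes α β
∈-hookCodes⁺ {ℓ} {α} {β} t h<β β≡α c′∈ = ∈-concat⁺′
  (∈-cartesianProductWith⁺ (λ h c → (toℕ t , h) ∷ c)
    (∈-upTo⁺ (subst (_ <_) (sym (weight-self β≡α)) h<β)) c′∈)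
  (∈-tabulate⁺ {f = codesFrom α β} t)

unique-hookCodes : ∀ {ℓ} (α β : Vector ℕ ℓ) → Unique (hookCodes α β)
unique-hookCodes {zero}  α β = [] ∷ []
unique-hookCodes {suc ℓ} α β = AllPairs.concat⁺
  (All.tabulate⁺ {f = codesFrom α β} unique)
  (AllPairs.tabulate⁺ {f = codesFrom α β} λ t≢t′ → All.tabulate λ c∈ → All.tabulate λ c′∈ →
    disjoint t≢t′ c∈ c′∈)
  where
  unique : ∀ t → Unique (codesFrom α β t)
  unique t = cartesianProductWith⁺ (λ h c → (toℕ t , h) ∷ c) (λ { refl → refl , refl })
    (upTo⁺ (weight (β t) (α (fromℕ ℓ)))) (unique-hookCodes (α ∘ inject₁) (β ∘ punchIn t))
  disjoint : ∀ {t t′} → t ≢ t′ → ∀ {c c′} → c ∈ₗ codesFrom α β t → c′ ∈ₗ codesFrom α β t′ → c ≢ c′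
  disjoint {t} {t′} t≢t′ c∈ c′∈ e with ∈-codesFrom⁻ α β t c∈ | ∈-codesFrom⁻ α β t′ c′∈
  ... | _ , _ , refl , _ | _ , _ , refl , _ =
    t≢t′ (toℕ-injective (proj₁ (,-injective (proj₁ (∷-injective e)))))

hookCode : ∀ {ℓ} → Vector ℕ ℓ → Permutation′ ℓ → List (ℕ × ℕ)
hookCode {zero}  hs π = []
hookCode {suc ℓ} hs π = (toℕ t , hs t) ∷ hookCode (hs ∘ punchIn t) (Perm.remove (fromℕ ℓ) π)
  where t = π ⟨$⟩ʳ fromℕ ℓ

remove-cong : ∀ {n} i {π π′ : Permutation′ (suc n)} → π Perm.≈ π′ →
  Perm.remove i π Perm.≈ Perm.remove i π′
remove-cong i {π} {π′} e j = punchIn-injective (π ⟨$⟩ʳ i) _ _ (begin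
  punchIn (π ⟨$⟩ʳ i) (Perm.remove i π ⟨$⟩ʳ j)    ≡⟨ Perm.punchIn-permute π i j ⟨
  π ⟨$⟩ʳ punchIn i j                             ≡⟨ e (punchIn i j) ⟩
  π′ ⟨$⟩ʳ punchIn i j                            ≡⟨ Perm.punchIn-permute π′ i j ⟩
  punchIn (π′ ⟨$⟩ʳ i) (Perm.remove i π′ ⟨$⟩ʳ j)
    ≡⟨ cong (λ t → punchIn t (Perm.remove i π′ ⟨$⟩ʳ j))
    (e i) ⟨
  punchIn (π ⟨$⟩ʳ i) (Perm.remove i π′ ⟨$⟩ʳ j)   ∎)
  where open ≡-Reasoning

hookCode-cong : ∀ {ℓ} {hs hs′ : Vector ℕ ℓ} {π π′ : Permutation′ ℓ} → hs ≗ hs′ → π Perm.≈ π′ →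
  hookCode hs π ≡ hookCode hs′ π′
hookCode-cong {zero}  e e′ = refl
hookCode-cong {suc ℓ} {hs} {hs′} {π} {π′} e e′ = cong₂ _∷_
  (cong₂ _,_ (cong toℕ (e′ _)) (trans (e _) (cong hs′ (e′ _))))
  (hookCode-cong (λ j → trans (e _) (cong (λ t → hs′ (punchIn t j)) (e′ _)))
    (remove-cong (fromℕ ℓ) {π} {π′} e′))

hookCode-injective : ∀ {ℓ} {hs hs′ : Vector ℕ ℓ} {π π′ : Permutation′ ℓ} →
  hookCode hs π ≡ hookCode hs′ π′ → hs ≗ hs′ × π Perm.≈ π′
hookCode-injective {zero}  e = (λ ()) , (λ ())
hookCode-injective {suc ℓ} {hs} {hs′} {π} {π′} e = same , same′
  where
  lastIndex : Fin (suc ℓ)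
  lastIndex = fromℕ ℓ
  t≡ : π ⟨$⟩ʳ lastIndex ≡ π′ ⟨$⟩ʳ lastIndex
  t≡ = toℕ-injective (proj₁ (,-injective (proj₁ (∷-injective e))))
  h≡ : hs (π ⟨$⟩ʳ lastIndex) ≡ hs′ (π′ ⟨$⟩ʳ lastIndex)
  h≡ = proj₂ (,-injective (proj₁ (∷-injective e)))
  rest = hookCode-injective (proj₂ (∷-injective e))
  same : hs ≗ hs′
  same i with punched (π ⟨$⟩ʳ lastIndex) i
  ... | inj₁ refl       = trans h≡ (cong hs′ (sym t≡))
  ... | inj₂ (k , refl) = trans (proj₁ rest k) (cong (λ t → hs′ (punchIn t k)) (sym t≡))
  same′ : π Perm.≈ π′
  same′ i with punched lastIndex i
  ... | inj₁ refl       = t≡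
  ... | inj₂ (k , refl) = trans (Perm.punchIn-permute π lastIndex k)
    (trans (cong₂ punchIn t≡ (proj₂ rest k)) (sym (Perm.punchIn-permute π′ lastIndex k)))

hookCode∈ : ∀ {ℓ} {α β hs : Vector ℕ ℓ} {π : Permutation′ ℓ} → (∀ i → hs i < β i) →
  (∀ i → β (π ⟨$⟩ʳ i) ≡ α i) →
  hookCode hs π ∈ₗ hookCodes α β
hookCode∈ {zero}  hs<β β≡α = here refl
hookCode∈ {suc ℓ} {α} {β} {hs} {π} hs<β β≡α = ∈-hookCodes⁺ {α = α} {β} t (hs<β t) (β≡α (fromℕ ℓ))
  (hookCode∈ (λ _ → hs<β _) (λ j → begin
    β (punchIn t (Perm.remove (fromℕ ℓ) π ⟨$⟩ʳ j))  ≡⟨ cong β (Perm.punchIn-permute π (fromℕ ℓ) j) ⟨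
    β (π ⟨$⟩ʳ punchIn (fromℕ ℓ) j)                   ≡⟨ β≡α _ ⟩
    α (punchIn (fromℕ ℓ) j)                          ≡⟨ cong α (punchIn-fromℕ j) ⟩
    α (inject₁ j)                                    ∎))
  where
  open ≡-Reasoning
  t = π ⟨$⟩ʳ fromℕ ℓ

insert-self : ∀ {n} i j (π : Permutation′ n) → Perm.insert i j π ⟨$⟩ʳ i ≡ j
insert-self i j π with i Fin.≟ i
... | yes _   = refl
... | no  i≢i = contradiction refl i≢i

hookDecode : ∀ {ℓ} {α β : Vector ℕ ℓ} {c} → c ∈ₗ hookCodes α β →
  ∃[ hs ] ∃[ π ] (∀ i → hs i < β i) × (∀ i → β (π ⟨$⟩ʳ i) ≡ α i) × hookCode hs π ≡ c
hookDecode {zero}  (here refl) = (λ ()) , Perm.id , (λ ()) , (λ ()) , refl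
hookDecode {suc ℓ} {α} {β} c∈
  with t , h , c′ , refl , h<β , β≡α , c′∈ ← ∈-hookCodes⁻ {α = α} {β} c∈
  with hs′ , π′ , hs<β , β≡α′ , refl ← hookDecode {α = α ∘ inject₁} {β ∘ punchIn t} c′∈ =
  hs , π , bounded , matches , cong₂ _∷_
    (cong₂ _,_ (cong toℕ t≡) (trans (cong hs t≡) (insertAt-lookup hs′ t h)))
    (hookCode-cong (λ j → trans (cong (λ t → hs (punchIn t j)) t≡) (insertAt-punchIn hs′ t h j))
      (Perm.remove-insert (fromℕ ℓ) t π′))
  where
  hs : Vector ℕ (suc ℓ)
  hs = insertAt hs′ t h
  π : Permutation′ (suc ℓ)
  π = Perm.insert (fromℕ ℓ) t π′
  t≡ : π ⟨$⟩ʳ fromℕ ℓ ≡ t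
  t≡ = insert-self (fromℕ ℓ) t π′
  bounded : ∀ i → hs i < β i
  bounded i with punched t i
  ... | inj₁ refl       = subst (_< β t) (sym (insertAt-lookup hs′ t h)) h<β
  ... | inj₂ (k , refl) = subst (_< β (punchIn t k)) (sym (insertAt-punchIn hs′ t h k)) (hs<β k)
  matches : ∀ i → β (π ⟨$⟩ʳ i) ≡ α i
  matches i with punched (fromℕ ℓ) i
  ... | inj₁ refl       = trans (cong β t≡) β≡α
  ... | inj₂ (k , refl) = trans (cong β (Perm.insert-punchIn (fromℕ ℓ) t π′ k))
    (trans (β≡α′ k) (cong α (sym (punchIn-fromℕ k))))

-- Hooks from their sizes and heights

∣∣-sum : ∀ μ → ∣ μ ∣ ≡ sum (rows μ)
∣∣-sum μ = length-cellsOfRows (rows μ)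

sum-ones : ∀ m → sum (replicate m 1) ≡ m
sum-ones zero    = refl
sum-ones (suc m) = cong suc (sum-ones m)

hookHeight : Hook → ℕ
hookHeight h = length (rows (partition h)) ∸ 1

hookSize-≡ : ∀ (h : Hook) → ∃[ k ] 0 < k × rows (partition h) ≡ k ∷ replicate (hookHeight h) 1 ×
  ∣ partition h ∣ ≡ k + hookHeight h
hookSize-≡ h with k , m , e ← isHook h
  rewrite ∣∣-sum (partition h) | e | length-replicate m {1} | sum-ones m =
  k , positive-head (subst (All (_> 0)) e (positive (partition h))) , refl , refl
  where
  positive-head : ∀ {x xs} → All (_> 0) (x ∷ xs) → 0 < x
  positive-head (p ∷ _) = p

hookHeight< : ∀ h → hookHeight h < ∣ partition h ∣
hookHeight< h with k , 0<k , _ , e ← hookSize-≡ h = subst (hookHeight h <_) (sym e) (ℕ.m<n+m _ 0<k)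

hook-injective : ∀ {h h′} → ∣ partition h ∣ ≡ ∣ partition h′ ∣ → hookHeight h ≡ hookHeight h′ →
  partition h ≡ partition h′
hook-injective {h} {h′} e e′ with k , _ , r , s ← hookSize-≡ h | k′ , _ , r′ , s′ ← hookSize-≡ h′ =
  rows-injective (trans r (trans (cong₂ (λ k m → k ∷ replicate m 1) k≡k′ e′) (sym r′)))
  where
  k≡k′ : k ≡ k′
  k≡k′ = ℕ.+-cancelʳ-≡ (hookHeight h) k k′
    (trans (sym s) (trans e (trans s′ (cong (λ m → k′ + m) (sym e′)))))

mkHook : ∀ {h s} → h < s → Hook
mkHook {h} {s} h<s = record
  { partition = mkPartition (s ∸ h ∷ replicate h 1) (linked h (s ∸ h) 0<s∸h)
    (0<s∸h ∷ All.replicate⁺ h (s≤s z≤n))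
  ; isHook    = s ∸ h , h , refl
  }
  where
  0<s∸h = ℕ.m<n⇒0<n∸m h<s
  linked : ∀ h x → 0 < x → Linked _≥_ (x ∷ replicate h 1)
  linked zero    x 0<x = [-]
  linked (suc h) x 0<x = 0<x ∷ linked h 1 (s≤s z≤n)

size-mkHook : ∀ {h s} (h<s : h < s) → ∣ partition (mkHook h<s) ∣ ≡ s
size-mkHook {h} {s} h<s = trans (∣∣-sum (partition (mkHook h<s)))
  (trans (cong (λ z → s ∸ h + z) (sum-ones h)) (ℕ.m∸n+n≡m (ℕ.<⇒≤ h<s)))

height-mkHook : ∀ {h s} (h<s : h < s) → hookHeight (mkHook h<s) ≡ h
height-mkHook {h} h<s = length-replicate h

-- Keys are compared by propositional equality, which for contents given as functions would require
-- extensionality; hence `Vec`.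
Contents : ℕ → Set
Contents ℓ = Vec ℕ ℓ × Vec ℕ ℓ

-- Positivity makes every move change its entry. The sum of `β` guarantees that `downFrom n`
-- contains enough small numbers, and the equality of both sums makes a walk return to the empty
-- partition.
record Good {ℓ} (n : ℕ) (κ : Contents ℓ) : Set where
  field
    0<α : ∀ i → 0 < Vec.lookup (proj₁ κ) i
    0<β : ∀ i → 0 < Vec.lookup (proj₂ κ) i
    Σα  : sumᵛ (Vec.lookup (proj₁ κ)) ≡ n
    Σβ  : sumᵛ (Vec.lookup (proj₂ κ)) ≡ n

good : ∀ {ℓ n} {α β : Vector ℕ ℓ} → (∀ i → 0 < α i) → (∀ i → 0 < β i) → sumᵛ α ≡ n → sumᵛ β ≡ n →
  Good n (Vec.tabulate α , Vec.tabulate β)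
good {α = α} {β} 0<α 0<β Σα Σβ = record
  { 0<α = λ i → subst (0 <_) (sym (Vec.lookup∘tabulate α i)) (0<α i)
  ; 0<β = λ i → subst (0 <_) (sym (Vec.lookup∘tabulate β i)) (0<β i)
  ; Σα  = trans (sum-cong-≗ (Vec.lookup∘tabulate α)) Σα
  ; Σβ  = trans (sum-cong-≗ (Vec.lookup∘tabulate β)) Σβ
  }

tabulate-injective : ∀ {ℓ} {f g : Vector ℕ ℓ} → Vec.tabulate f ≡ Vec.tabulate g → f ≗ g
tabulate-injective {f = f} {g} e i =
  trans (sym (Vec.lookup∘tabulate f i)) (trans (cong (λ v → Vec.lookup v i) e)
    (Vec.lookup∘tabulate g i))

module _ {n ℓ : ℕ} where

  hookContents : HookPermutation n ℓ → Contents ℓ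
  hookContents a = Vec.tabulate (permutedHookContent a) , Vec.tabulate (hookContent a)

  heights : HookPermutation n ℓ → Vector ℕ ℓ
  heights a i = hookHeight (H a i)

  hookCoding : Coding {HookPermutation-setoid n ℓ} {Contents ℓ} {List (ℕ × ℕ)} {Good n}
  hookCoding = record
    { key        = hookContents
    ; key-cong   = λ {a} {a′} (p , q) → cong₂ _,_
        (Vec.tabulate-cong (λ i → trans (cong ∣_∣ (p _))
          (cong (λ j → ∣ partition (H a′ j) ∣) (q i))))
        (Vec.tabulate-cong (λ i → cong ∣_∣ (p i)))
    ; key-good   = λ a → good
        (λ i → ℕ.≤-<-trans z≤n (hookHeight< (H a (σ a ⟨$⟩ʳ i))))
          (λ i → ℕ.≤-<-trans z≤n (hookHeight< (H a i)))
        (trans (sym (sum-permute (hookContent a) (σ a))) (hookSize a)) (hookSize a)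
    ; listing    = λ (α , β) → hookCodes (Vec.lookup α) (Vec.lookup β)
    ; unique     = λ {(α , β)} _ → unique-hookCodes (Vec.lookup α) (Vec.lookup β)
    ; label      = λ a → hookCode (heights a) (σ a)
    ; label-cong = λ (p , q) → hookCode-cong (λ i → cong (λ μ → length (rows μ) ∸ 1) (p i)) q
    ; injective  = λ {a} {a′} e e′ →
        let hs≗ , π≈ = hookCode-injective e′
        in (λ i → hook-injective {H a i} {H a′ i} (tabulate-injective (cong proj₂ e) i) (hs≗ i)) , π≈
    ; label∈     = λ a → hookCode∈
        (λ i → subst (_ <_) (sym (Vec.lookup∘tabulate (hookContent a) i)) (hookHeight< (H a i)))
        (λ i → trans (Vec.lookup∘tabulate (hookContent a) _)
          (sym (Vec.lookup∘tabulate (permutedHookContent a) i)))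
    ; decoded    = λ {(α , β)} {c} → decoded α β c
    }
    where
    decoded : ∀ α β c → Good n (α , β) → c ∈ₗ hookCodes (Vec.lookup α) (Vec.lookup β) →
      ∃[ a ] hookContents a ≡ (α , β) × hookCode (heights a) (σ a) ≡ c
    decoded α β c g c∈ with hs , π , hs<β , β≡α , e ← hookDecode {α = Vec.lookup α} {Vec.lookup β}
      c∈ =
      record
        { H        = λ i → mkHook (hs<β i)
        ; σ        = π
        ; hookSize = trans (sum-cong-≗ (λ i → size-mkHook (hs<β i))) (Good.Σβ g)
        } ,
      cong₂ _,_
        (trans (Vec.tabulate-cong (λ i → trans (size-mkHook (hs<β _)) (β≡α i)))
          (Vec.tabulate∘lookup α))
        (trans (Vec.tabulate-cong (λ i → size-mkHook (hs<β i))) (Vec.tabulate∘lookup β)) ,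
      trans (hookCode-cong (λ i → height-mkHook (hs<β i)) (λ _ → refl)) e

-- Pairs of tableaux

product : ∀ {ℓ} → Vector Sign ℓ → Sign
product = Vector.foldr Sign._*_ Sign.+

downs : ∀ {ℓ} → Vector ℕ ℓ → List Move
downs {zero}  α = []
downs {suc ℓ} α = lowerBy (α (fromℕ ℓ)) ∷ downs (α ∘ inject₁)

steps : ∀ {ℓ} → Vector ℕ ℓ → Vector ℕ ℓ → List Move
steps α β = tabulate (raiseBy ∘ β) ++ downs α

foldr-downs : ∀ {ℓ} (α : Vector ℕ ℓ) F → foldr ∂ F (downs α) ≡ lower α F
foldr-downs {zero}  α F = refl
foldr-downs {suc ℓ} α F = cong (∂ (lowerBy (α (fromℕ ℓ)))) (foldr-downs (α ∘ inject₁) F)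

foldr-ups : ∀ {ℓ} (β : Vector ℕ ℓ) gs F →
  foldr ∂ F (tabulate (raiseBy ∘ β) ++ gs) ≡ raise β (foldr ∂ F gs)
foldr-ups {zero}  β gs F = refl
foldr-ups {suc ℓ} β gs F = cong (∂ (raiseBy (β zero))) (foldr-ups (β ∘ suc) gs F)

-- Only `n` beads are needed, as a partition of `n` has at most `n` rows. The return to the start is
-- not imposed; it is a consequence of equal sums of `α` and `β`.
closedWalks : ∀ {ℓ} → ℕ → Vector ℕ ℓ → Vector ℕ ℓ → Signed (List (List ℕ))
closedWalks n α β = walks (steps α β) (downFrom n)

downFrom-decreasing : ∀ n → Decreasing (downFrom n)
downFrom-decreasing n = AllPairs.applyDownFrom⁺₁ id n (λ j<i _ → j<i)

total-closedWalks : ∀ {ℓ n} (α β : Vector ℕ ℓ) → (∀ i → 0 < α i) → (∀ i → 0 < β i) → sumᵛ β ≤ n →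
  total (λ _ → ℤ.1ℤ) (closedWalks n α β) ≡ ℤ.+ count α β
total-closedWalks {n = n} α β 0<α 0<β Σβ≤n = begin
  total (λ _ → ℤ.1ℤ) (closedWalks n α β)
    ≡⟨ total-walks (steps α β)
    (downFrom-decreasing n) ⟩
  foldr ∂ sortSign (steps α β) (downFrom n)
    ≡⟨ cong (λ F → F (downFrom n))
    (foldr-ups β (downs α) sortSign) ⟩
  raise β (foldr ∂ sortSign (downs α)) (downFrom n)
    ≡⟨ cong (λ F → raise β F (downFrom n))
    (foldr-downs α sortSign) ⟩
  raise β (lower α sortSign) (downFrom n)                 ≡⟨ raise-lower-count α β 0<α 0<β Σβ≤n ⟩
  ℤ.+ count α β                                           ∎
  where open ≡-Reasoning

up-moving : ∀ {k} → 0 < k → ∀ {x} → raiseBy k x ≢ just x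
up-moving {k} 0<k {x} e with e′ ← cong (λ { (just y) → y ; nothing → 0 }) e =
  ℕ.<⇒≢ (ℕ.m<m+n x 0<k) (sym e′)

down-moving : ∀ {k} → 0 < k → ∀ {x} → lowerBy k x ≢ just x
down-moving 0<k {x} e with k≤x , e′ ← down-just e = ℕ.<⇒≢ (ℕ.∸-monoʳ-< 0<k k≤x) (sym e′)

distinct-closedWalks : ∀ {ℓ n} (α β : Vector ℕ ℓ) → (∀ i → 0 < α i) → (∀ i → 0 < β i) →
  Distinct (closedWalks n α β)
distinct-closedWalks {n = n} α β 0<α 0<β = distinct-walks
  (All.++⁺ (All.tabulate⁺ (λ i → up-moving (0<β i))) (downs-moving α 0<α)) (downFrom-decreasing n)
  where
  downs-moving : ∀ {ℓ} (α : Vector ℕ ℓ) → (∀ i → 0 < α i) →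
    All (λ g → ∀ {x} → g x ≢ just x) (downs α)
  downs-moving {zero}  α 0<α = []
  downs-moving {suc ℓ} α 0<α = down-moving (0<α (fromℕ ℓ)) ∷ downs-moving (α ∘ inject₁)
    (λ i → 0<α (inject₁ i))

-- Walks and sequences of beads

∈-walks⁺ : ∀ {g gs b s b′ t w} → Decreasing b → Shift g b s b′ → (t , w) ∈ₗ walks gs b′ →
  (s Sign.* t , b′ ∷ w) ∈ₗ walks (g ∷ gs) b
∈-walks⁺ d sh w∈ = ∈-bind⁺ (∈-moves⁺ d sh) (∈-map⁺ _ w∈)

∈-walks⁻ : ∀ {g gs b u w} → Decreasing b → (u , w) ∈ₗ walks (g ∷ gs) b →
  ∃[ s ] ∃[ b′ ] ∃[ t ] ∃[ w′ ] Shift g b s b′ × (t , w′) ∈ₗ walks gs b′ ×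
    u ≡ s Sign.* t × w ≡ b′ ∷ w′
∈-walks⁻ {g} {gs} {b} d u∈
  with s , b′ , t , b′∈ , t∈ , e ← ∈-bind⁻ (moves g b) _ u∈
  with (_ , w′) , w′∈ , refl ← ∈-map⁻ _ t∈ = s , b′ , t , w′ , ∈-moves⁻ d b′∈ , w′∈ , e , refl

shift-flip : ∀ {k b s b′} → Shift (raiseBy k) b s b′ → Shift (lowerBy k) b′ s b
shift-flip {k} (shift {x = x} {s₁ = s₁} {s₂} d refl i i′ e) =
  shift d (trans (down-≤ (ℕ.m≤n+m k x)) (cong just (ℕ.m+n∸n≡m x k))) i′ i
    (trans e (Sign.*-comm s₁ s₂))

shift-flip⁻ : ∀ {k b s b′} → Shift (lowerBy k) b s b′ → Shift (raiseBy k) b′ s b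
shift-flip⁻ (shift {s₁ = s₁} {s₂} d moved i i′ e) with k≤x , refl ← down-just moved =
  shift d (cong just (ℕ.m∸n+n≡m k≤x)) i′ i (trans e (Sign.*-comm s₁ s₂))

Path : ∀ {ℓ} → Vector ℕ ℓ → Vector (List ℕ) (suc ℓ) → Vector Sign ℓ → Set
Path α p s = ∀ i → Shift (raiseBy (α i)) (p (inject₁ i)) (s i) (p (suc i))

-- Applied to `p ∘ inject₁` it omits the topmost list, which the way up has recorded already.
backwards : ∀ {X : Set} {ℓ} → Vector X ℓ → List X
backwards {ℓ = zero}  p = []
backwards {ℓ = suc ℓ} p = p (fromℕ ℓ) ∷ backwards (p ∘ inject₁)

backwards-cong : ∀ {X : Set} {ℓ} {p q : Vector X ℓ} → p ≗ q → backwards p ≡ backwards q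
backwards-cong {ℓ = zero}  e = refl
backwards-cong {ℓ = suc ℓ} e = cong₂ _∷_ (e _) (backwards-cong (e ∘ inject₁))

backwards-injective : ∀ {X : Set} {ℓ} {p q : Vector X ℓ} → backwards p ≡ backwards q → p ≗ q
backwards-injective {ℓ = suc ℓ} e i with view i
... | ‵fromℕ        = proj₁ (∷-injective e)
... | ‵inj₁ {i = j} _ = backwards-injective (proj₂ (∷-injective e)) j

tabulate-++-injective : ∀ {X : Set} {ℓ} {f g : Vector X ℓ} {w w′} →
  tabulate f ++ w ≡ tabulate g ++ w′ → f ≗ g × w ≡ w′
tabulate-++-injective {ℓ = zero}  e = (λ ()) , e
tabulate-++-injective {ℓ = suc ℓ} e with e₀ , e′ ← ∷-injective e
  with f≗g , w≡w′ ← tabulate-++-injective e′ =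
  (λ { zero → e₀ ; (suc i) → f≗g i }) , w≡w′

path-down⁺ : ∀ {ℓ} {α : Vector ℕ ℓ} {p s} → (∀ i → Decreasing (p i)) → Path α p s →
  (product s , backwards (p ∘ inject₁)) ∈ₗ walks (downs α) (p (fromℕ ℓ))
path-down⁺ {zero}  d path = here refl
path-down⁺ {suc ℓ} {α} {p} {s} d path = subst
  (λ t → (t , backwards (p ∘ inject₁)) ∈ₗ walks (downs α) (p (fromℕ (suc ℓ))))
  (trans (Sign.*-comm (s (fromℕ ℓ)) (product (s ∘ inject₁))) (sym (Product.sum-init-last s)))
  (∈-walks⁺ {gs = downs (α ∘ inject₁)} (d (fromℕ (suc ℓ))) (shift-flip (path (fromℕ ℓ)))
    (path-down⁺ {α = α ∘ inject₁} {p ∘ inject₁} (d ∘ inject₁) (path ∘ inject₁)))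

path-up⁺ : ∀ {ℓ} {β : Vector ℕ ℓ} {q s gs t w} → (∀ i → Decreasing (q i)) → Path β q s →
  (t , w) ∈ₗ walks gs (q (fromℕ ℓ)) →
  (product s Sign.* t , tabulate (q ∘ suc) ++ w) ∈ₗ walks (tabulate (raiseBy ∘ β) ++ gs) (q zero)
path-up⁺ {zero}  d path w∈ = w∈
path-up⁺ {suc ℓ} {β} {q} {s} {gs} {t} {w} d path w∈ =
  subst (λ u → (u , tabulate (q ∘ suc) ++ w) ∈ₗ walks (tabulate (raiseBy ∘ β) ++ gs) (q zero))
    (sym (Sign.*-assoc (s zero) (product (s ∘ suc)) t))
    (∈-walks⁺ {gs = tabulate (raiseBy ∘ β ∘ suc) ++ gs} (d zero) (path zero)
      (path-up⁺ {β = β ∘ suc} {q ∘ suc} {gs = gs} (d ∘ suc) (path ∘ suc) w∈))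

path-up⁻ : ∀ {ℓ} (β : Vector ℕ ℓ) {gs b u v} → Decreasing b →
  (u , v) ∈ₗ walks (tabulate (raiseBy ∘ β) ++ gs) b →
  ∃[ q ] ∃[ s ] ∃[ t ] ∃[ w ] q zero ≡ b × Path β q s × (t , w) ∈ₗ walks gs (q (fromℕ ℓ)) ×
    u ≡ product s Sign.* t × v ≡ tabulate (q ∘ suc) ++ w
path-up⁻ {zero}  β {b = b} d v∈ = (λ _ → b) , (λ ()) , _ , _ , refl , (λ ()) , v∈ , refl , refl
path-up⁻ {suc ℓ} β {gs} {b} d v∈
  with s₀ , b′ , _ , _ , sh , w∈ , refl , refl ← ∈-walks⁻ {gs = tabulate (raiseBy ∘ β ∘ suc) ++ gs}
    d v∈
  with q , s , t , w , refl , path , w∈ , refl , refl ← path-up⁻ (β ∘ suc) {gs}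
    (shift-decreasing sh) w∈ =
  b Vector.∷ q , s₀ Vector.∷ s , t , w , refl , (λ { zero → sh ; (suc i) → path i }) , w∈ ,
  sym (Sign.*-assoc s₀ (product s) t) , refl

-- A walk down is unfolded from its top, whereas a path is indexed from its bottom, so paths have to
-- be extended at the last index.
snoc : ∀ {X : Set} {ℓ} → Vector X ℓ → X → Vector X (suc ℓ)
snoc {ℓ = ℓ} p x = insertAt p (fromℕ ℓ) x

snoc-inject₁ : ∀ {X : Set} {ℓ} (p : Vector X ℓ) x i → snoc p x (inject₁ i) ≡ p i
snoc-inject₁ {ℓ = ℓ} p x i = trans (cong (snoc p x) (sym (punchIn-fromℕ i)))
  (insertAt-punchIn p (fromℕ ℓ) x i)

snoc-last : ∀ {X : Set} {ℓ} (p : Vector X ℓ) x → snoc p x (fromℕ ℓ) ≡ x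
snoc-last {ℓ = ℓ} p x = insertAt-lookup p (fromℕ ℓ) x

path-down⁻ : ∀ {ℓ} (α : Vector ℕ ℓ) {b t w} → Decreasing b → (t , w) ∈ₗ walks (downs α) b →
  ∃[ p ] ∃[ s ] p (fromℕ ℓ) ≡ b × Path α p s × t ≡ product s × w ≡ backwards (p ∘ inject₁)
path-down⁻ {zero}  α {b} d (here refl) = (λ _ → b) , (λ ()) , refl , (λ ()) , refl , refl
path-down⁻ {suc ℓ} α {b} d w∈
  with s₀ , b′ , _ , _ , sh , w∈ , refl , refl ← ∈-walks⁻ {gs = downs (α ∘ inject₁)} d w∈
  with p , s , refl , path , refl , refl ← path-down⁻ (α ∘ inject₁) (shift-decreasing sh) w∈ =
  snoc p b , snoc s s₀ , snoc-last p b , path′ , sign , cong₂ _∷_ (sym (snoc-inject₁ p b _))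
    (backwards-cong (λ i → sym (snoc-inject₁ p b (inject₁ i))))
  where
  path′ : Path α (snoc p b) (snoc s s₀)
  path′ i with view i
  ... | ‵fromℕ rewrite snoc-inject₁ p b (fromℕ ℓ) | snoc-last p b | snoc-last s s₀ = shift-flip⁻ sh
  ... | ‵inj₁ {i = j} _ rewrite snoc-inject₁ p b (inject₁ j) | snoc-inject₁ p b
    (suc j) | snoc-inject₁ s s₀ j = path j
  sign : s₀ Sign.* product s ≡ product (snoc s s₀)
  sign = begin
    s₀ Sign.* product s
      ≡⟨ Sign.*-comm s₀ (product s) ⟩
    product s Sign.* s₀
      ≡⟨ cong₂ Sign._*_ (Product.sum-cong-≗ (λ i → sym (snoc-inject₁ s s₀ i)))
        (sym (snoc-last s s₀)) ⟩
    product (snoc s s₀ ∘ inject₁) Sign.* snoc s s₀ (fromℕ ℓ)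
      ≡⟨ Product.sum-init-last (snoc s s₀) ⟨
    product (snoc s s₀) ∎
    where open ≡-Reasoning

path-sum : ∀ {ℓ} {α : Vector ℕ ℓ} p {s} → Path α p s → sum (p (fromℕ ℓ)) ≡ sum (p zero) + sumᵛ α
path-sum {zero}  p path = sym (ℕ.+-identityʳ _)
path-sum {suc ℓ} {α} p path = begin
  sum (p (fromℕ (suc ℓ)))              ≡⟨ path-sum (p ∘ suc) (path ∘ suc) ⟩
  sum (p (suc zero)) + sumᵛ (α ∘ suc)  ≡⟨ cong (λ z → z + sumᵛ (α ∘ suc)) (sum-shift (path zero)) ⟩
  sum (p zero) + α zero + sumᵛ (α ∘ suc) ≡⟨ ℕ.+-assoc (sum (p zero)) (α zero) _ ⟩
  sum (p zero) + sumᵛ α                ∎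
  where open ≡-Reasoning

Strict : ℕ → List ℕ → Set
Strict n b = Decreasing b × length b ≡ n

shift-strict : ∀ {g n b s b′} → Shift g b s b′ → Strict n b → Strict n b′
shift-strict sh (_ , l) = shift-decreasing sh , trans (sym (shift-length sh)) l

path-strict : ∀ {ℓ n} {α : Vector ℕ ℓ} {p s} → Path α p s → Strict n (p zero) → ∀ i → Strict n (p i)
path-strict {n = n} {p = p} path st = <-weakInduction (Strict n ∘ p) st
  (λ i → shift-strict (path i))

path-strict′ : ∀ {ℓ n} {α : Vector ℕ ℓ} {p s} → Path α p s → Strict n (p (fromℕ ℓ)) → ∀ i →
  Strict n (p i)
path-strict′ {n = n} {p = p} path st = >-weakInduction (Strict n ∘ p) st
  (λ i → shift-strict (shift-flip (path i)))

short-rows : ∀ {xs} → All (_> 0) xs → ∀ n → rowLength xs n ≡ 0 → length xs ≤ n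
short-rows []       n       e = z≤n
short-rows (p ∷ ps) zero    e = contradiction e (ℕ.>⇒≢ p)
short-rows (p ∷ ps) (suc n) e = s≤s (short-rows ps n e)

fitsIn⇒fits : ∀ {n} μ → FitsIn n μ → Fits n μ
fitsIn⇒fits {n} μ (_ , few) = short-rows (positive μ) n (few n ℕ.≤-refl)

encode-∅ : ∀ n → encode n ∅ ≡ downFrom n
encode-∅ zero    = refl
encode-∅ (suc n) = cong (n ∷_) (encode-∅ n)

∅⊆ : ∀ μ → ∅ ⊆ μ
∅⊆ μ c ()

∣∖∅∣ : ∀ μ → ∣ μ ∖ ∅ ∣ ≡ ∣ μ ∣
∣∖∅∣ μ = cong length (filter-all (λ c → ¬? (c ∈? ∅)) {xs = cells μ} (All.tabulate λ _ ()))

sum-encode-∅ : ∀ {n μ} → Fits n μ → sum (encode n μ) ≡ sum (encode n ∅) + ∣ μ ∣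
sum-encode-∅ {n} {μ} fits = trans (sum-encode n {μ} {∅} fits (∅⊆ μ))
  (cong (λ z → sum (encode n ∅) + z) (∣∖∅∣ μ))

∣∣≡0⇒∅ : ∀ μ → ∣ μ ∣ ≡ 0 → μ ≡ ∅
∣∣≡0⇒∅ μ e = rows-injective (empty (positive μ) (trans (sym (∣∣-sum μ)) e))
  where
  empty : ∀ {xs} → All (_> 0) xs → sum xs ≡ 0 → xs ≡ []
  empty []       e = refl
  empty {x ∷ xs} (p ∷ _) e = contradiction (ℕ.m+n≡0⇒m≡0 x e) (ℕ.>⇒≢ p)

-- Pairs of tableaux as signed closed walks

module _ {n : ℕ} where

  select : Sign → Signed (List (List ℕ)) → List (Sign × List (List ℕ))
  select s = filter (λ u → proj₁ u Sign.≟ s)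

  -- The total of the constant 1 is the number of positive terms minus that of negative ones,
  -- arranged here without subtraction to match the balance required for the cancellation.
  total-select : ∀ L → ℤ.+ length (select Sign.+ L)
    ≡ ℤ.+ length (select Sign.- L) ℤ.+ total (λ _ → ℤ.1ℤ) L
  total-select [] = refl
  total-select ((Sign.+ , _) ∷ L) = trans (cong (ℤ._+_ ℤ.1ℤ) (total-select L))
    (rearrange (ℤ.+ length (select Sign.- L)) (total (λ _ → ℤ.1ℤ) L))
    where
    open ℤ-Solver.+-*-Solver
    rearrange : ∀ a b → ℤ.1ℤ ℤ.+ (a ℤ.+ b) ≡ a ℤ.+ (ℤ.1ℤ ℤ.+ b)
    rearrange = solve 2 (λ a b → con ℤ.1ℤ :+ (a :+ b) := a :+ (con ℤ.1ℤ :+ b)) refl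
  total-select ((Sign.- , _) ∷ L) = trans (total-select L)
    (rearrange (ℤ.+ length (select Sign.- L)) (total (λ _ → ℤ.1ℤ) L))
    where
    open ℤ-Solver.+-*-Solver
    rearrange : ∀ a b → a ℤ.+ b ≡ (ℤ.1ℤ ℤ.+ a) ℤ.+ (ℤ.-1ℤ ℤ.+ b)
    rearrange = solve 2 (λ a b → a :+ b := (con ℤ.1ℤ :+ a) :+ (con ℤ.-1ℤ :+ b)) refl

  module _ {ℓ : ℕ} {μ : Partition} (T : RibbonTableau μ ℓ) (∣μ∣≡n : ∣ μ ∣ ≡ n) where

    chain-fits : ∀ i → Fits n (chain T i)
    chain-fits i = fitsIn⇒fits (chain T i) (chain-fitsIn T ∣μ∣≡n i)

    tableau-shift : ∀ i → 0 < tableauContent T i ×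
      Shift (raiseBy (tableauContent T i)) (encode n (chain T (inject₁ i)))
        (ribbonSign (chain T (suc i)) (chain T (inject₁ i))) (encode n (chain T (suc i)))
    tableau-shift i = ribbon⇒shift n {chain T (suc i)} {chain T (inject₁ i)} (chain-fits (suc i))
      (chain-fits (inject₁ i)) (ribbon T i)

    tableau-path : Path (tableauContent T) (encode n ∘ chain T)
      (λ i → ribbonSign (chain T (suc i)) (chain T (inject₁ i)))
    tableau-path = proj₂ ∘ tableau-shift

    sum-content : sumᵛ (tableauContent T) ≡ n
    sum-content = ℕ.+-cancelˡ-≡ (sum (encode n ∅)) _ _ (begin
      sum (encode n ∅) + sumᵛ (tableauContent T)
        ≡⟨ cong (λ ν → sum (encode n ν) + sumᵛ (tableauContent T)) (start T) ⟨
      sum (encode n (chain T zero)) + sumᵛ (tableauContent T)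
        ≡⟨ path-sum (encode n ∘ chain T) tableau-path ⟨
      sum (encode n (chain T (fromℕ ℓ)))
        ≡⟨ sum-encode-∅ {μ = chain T (fromℕ ℓ)} (chain-fits (fromℕ ℓ)) ⟩
      sum (encode n ∅) + ∣ chain T (fromℕ ℓ) ∣
        ≡⟨ cong (λ z → sum (encode n ∅) + z) (trans (cong ∣_∣ (end T)) ∣μ∣≡n) ⟩
      sum (encode n ∅) + n ∎)
      where open ≡-Reasoning

  record PathTableau {ℓ} (α : Vector ℕ ℓ) (p : Vector (List ℕ) (suc ℓ)) (s : Vector Sign ℓ)
    (μ : Partition) : Set where
    field
      tableau  : RibbonTableau μ ℓ
      encodes  : ∀ i → encode n (chain tableau i) ≡ p i
      sizes    : ∀ i → tableauContent tableau i ≡ α i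
      signed   : tableauSign tableau ≡ product s
      shape∣∣  : ∣ μ ∣ ≡ sumᵛ α

  -- The final partition `μ` is prescribed, so that two paths ending at the same beads give tableaux
  -- of literally the same shape.
  path⇒tableau : ∀ {ℓ} {α : Vector ℕ ℓ} {p s μ} → (∀ i → 0 < α i) → Path α p s →
    (∀ i → Strict n (p i)) →
    p zero ≡ encode n ∅ → Fits n μ → p (fromℕ ℓ) ≡ encode n μ → PathTableau α p s μ
  path⇒tableau {ℓ} {α} {p} {s} {μ} 0<α path strict p₀ fits pₗ = record
    { tableau = record
      { chain  = ν
      ; start  = ν₀≡∅
      ; end    = νₗ≡μ
      ; ribbon = λ i → proj₁ (ribbons i)
      }
    ; encodes = ν-encodes
    ; sizes   = λ i → proj₂ (proj₂ (ribbons i))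
    ; signed  = foldr-≗ (λ i → proj₁ (proj₂ (ribbons i)))
    ; shape∣∣ = ℕ.+-cancelˡ-≡ (sum (encode n ∅)) _ _ (begin
        sum (encode n ∅) + ∣ μ ∣   ≡⟨ sum-encode-∅ {μ = μ} fits ⟨
        sum (encode n μ)           ≡⟨ cong sum pₗ ⟨
        sum (p (fromℕ ℓ))          ≡⟨ path-sum p path ⟩
        sum (p zero) + sumᵛ α      ≡⟨ cong (λ b → sum b + sumᵛ α) p₀ ⟩
        sum (encode n ∅) + sumᵛ α  ∎)
    }
    where
    open ≡-Reasoning
    decodings : ∀ i → Σ[ μ ∈ Partition ] Fits n μ × encode n μ ≡ p i
    decodings i = decode (proj₁ (strict i)) (proj₂ (strict i))
    ν : Vector Partition (suc ℓ)
    ν = proj₁ ∘ decodings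
    ν-fits : ∀ i → Fits n (ν i)
    ν-fits i = proj₁ (proj₂ (decodings i))
    ν-encodes : ∀ i → encode n (ν i) ≡ p i
    ν-encodes i = proj₂ (proj₂ (decodings i))
    ν₀≡∅ = encode-injective n {ν zero} {∅} (ν-fits zero) z≤n (trans (ν-encodes zero) p₀)
    νₗ≡μ = encode-injective n {ν (fromℕ ℓ)} {μ} (ν-fits (fromℕ ℓ)) fits
      (trans (ν-encodes (fromℕ ℓ)) pₗ)
    ribbons : ∀ i → IsNonemptyRibbon (ν (suc i)) (ν (inject₁ i)) × ribbonSign (ν (suc i))
      (ν (inject₁ i)) ≡ s i ×
      ∣ ν (suc i) ∖ ν (inject₁ i) ∣ ≡ α i
    ribbons i = shift⇒ribbon n {ν (suc i)} {ν (inject₁ i)} (ν-fits (suc i)) (ν-fits (inject₁ i))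
      (0<α i)
      (subst₂ (λ b b′ → Shift (raiseBy (α i)) b (s i) b′) (sym (ν-encodes (inject₁ i)))
        (sym (ν-encodes (suc i))) (path i))

  module _ {ℓ : ℕ} where

    tableauContents : TableauPair n ℓ → Contents ℓ
    tableauContents b = Vec.tabulate (tableauContent (P b)) , Vec.tabulate (tableauContent (Q b))

    pairSign : TableauPair n ℓ → Sign
    pairSign b = tableauSign (P b) Sign.* tableauSign (Q b)

    -- From ∅ to the shape along Q and back to ∅ along P.
    pairWalk : TableauPair n ℓ → List (List ℕ)
    pairWalk b = tabulate (encode n ∘ chain (Q b) ∘ suc) ++ backwards
      (encode n ∘ chain (P b) ∘ inject₁)

    pairWalks : Contents ℓ → Signed (List (List ℕ))
    pairWalks (α , β) = closedWalks n (Vec.lookup α) (Vec.lookup β)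

    pairWalk-injective : ∀ {b b′} → pairWalk b ≡ pairWalk b′ →
      chain (P b) ≗ chain (P b′) × chain (Q b) ≗ chain (Q b′)
    pairWalk-injective {b} {b′} e with q≗ , w≡ ← tabulate-++-injective e = P≗ , Q≗
      where
      Q≗ : chain (Q b) ≗ chain (Q b′)
      Q≗ zero    = trans (start (Q b)) (sym (start (Q b′)))
      Q≗ (suc i) = encode-injective n {chain (Q b) (suc i)} {chain (Q b′) (suc i)}
        (chain-fits (Q b) (shapeSize b) (suc i)) (chain-fits (Q b′) (shapeSize b′) (suc i)) (q≗ i)
      P≗ : chain (P b) ≗ chain (P b′)
      P≗ i with view i
      -- The way down does not list the shape; it is recovered as the last partition of the other
      -- tableau.
      ... | ‵fromℕ = begin
        chain (P b) (fromℕ ℓ)   ≡⟨ trans (end (P b)) (sym (end (Q b))) ⟩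
        chain (Q b) (fromℕ ℓ)   ≡⟨ Q≗ (fromℕ ℓ) ⟩
        chain (Q b′) (fromℕ ℓ)  ≡⟨ trans (end (Q b′)) (sym (end (P b′))) ⟩
        chain (P b′) (fromℕ ℓ)  ∎
        where open ≡-Reasoning
      ... | ‵inj₁ {i = j} _ = encode-injective n {chain (P b) (inject₁ j)}
        {chain (P b′) (inject₁ j)}
        (chain-fits (P b) (shapeSize b) (inject₁ j)) (chain-fits (P b′) (shapeSize b′) (inject₁ j))
          (backwards-injective w≡ j)

    path-lookup : ∀ {α : Vector ℕ ℓ} {p s} → Path α p s → Path (Vec.lookup (Vec.tabulate α)) p s
    path-lookup {α} {p} {s} path i = subst
      (λ k → Shift (raiseBy k) (p (inject₁ i)) (s i) (p (suc i)))
      (sym (Vec.lookup∘tabulate α i)) (path i)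

    pairWalk∈ : ∀ b → (pairSign b , pairWalk b) ∈ₗ pairWalks (tableauContents b)
    pairWalk∈ b = subst₂ (λ s a → (s , pairWalk b) ∈ₗ walks (steps α β) a)
      (Sign.*-comm (tableauSign (Q b)) (tableauSign (P b)))
      (trans (cong (encode n) (start (Q b))) (encode-∅ n))
      (path-up⁺ {β = β} {encode n ∘ chain (Q b)} {gs = downs α} (encode-decreasing n ∘ chain (Q b))
        (path-lookup {p = encode n ∘ chain (Q b)} (tableau-path (Q b) (shapeSize b)))
        (subst (λ μ → (_ , backwards (encode n ∘ chain (P b) ∘ inject₁)) ∈ₗ walks (downs α)
          (encode n μ))
          (trans (end (P b)) (sym (end (Q b))))
          (path-down⁺ {α = α} {encode n ∘ chain (P b)} (encode-decreasing n ∘ chain (P b))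
            (path-lookup {p = encode n ∘ chain (P b)} (tableau-path (P b) (shapeSize b))))))
      where
      α β : Vector ℕ ℓ
      α = Vec.lookup (proj₁ (tableauContents b))
      β = Vec.lookup (proj₂ (tableauContents b))

    pairDecode : ∀ {κ} → Good n κ → ∀ {s w} → (s , w) ∈ₗ pairWalks κ →
      ∃[ b ] (pairSign b , tableauContents b) ≡ (s , κ) × (pairSign b , pairWalk b) ≡ (s , w)
    pairDecode {α , β} g w∈
      with q , sq , _ , _ , q₀ , pathQ , w∈ , refl , refl ← path-up⁻
        (Vec.lookup β) {downs (Vec.lookup α)} (downFrom-decreasing n) w∈
      with strictQ ← path-strict pathQ (subst (Strict n) (sym q₀)
        (downFrom-decreasing n , length-downFrom n))
      with p , sp , pₗ , pathP , refl , refl ← path-down⁻ (Vec.lookup α)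
        (proj₁ (strictQ (fromℕ ℓ))) w∈
      with strictP ← path-strict′ pathP (subst (Strict n) (sym pₗ) (strictQ (fromℕ ℓ)))
      -- The list where the walk turns from raising to lowering encodes the common shape.
      with μ , fits , μ-encodes ← decode (proj₁ (strictQ (fromℕ ℓ))) (proj₂ (strictQ (fromℕ ℓ)))
      = b , cong₂ _,_ sign≡ (cong₂ _,_ (contents α TP) (contents β TQ)) , cong₂ _,_ sign≡
        (cong₂ _++_
          (tabulate-cong (encodes TQ ∘ suc)) (backwards-cong (encodes TP ∘ inject₁)))
      where
      open PathTableau
      open Good g
      TQ : PathTableau (Vec.lookup β) q sq μ
      TQ = path⇒tableau 0<β pathQ strictQ (trans q₀ (sym (encode-∅ n))) fits (sym μ-encodes)
      -- The amounts raised and lowered have the same sum, so the last list has the bead sum of the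
      -- empty partition. The partition it encodes then has no cells.
      p₀ : p zero ≡ encode n ∅
      p₀ with ν , fitsν , ν-encodes ← decode (proj₁ (strictP zero)) (proj₂ (strictP zero)) =
        trans (sym ν-encodes) (cong (encode n)
          (∣∣≡0⇒∅ ν (ℕ.+-cancelˡ-≡ (sum (encode n ∅) + n) _ _ (begin
          sum (encode n ∅) + n + ∣ ν ∣    ≡⟨ swapʳ (sum (encode n ∅)) n ∣ ν ∣ ⟩
          sum (encode n ∅) + ∣ ν ∣ + n    ≡⟨ cong (λ z → z + n) (sum-encode-∅ {μ = ν} fitsν) ⟨
          sum (encode n ν) + n            ≡⟨ cong₂ _+_ (cong sum ν-encodes) (sym Σα) ⟩
          sum (p zero) + sumᵛ (Vec.lookup α) ≡⟨ path-sum p pathP ⟨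
          sum (p (fromℕ ℓ))               ≡⟨ cong sum pₗ ⟩
          sum (q (fromℕ ℓ))               ≡⟨ path-sum q pathQ ⟩
          sum (q zero) + sumᵛ (Vec.lookup β)
            ≡⟨ cong₂ _+_ (cong sum (trans q₀ (sym (encode-∅ n)))) Σβ ⟩
          sum (encode n ∅) + n            ≡⟨ ℕ.+-identityʳ _ ⟨
          sum (encode n ∅) + n + 0        ∎))))
        where
        open ≡-Reasoning
        swapʳ : ∀ a b c → a + b + c ≡ a + c + b
        swapʳ a b c = trans (ℕ.+-assoc a b c)
          (trans (cong (λ z → a + z) (ℕ.+-comm b c)) (sym (ℕ.+-assoc a c b)))
      TP : PathTableau (Vec.lookup α) p sp μ
      TP = path⇒tableau 0<α pathP strictP p₀ fits (trans pₗ (sym μ-encodes))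
      b : TableauPair n ℓ
      b = record { shape = μ ; P = tableau TP ; Q = tableau TQ ; shapeSize = trans (shape∣∣ TQ) Σβ }
      sign≡ : pairSign b ≡ product sq Sign.* product sp
      sign≡ = trans (cong₂ Sign._*_ (signed TP) (signed TQ)) (Sign.*-comm (product sp) (product sq))
      contents : ∀ v {p s} (T : PathTableau (Vec.lookup v) p s μ) →
        Vec.tabulate (tableauContent (tableau T)) ≡ v
      contents v T = trans (Vec.tabulate-cong (sizes T)) (Vec.tabulate∘lookup v)

    tableauCoding : Coding {TableauPair-setoid n ℓ} {Sign × Contents ℓ} {Sign × List (List ℕ)}
      {Good n ∘ proj₂}
    tableauCoding = record
      { key        = λ b → pairSign b , tableauContents b
      ; key-cong   = λ {b} {b′} e → cong₂ _,_ (SignedSet.sign-cong (TableauPairs n ℓ) {b} {b′} e)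
        (cong₂ _,_
          (Vec.tabulate-cong (λ i → cong₂ ∣_∖_∣ (proj₁ e (suc i)) (proj₁ e (inject₁ i))))
          (Vec.tabulate-cong (λ i → cong₂ ∣_∖_∣ (proj₂ e (suc i)) (proj₂ e (inject₁ i)))))
      ; key-good   = λ b → good
          (proj₁ ∘ tableau-shift (P b) (shapeSize b)) (proj₁ ∘ tableau-shift (Q b) (shapeSize b))
          (sum-content (P b) (shapeSize b)) (sum-content (Q b) (shapeSize b))
      ; listing    = λ (s , κ) → select s (pairWalks κ)
      ; unique     = λ {(s , κ)} g → AllPairs.filter⁺ (λ u → proj₁ u Sign.≟ s)
          (AllPairs.map (λ { ≢ refl → ≢ refl })
            (distinct-closedWalks (Vec.lookup (proj₁ κ)) (Vec.lookup (proj₂ κ)) (Good.0<α g)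
              (Good.0<β g)))
      ; label      = λ b → pairSign b , pairWalk b
      ; label-cong = λ {b} {b′} e → cong₂ _,_ (SignedSet.sign-cong (TableauPairs n ℓ) {b} {b′} e)
        (cong₂ _++_
          (tabulate-cong (λ i → cong (encode n) (proj₂ e (suc i))))
          (backwards-cong (λ i → cong (encode n) (proj₁ e (inject₁ i)))))
      ; injective  = λ {b} {b′} _ e → pairWalk-injective {b} {b′} (cong proj₂ e)
      ; label∈     = λ b → ∈-filter⁺ (λ u → proj₁ u Sign.≟ pairSign b) (pairWalk∈ b) refl
      ; decoded    = decoded
      }
      where
      decoded : ∀ {sκ c} → Good n (proj₂ sκ) → c ∈ₗ select (proj₁ sκ) (pairWalks (proj₂ sκ)) →
        ∃[ b ] (pairSign b , tableauContents b) ≡ sκ × (pairSign b , pairWalk b) ≡ c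
      decoded {s , κ} g c∈ with c∈′ , refl ← ∈-filter⁻
        (λ u → proj₁ u Sign.≟ s) {xs = pairWalks κ} c∈ = pairDecode g c∈′

    balanced : ∀ {κ : Contents ℓ} → Good n κ →
      length (select Sign.+ (pairWalks κ)) ≡
      length (select Sign.- (pairWalks κ)) + length
        (hookCodes (Vec.lookup (proj₁ κ)) (Vec.lookup (proj₂ κ)))
    balanced {α , β} g = ℤ.+-injective (begin
      ℤ.+ length (select Sign.+ L)
        ≡⟨ total-select L ⟩
      ℤ.+ length (select Sign.- L) ℤ.+ total (λ _ → ℤ.1ℤ) L
        ≡⟨ cong (λ z → ℤ.+ length (select Sign.- L) ℤ.+ z) (trans
            (total-closedWalks (Vec.lookup α) (Vec.lookup β) 0<α 0<β (ℕ.≤-reflexive Σβ))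
            (cong ℤ.+_ (sym (length-hookCodes (Vec.lookup α) (Vec.lookup β))))) ⟩
      ℤ.+ length (select Sign.- L) ℤ.+ ℤ.+ length (hookCodes (Vec.lookup α) (Vec.lookup β)) ∎)
      where
      open ≡-Reasoning
      open Good g
      L = pairWalks (α , β)

theorem10 : (n ℓ : ℕ) .{{_ : NonZero n}} .{{_ : NonZero ℓ}} →
    Σ[ Φ ∈ SignedBijection (HookPermutations n ℓ) (TableauPairs n ℓ) ]
    (ιA-IsIdentity Φ × ιB-PreservesContents Φ × φ-PreservesContents Φ)
-- Contents are part of the keys: `ι` keeps `base`, and `φ` sends an element to one whose key has
-- the same contents.
theorem10 n ℓ = Φ , (λ _ → (λ _ → refl) , (λ _ → refl)) ,
  (λ b → (λ i → sym (tabulate-injective (cong proj₁ (base-ι b)) i)) , (λ i →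
    sym (tabulate-injective (cong proj₂ (base-ι b)) i))) ,
  (λ (a , _) → (λ i → sym (tabulate-injective (cong (proj₂ ∘ proj₂) (key-φ a)) i)) ,
               (λ i → sym (tabulate-injective (cong (proj₁ ∘ proj₂) (key-φ a)) i)))
  where
  open Cancellation {HookPermutations n ℓ} {TableauPairs n ℓ}
    (enumeration hookCoding) (enumeration tableauCoding) (λ _ → refl) (λ _ → refl) balanced
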